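{- Let $a,b\ge 1$ be integers, $r=a+b$, and $k\ge 2$. Then, as $n\to\infty$ with $a,b,k$ fixed: (1) if $r$ is odd, then ${\rm ex}_r(n,P_{2k-1}(a,b))=(k-1)\binom{n}{r-1}+o(n^{r-1})$; (2) if $a>b$, then ${\rm ex}_r(n,P_{2k}(a,b))=(k-1)\binom{n}{r-1}+o(n^{r-1})$. Moreover, if $a\neq b$ and $a,b\ge 2$, then for all sufficiently large $n$ the $r$-graph $\Psi_{k-1}(n,r)$ is the only extremal $n$-vertex $P_{2k-1}(a,b)$-free $r$-graph (up to isomorphism).
   Context: An $r$-graph is a family of $r$-element subsets of a finite vertex set. For an $r$-graph $F$, ${\rm ex}_r(n,F)$ is the maximum number of edges of an $r$-graph on $n$ vertices containing no copy of $F$; an $F$-free $n$-vertex $r$-graph with this many edges is called extremal. The $(a,b)$-path $P_{2k-1}(a,b)$ is the $r$-graph defined as follows: take pairwise disjoint sets $A_0,B_1,A_2,B_3,\dots,A_{2k-2},B_{2k-1}$ with $|A_i|=a$ and $|B_j|=b$, listed in this linear order; its $2k-1$ edges are the unions of each two consecutive sets in this list, i.e. $A_i\cup B_{i+1}$ ($i$ even, $0\le i\le 2k-2$) and $B_j\cup A_{j+1}$ ($j$ odd, $1\le j\le 2k-3$). The path $P_{2k}(a,b)$ is obtained by adding one further $a$-set $A_{2k}$ disjoint from all previous sets, together with the edge $B_{2k-1}\cup A_{2k}$. $\Psi_{c}(n,r)$ denotes the $r$-graph on vertex set $[n]=\{1,\dots,n\}$ consisting of all $r$-subsets of $[n]$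 that meet $[c]$. -}

module Defs where

open import Data.Nat using (ℕ; zero; suc; _+_; _*_; _∸_; _^_; _≤_; _<_; _≤ᵇ_; _<ᵇ_; ∣_-_∣)
open import Data.Nat.Combinatorics using (_C_)
open import Data.Bool using (Bool; true; false; _∧_; if_then_else_)
open import Data.Fin using (Fin; toℕ)
open import Data.Fin.Subset using (Subset; ⁅_⁆; _∪_; ⊥; ∣_∣)
open import Data.Vec using (lookup; tabulate)
open import Data.List using (List; map; foldr; upTo; allFin; length)
open import Data.List.Membership.Propositional using (_∈_)
open import Data.List.Relation.Unary.All using (All)
open import Data.List.Relation.Unary.Unique.Propositional using (Unique)
open import Data.Product using (Σ; ∃; ∃-syntax; _×_; _,_)
open import Function.Definitions using (Injective)
open import Function.Bundles using (_⇔_)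
open import Relation.Binary.PropositionalEquality using (_≡_)
open import Relation.Nullary using (¬_)

IsRGraph : (r n : ℕ) → List (Subset n) → Set
IsRGraph r n H = Unique H × All (λ e → ∣ e ∣ ≡ r) H

edges : {n : ℕ} → List (Subset n) → ℕ
edges = length

Pattern : Set
Pattern = Σ ℕ (λ v → List (Subset v))

image : {v n : ℕ} → (Fin v → Fin n) → Subset v → Subset n
image {v} φ e = foldr (λ i acc → if lookup e i then ⁅ φ i ⁆ ∪ acc else acc) ⊥ (allFin v)

Contains : {n : ℕ} → List (Subset n) → Pattern → Set
Contains H (v , F) = ∃[ φ ] (Injective _≡_ _≡_ φ × All (λ e → image φ e ∈ H) F)

Extremal : (r n : ℕ) → Pattern → List (Subset n) → Set
Extremal r n F H =
  IsRGraph r n H × ¬ Contains H F ×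
  (∀ H′ → IsRGraph r n H′ → ¬ Contains H′ F → edges H′ ≤ edges H)

-- Positions of the blocks A₀,B₁,A₂,B₃,… laid out consecutively on 0,1,2,…:
-- block j starts at pos a b j (|A|=a, |B|=b).
pos : ℕ → ℕ → ℕ → ℕ
pos a b zero = zero
pos a b (suc zero) = a
pos a b (suc (suc j)) = a + b + pos a b j

interval : (v s len : ℕ) → Subset v
interval v s len = tabulate (λ x → (s ≤ᵇ toℕ x) ∧ (toℕ x <ᵇ s + len))

-- the j-th edge (j = 0,1,…) is the union of blocks j and j+1,
-- i.e. the interval [pos j, pos j + a + b).
pathEdges : (a b v L : ℕ) → List (Subset v)
pathEdges a b v L = map (λ j → interval v (pos a b j) (a + b)) (upTo L)

-- P_{2k-1}(a,b): blocks A₀,B₁,…,A_{2k-2},B_{2k-1}; k(a+b) vertices, 2k-1 edges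
Podd : (a b k : ℕ) → Pattern
Podd a b k = (k * (a + b)) , pathEdges a b (k * (a + b)) (2 * k ∸ 1)

-- P_{2k}(a,b): additionally A_{2k}; k(a+b)+a vertices, 2k edges
Peven : (a b k : ℕ) → Pattern
Peven a b k = (k * (a + b) + a) , pathEdges a b (k * (a + b) + a) (2 * k)

-- ex_r(n,F) = (k-1) C(n,r-1) + o(n^{r-1}):
-- for every ε = 1/(m+1) there is N such that for n ≥ N every extremal H satisfies
-- |e(H) - (k-1) C(n,r-1)| ≤ ε n^{r-1}.
ExAsymp : (r : ℕ) → Pattern → (k : ℕ) → Set
ExAsymp r F k = ∀ m → ∃[ N ] (∀ n → N ≤ n → ∀ (H : List (Subset n)) → Extremal r n F H →
  suc m * ∣ edges H - (k ∸ 1) * (n C (r ∸ 1)) ∣ ≤ n ^ (r ∸ 1))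

-- Ψ_c(n,r) membership: r-subsets of [n] meeting [c] (vertex i+1 of [n] is Fin index i)
InPsi : (c r n : ℕ) → Subset n → Set
InPsi c r n e = ∣ e ∣ ≡ r × ∃[ x ] (x Data.Fin.Subset.∈ e × toℕ x < c)

IsoPsi : (c r n : ℕ) → List (Subset n) → Set
IsoPsi c r n H = ∃[ σ ] (Injective _≡_ _≡_ σ × (∀ (e : Subset n) → (e ∈ H) ⇔ InPsi c r n (image σ e)))

{-# OPTIONS --safe #-}
module Submission where

-- Write r = a + b and assume a > b (reversing P_{2k-1}(a,b) swaps a and b).
--
-- A graph without P_{2k}(a,b) has no subgraph in which every facet of every edge has large degree,
-- so its edges can be charged to facets: W(S) is a bounded set of "colours" w with S ∪ {w} an edge,
-- and the number of edges is at most the sum of |W(S)| over the (r-1)-sets S.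
--
-- In a family 𝒢 of tuples a positive fraction 𝒢* has the following property: given a set X of
-- coordinates, every G ∈ 𝒢* can be moved inside 𝒢* so that X is fixed and all coordinates not
-- determined by X avoid any given small set.  This is applied to the tuples (S , w₁ , … , w_k) with
-- w_i ∈ W(S).  If 𝒢* is larger than n^{r-2}, then no r-2 coordinates determine all others, and
-- this forces, in each edge S ∪ {w_i}, enough freedom to build P_{2k}(a,b) with w_i in its i-th b-block
-- (or, in the other case, with all edges inside one class).  Hence |W(S)| ≤ k-1 for all but
-- O(n^{r-2}) sets S.  The same argument for two sets S, S′ differing in one vertex shows, when b ≥ 2,
-- that W is constant up to O(n^{r-2}) exceptions, with value L say.
--
-- If some edge misses L, then each b-subset B of it lies in at least n^{a-1}/2 ordered missing edges
-- of the star of L (otherwise a P_{2k-1}(a,b) starts with that edge and continues through L).  As every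
-- facet contains two disjoint b-sets, there are far fewer edges missing L than missing edges of the
-- star, which contradicts extremality.

open import Defs
open import Data.Nat using (ℕ; zero; suc; _+_; _∸_; _*_; _^_; _≤_; _<_; _≤ᵇ_; _<ᵇ_; z≤n; s≤s; _%_; _≤?_; _<?_; ∣_-_∣; NonZero; nonZero; >-nonZero; _⊓_)
open import Data.Nat.Properties
open import Data.Nat.Combinatorics using (_C_; nCk+nC[k+1]≡[n+1]C[k+1]; nCk≡nC[n∸k]; nCn≡1)
open import Data.Nat.DivMod using (m*n%n≡0)
open import Algebra.Properties.CommutativeSemigroup +-commutativeSemigroup using (interchange)
open import Data.Bool using (Bool; true; false; if_then_else_; _∧_; T)
import Data.Bool.Properties as Boolₚ
open import Data.Empty using (⊥; ⊥-elim)
open import Data.Unit using (⊤; tt)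
open import Data.Sum using (_⊎_; inj₁; inj₂; [_,_]′)
open import Data.Sum.Properties using (inj₁-injective)
import Data.Sum.Properties as Sumₚ
open import Data.Product using (∃-syntax; _×_; _,_; proj₁; proj₂)
import Data.Product.Properties as Productₚ
open import Data.Maybe using (Maybe; just; nothing)
open import Data.Maybe.Properties using (just-injective)
import Data.Maybe.Properties as Maybeₚ
open import Data.Fin using (Fin; toℕ; fromℕ<)
open import Data.Fin.Properties using (toℕ-injective; toℕ<n; toℕ-fromℕ<) renaming (_≟_ to _≟F_; any? to anyFin?)
open import Data.Fin.Subset using (Subset; ⁅_⁆; _∪_; ∣_∣) renaming (_∈_ to _∈ˢ_; _∉_ to _∉ˢ_; _⊆_ to _⊆ˢ_; ⊥ to ∅ˢ)
open import Data.Fin.Subset.Properties using (x∈p∪q⁻; x∈p∪q⁺; x∈⁅x⁆; x∈⁅y⁆⇒x≡y; ∉⊥; p⊂q⇒∣p∣<∣q∣; ∪-identityˡ; ∣⊥∣≡0) renaming (_∈?_ to _∈ˢ?_; _⊆?_ to _⊆ˢ?_; ⊆-antisym to ⊆ˢ-antisym)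
import Data.Vec as Vec
import Data.Vec.Properties as Vecₚ
open import Data.List using (List; []; _∷_; _++_; map; length; filter; concat; take; drop; upTo; allFin; lookup; tabulate; reverse; _∷ʳ_; concatMap; foldr; cartesianProduct)
open import Data.List.Properties using (length-map; length-++; length-take; length-drop; length-filter; length-upTo; length-tabulate; length-reverse; filter-notAll; ++-assoc; ++-identityʳ; map-++; map-∘; map-tabulate; take++drop≡id; take-all; take-take; drop-drop; unfold-reverse; concat-++; ∷-injective)
import Data.List.Properties as Listₚ
open import Data.List.Membership.Propositional using (_∈_; _∉_; find; lose)
open import Data.List.Membership.Propositional.Properties using (∈-∃++; ∈-++⁺ˡ; ∈-++⁺ʳ; ∈-++⁻; ∈-map⁺; ∈-map⁻; ∈-filter⁺; ∈-filter⁻; ∈-allFin; ∈-upTo⁺; ∈-upTo⁻; ∈-concat⁺′; ∈-concat⁻′; ∈-lookup; ∈-tabulate⁻; ∈-cartesianProduct⁺)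
open import Data.List.Relation.Unary.Any using (Any; here; there; any?)
open import Data.List.Relation.Unary.All using (All; []; _∷_; all?)
import Data.List.Relation.Unary.All as All
open import Data.List.Relation.Unary.All.Properties using (¬Any⇒All¬)
open import Data.List.Relation.Unary.AllPairs using ([]; _∷_)
import Data.List.Relation.Unary.AllPairs as AllPairs
open import Data.List.Relation.Unary.Linked using (Linked; []; [-]; _∷_)
import Data.List.Relation.Unary.Linked as Linked
open import Data.List.Relation.Unary.Unique.Propositional using (Unique)
import Data.List.Relation.Unary.Unique.Propositional.Properties as Uniqueₚ
open import Data.List.Relation.Unary.Unique.Propositional.Properties using () renaming (Unique[x∷xs]⇒x∉xs to unique-∷⁻)
open import Function using (_∘_; id)
open import Function.Bundles using (mk⇔)
open import Relation.Nullary using (¬_; Dec; yes; no; ¬?; _×-dec_; _⊎-dec_; contradiction)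
open import Relation.Nullary.Decidable using (map′; decidable-stable; _→-dec_)
open import Relation.Unary using (Decidable)
open import Relation.Binary.Definitions using (DecidableEquality; tri<; tri≈; tri>)
open import Relation.Binary.PropositionalEquality using (_≡_; _≢_; refl; sym; trans; cong; cong₂; subst; module ≡-Reasoning)

-- The freedom comes from one count. Call a coordinate of an edge tied if the other coordinates of
-- the edge, together with those outside it, determine it; each w_i is tied. If a part f of the edge
-- determined some x outside f while a second tied y also lay outside f, then the coordinates other
-- than x and y would determine x, hence y, hence everything: one coordinate too few for so large a
-- family. So the complement of f can be moved unless it contains exactly one tied coordinate. If
-- w_i alone is tied, it is kept in the fixed part; otherwise the edge is recut, where possible,
-- into an a-set and a b-set neither of which contains exactly one tied coordinate, and a > b makes
-- room for this. To compare S with S′, all k edges must still share one a-set, so the exchanged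
-- vertices lie among the b-1 companions of w_i; this is what b ≥ 2 provides. For exactness let β
-- count the ordered b-tuples inside edges missing L. Up to constants there are at least β n^(a-1)
-- missing star edges, at most β² n^(a-1-b) edges missing L, and β is at most n^(b-1); for large n
-- this forces β = 0.

private
  variable
    A B : Set
    n : ℕ

-- Lists and counting

unique-⊆-length : {xs ys : List A} → Unique xs → (∀ {x} → x ∈ xs → x ∈ ys) → length xs ≤ length ys
unique-⊆-length {xs = []} u sub = z≤n
unique-⊆-length {A} {xs = x ∷ xs} (x∉ ∷ u) sub with ∈-∃++ (sub (here refl))
... | as , bs , refl = begin
  suc (length xs)             ≤⟨ s≤s (unique-⊆-length u sub′) ⟩
  suc (length (as ++ bs))     ≡⟨ cong suc (length-++ as) ⟩
  suc (length as + length bs) ≡⟨ sym (+-suc (length as) (length bs)) ⟩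
  length as + suc (length bs) ≡⟨ sym (length-++ as) ⟩
  length (as ++ x ∷ bs)       ∎
  where
  open ≤-Reasoning
  sub′ : ∀ {y} → y ∈ xs → y ∈ as ++ bs
  sub′ {y} y∈ with ∈-++⁻ as (sub (there y∈))
  ... | inj₁ p = ∈-++⁺ˡ p
  ... | inj₂ (here refl) = contradiction refl (All.lookup x∉ y∈)
  ... | inj₂ (there p) = ∈-++⁺ʳ as p

∈-take : ∀ m {xs : List A} {x} → x ∈ take m xs → x ∈ xs
∈-take (suc m) {y ∷ xs} (here p) = here p
∈-take (suc m) {y ∷ xs} (there p) = there (∈-take m p)

∈-drop : ∀ m {xs : List A} {x} → x ∈ drop m xs → x ∈ xs
∈-drop zero p = p
∈-drop (suc m) {y ∷ xs} p = there (∈-drop m p)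

take-++-≡ : ∀ m (xs : List A) {ys} → length xs ≡ m → take m (xs ++ ys) ≡ xs
take-++-≡ .zero [] refl = refl
take-++-≡ .(suc _) (x ∷ xs) refl = cong (x ∷_) (take-++-≡ _ xs refl)

drop-++-≡ : ∀ m (xs : List A) {ys} → length xs ≡ m → drop m (xs ++ ys) ≡ ys
drop-++-≡ .zero [] refl = refl
drop-++-≡ .(suc _) (x ∷ xs) refl = drop-++-≡ _ xs refl

take-+ : ∀ i j (xs : List A) → take i xs ++ take j (drop i xs) ≡ take (i + j) xs
take-+ zero j xs = refl
take-+ (suc i) j [] = take-all j [] z≤n
take-+ (suc i) j (x ∷ xs) = cong (x ∷_) (take-+ i j xs)

unique-++⁻ : (xs : List A) {ys : List A} → Unique (xs ++ ys) → Unique xs × Unique ys × (∀ {x} → x ∈ xs → x ∉ ys)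
unique-++⁻ [] u = [] , u , λ ()
unique-++⁻ (x ∷ xs) (x∉ ∷ u) with unique-++⁻ xs u
... | ux , uy , d = (All.tabulate (λ p → All.lookup x∉ (∈-++⁺ˡ p)) ∷ ux) , uy ,
  λ { (here refl) q → All.lookup x∉ (∈-++⁺ʳ xs q) refl ; (there p) q → d p q }

unique-++⁺ : {xs ys : List A} → Unique xs → Unique ys → (∀ {x} → x ∈ xs → x ∉ ys) → Unique (xs ++ ys)
unique-++⁺ u v d = Uniqueₚ.++⁺ u v (λ (p , q) → d p q)

unique-∷⁺ : {x : A} {xs : List A} → x ∉ xs → Unique xs → Unique (x ∷ xs)
unique-∷⁺ x∉ u = All.tabulate (λ { p refl → x∉ p }) ∷ u

-- Finite sums over lists

∑ : List A → (A → ℕ) → ℕ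
∑ [] f = 0
∑ (x ∷ xs) f = f x + ∑ xs f

∑-mono : ∀ (xs : List A) {f g : A → ℕ} → (∀ {x} → x ∈ xs → f x ≤ g x) → ∑ xs f ≤ ∑ xs g
∑-mono [] h = z≤n
∑-mono (x ∷ xs) h = +-mono-≤ (h (here refl)) (∑-mono xs (h ∘ there))

∑-cong : ∀ (xs : List A) {f g : A → ℕ} → (∀ {x} → x ∈ xs → f x ≡ g x) → ∑ xs f ≡ ∑ xs g
∑-cong [] h = refl
∑-cong (x ∷ xs) h = cong₂ _+_ (h (here refl)) (∑-cong xs (h ∘ there))

∑-++ : ∀ (xs ys : List A) f → ∑ (xs ++ ys) f ≡ ∑ xs f + ∑ ys f
∑-++ [] ys f = refl
∑-++ (x ∷ xs) ys f = trans (cong (f x +_) (∑-++ xs ys f)) (sym (+-assoc (f x) _ _))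

∑-map : ∀ (g : A → B) xs f → ∑ (map g xs) f ≡ ∑ xs (f ∘ g)
∑-map g [] f = refl
∑-map g (x ∷ xs) f = cong (f (g x) +_) (∑-map g xs f)

∑-const : ∀ (xs : List A) c → ∑ xs (λ _ → c) ≡ length xs * c
∑-const [] c = refl
∑-const (x ∷ xs) c = cong (c +_) (∑-const xs c)

∑-+ : ∀ (xs : List A) f g → ∑ xs (λ x → f x + g x) ≡ ∑ xs f + ∑ xs g
∑-+ [] f g = refl
∑-+ (x ∷ xs) f g = trans (cong (f x + g x +_) (∑-+ xs f g)) (interchange (f x) (g x) _ _)

∑-*ʳ : ∀ (xs : List A) f c → ∑ xs (λ x → f x * c) ≡ ∑ xs f * c
∑-*ʳ [] f c = refl
∑-*ʳ (x ∷ xs) f c = trans (cong (f x * c +_) (∑-*ʳ xs f c)) (sym (*-distribʳ-+ c (f x) _))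

∑-swap : ∀ (xs : List A) (ys : List B) (f : A → B → ℕ) → ∑ xs (λ x → ∑ ys (f x)) ≡ ∑ ys (λ y → ∑ xs (λ x → f x y))
∑-swap [] ys f = sym (trans (∑-const ys 0) (*-zeroʳ (length ys)))
∑-swap (x ∷ xs) ys f = trans (cong (∑ ys (f x) +_) (∑-swap xs ys f)) (sym (∑-+ ys (f x) _))

∑-average : ∀ (xs : List A) {f : A → ℕ} c → 0 < length xs → ∑ xs f ≤ length xs * c → ∃[ x ] (x ∈ xs × f x ≤ c)
∑-average (x ∷ xs) {f} c _ h with f x ≤? c
... | yes p = x , here refl , p
∑-average (x ∷ []) {f} c _ h | no p = contradiction (subst (_≤ c) (+-identityʳ (f x)) (subst (f x + 0 ≤_) (+-identityʳ c) h)) p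
∑-average (x ∷ y ∷ xs) {f} c _ h | no p
  with ∑-average (y ∷ xs) c (s≤s z≤n) (+-cancelˡ-≤ c _ _ (≤-trans (+-monoˡ-≤ (∑ (y ∷ xs) f) (<⇒≤ (≰⇒> p))) h))
... | z , z∈ , q = z , there z∈ , q

length-concatMap : ∀ (f : A → List B) xs → length (concatMap f xs) ≡ ∑ xs (length ∘ f)
length-concatMap f [] = refl
length-concatMap f (x ∷ xs) = trans (length-++ (f x)) (cong (length (f x) +_) (length-concatMap f xs))

-- Counting list entries with a decidable property

𝟙 : {P : Set} → Dec P → ℕ
𝟙 (yes _) = 1
𝟙 (no _) = 0

count : {P : A → Set} → Decidable P → List A → ℕ
count P? xs = length (filter P? xs)

module _ {P : A → Set} (P? : Decidable P) where

  count≡∑ : ∀ xs → count P? xs ≡ ∑ xs (𝟙 ∘ P?)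
  count≡∑ [] = refl
  count≡∑ (x ∷ xs) with P? x
  ... | yes _ = cong suc (count≡∑ xs)
  ... | no _ = count≡∑ xs

  count-none : ∀ xs → (∀ {x} → x ∈ xs → ¬ P x) → count P? xs ≡ 0
  count-none [] h = refl
  count-none (x ∷ xs) h with P? x
  ... | yes p = contradiction p (h (here refl))
  ... | no _ = count-none xs (h ∘ there)

  count-all : ∀ xs → (∀ {x} → x ∈ xs → P x) → count P? xs ≡ length xs
  count-all [] h = refl
  count-all (x ∷ xs) h with P? x
  ... | yes p = cong suc (count-all xs (h ∘ there))
  ... | no ¬p = contradiction (h (here refl)) ¬p

  count-++ : ∀ xs ys → count P? (xs ++ ys) ≡ count P? xs + count P? ys
  count-++ xs ys = trans (count≡∑ (xs ++ ys)) (trans (∑-++ xs ys _) (sym (cong₂ _+_ (count≡∑ xs) (count≡∑ ys))))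

  count-concatMap : ∀ (f : B → List A) xs → count P? (concatMap f xs) ≡ ∑ xs (λ x → count P? (f x))
  count-concatMap f [] = refl
  count-concatMap f (x ∷ xs) = trans (count-++ (f x) _) (cong (count P? (f x) +_) (count-concatMap f xs))

  count-map : ∀ (f : B → A) xs → count P? (map f xs) ≡ count (P? ∘ f) xs
  count-map f [] = refl
  count-map f (x ∷ xs) with P? (f x)
  ... | yes _ = cong suc (count-map f xs)
  ... | no _ = count-map f xs

  count-< : ∀ xs → count P? xs < length xs → ∃[ x ] (x ∈ xs × ¬ P x)
  count-< (x ∷ xs) h with P? x
  ... | no ¬p = x , here refl , ¬p
  ... | yes _ with count-< xs (≤-pred h)
  ... | y , y∈ , q = y , there y∈ , q

module _ {P Q : A → Set} (P? : Decidable P) (Q? : Decidable Q) where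

  count-mono : ∀ xs → (∀ {x} → x ∈ xs → P x → Q x) → count P? xs ≤ count Q? xs
  count-mono [] h = z≤n
  count-mono (x ∷ xs) h with P? x | Q? x
  ... | yes p | yes q = s≤s (count-mono xs (h ∘ there))
  ... | yes p | no ¬q = contradiction (h (here refl) p) ¬q
  ... | no ¬p | yes q = m≤n⇒m≤1+n (count-mono xs (h ∘ there))
  ... | no ¬p | no ¬q = count-mono xs (h ∘ there)

count-cong : {P Q : A → Set} (P? : Decidable P) (Q? : Decidable Q) → ∀ xs →
  (∀ {x} → x ∈ xs → P x → Q x) → (∀ {x} → x ∈ xs → Q x → P x) → count P? xs ≡ count Q? xs
count-cong P? Q? xs f g = ≤-antisym (count-mono P? Q? xs f) (count-mono Q? P? xs g)

count-⊎ : {P Q R : A → Set} (P? : Decidable P) (Q? : Decidable Q) (R? : Decidable R) → ∀ xs →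
  (∀ {x} → x ∈ xs → P x → Q x ⊎ R x) → count P? xs ≤ count Q? xs + count R? xs
count-⊎ P? Q? R? [] h = z≤n
count-⊎ P? Q? R? (x ∷ xs) h with P? x | Q? x | R? x | count-⊎ P? Q? R? xs (h ∘ there)
... | no _  | yes _ | yes _ | ih = m≤n⇒m≤1+n (≤-trans ih (+-monoʳ-≤ _ (n≤1+n _)))
... | no _  | yes _ | no _  | ih = m≤n⇒m≤1+n ih
... | no _  | no _  | yes _ | ih = ≤-trans ih (+-monoʳ-≤ _ (n≤1+n _))
... | no _  | no _  | no _  | ih = ih
... | yes _ | yes _ | yes _ | ih = s≤s (≤-trans ih (+-monoʳ-≤ _ (n≤1+n _)))
... | yes _ | yes _ | no _  | ih = s≤s ih
... | yes _ | no _  | yes _ | ih = ≤-trans (s≤s ih) (≤-reflexive (sym (+-suc _ _)))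
... | yes p | no ¬q | no ¬r | ih with h (here refl) p
... | inj₁ q = contradiction q ¬q
... | inj₂ r = contradiction r ¬r

count-¬ : {P : A → Set} (P? : Decidable P) → ∀ xs → count P? xs + count (¬? ∘ P?) xs ≡ length xs
count-¬ P? [] = refl
count-¬ P? (x ∷ xs) with P? x
... | yes _ = cong suc (count-¬ P? xs)
... | no _ = trans (+-suc _ _) (cong suc (count-¬ P? xs))

count-Any : {C : Set} {P : C → A → Set} (P? : ∀ c → Decidable (P c)) → ∀ (cs : List C) xs →
  count (λ x → any? (λ c → P? c x) cs) xs ≤ ∑ cs (λ c → count (P? c) xs)
count-Any P? [] xs = ≤-reflexive (count-none _ xs (λ _ ()))
count-Any P? (c ∷ cs) xs = ≤-trans
  (count-⊎ _ (P? c) (λ x → any? (λ c → P? c x) cs) xs (λ { _ (here p) → inj₁ p ; _ (there p) → inj₂ p }))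
  (+-monoʳ-≤ _ (count-Any P? cs xs))

pigeonhole : {K : Set} (_≟_ : DecidableEquality K) (col : A → K) (ks : List K) (xs : List A) →
  0 < length ks → (∀ {x} → x ∈ xs → col x ∈ ks) →
  ∃[ c ] (c ∈ ks × length xs ≤ length ks * count (λ x → col x ≟ c) xs)
pigeonhole {A} {K} _≟_ col ks xs ne cover = c , c∈ , ≤-trans tot c-big
  where
  classes : K → ℕ
  classes c = count (λ x → col x ≟ c) xs
  tot : length xs ≤ ∑ ks classes
  tot = ≤-trans (≤-reflexive (sym (count-all (λ x → any? (λ c → col x ≟ c) ks) xs (λ p → cover p))))
                (count-Any (λ c x → col x ≟ c) ks xs)
  maximal : ∀ ls → 0 < length ls → ∃[ c ] (c ∈ ls × ∑ ls classes ≤ length ls * classes c)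
  maximal (c ∷ []) _ = c , here refl , ≤-refl
  maximal (c ∷ ls@(_ ∷ _)) _ with maximal ls (s≤s z≤n)
  ... | d , d∈ , p with classes c ≤? classes d
  ... | yes q = d , there d∈ , +-mono-≤ q p
  ... | no q = c , here refl , +-monoʳ-≤ (classes c) (≤-trans p (*-monoʳ-≤ (length ls) (<⇒≤ (≰⇒> q))))
  c = proj₁ (maximal ks ne)
  c∈ = proj₁ (proj₂ (maximal ks ne))
  c-big = proj₂ (proj₂ (maximal ks ne))

-- Tuples

tuplesOver : List A → ℕ → List (List A)
tuplesOver V zero = [] ∷ []
tuplesOver V (suc d) = concatMap (λ x → map (x ∷_) (tuplesOver V d)) V

∈-tuplesOver⁺ : ∀ (V : List A) t → (∀ {x} → x ∈ t → x ∈ V) → t ∈ tuplesOver V (length t)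
∈-tuplesOver⁺ V [] h = here refl
∈-tuplesOver⁺ V (x ∷ t) h =
  ∈-concat⁺′ (∈-map⁺ (x ∷_) (∈-tuplesOver⁺ V t (h ∘ there))) (∈-map⁺ (λ x → map (x ∷_) (tuplesOver V (length t))) (h (here refl)))

∈-tuplesOver⁻ : ∀ (V : List A) d {t} → t ∈ tuplesOver V d → length t ≡ d
∈-tuplesOver⁻ V zero (here refl) = refl
∈-tuplesOver⁻ V (suc d) t∈ with ∈-concat⁻′ (map (λ x → map (x ∷_) (tuplesOver V d)) V) t∈
... | ts , t∈ts , ts∈ with ∈-map⁻ (λ x → map (x ∷_) (tuplesOver V d)) ts∈
... | x , _ , refl with ∈-map⁻ _ t∈ts
... | s , s∈ , refl = cong suc (∈-tuplesOver⁻ V d s∈)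

length-tuplesOver : ∀ (V : List A) d → length (tuplesOver V d) ≡ length V ^ d
length-tuplesOver V zero = refl
length-tuplesOver V (suc d) = begin
  length (concatMap (λ x → map (x ∷_) (tuplesOver V d)) V) ≡⟨ length-concatMap _ V ⟩
  ∑ V (λ x → length (map (x ∷_) (tuplesOver V d)))         ≡⟨ ∑-cong V (λ {x} _ → trans (length-map (x ∷_) (tuplesOver V d)) (length-tuplesOver V d)) ⟩
  ∑ V (λ _ → length V ^ d)                                 ≡⟨ ∑-const V _ ⟩
  length V * length V ^ d                                  ∎
  where open ≡-Reasoning

unique-concatMap : ∀ (f : A → List B) xs → Unique xs → (∀ {x} → x ∈ xs → Unique (f x)) →
  (∀ {x y z} → x ∈ xs → y ∈ xs → z ∈ f x → z ∈ f y → x ≡ y) → Unique (concatMap f xs)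
unique-concatMap f [] u v d = []
unique-concatMap f (x ∷ xs) (x∉ ∷ u) v d = unique-++⁺ (v (here refl))
  (unique-concatMap f xs u (v ∘ there) (λ p q → d (there p) (there q))) sep
  where
  sep : ∀ {z} → z ∈ f x → z ∉ concatMap f xs
  sep z∈ z∈′ with ∈-concat⁻′ _ z∈′
  ... | zs , z∈zs , zs∈ with ∈-map⁻ f zs∈
  ... | y , y∈ , refl = All.lookup x∉ y∈ (d (here refl) (there y∈) z∈ z∈zs)

unique-tuplesOver : ∀ {V : List A} d → Unique V → Unique (tuplesOver V d)
unique-tuplesOver zero u = [] ∷ []
unique-tuplesOver {V = V} (suc d) u = unique-concatMap _ V u
  (λ _ → Uniqueₚ.map⁺ (λ { refl → refl }) (unique-tuplesOver d u))
  (λ _ _ p q → heads p q)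
  where
  heads : ∀ {x y z} → z ∈ map (x ∷_) (tuplesOver V d) → z ∈ map (y ∷_) (tuplesOver V d) → x ≡ y
  heads p q with ∈-map⁻ _ p | ∈-map⁻ _ q
  ... | _ , _ , refl | _ , _ , refl = refl

module _ {n : ℕ} where

  _∈F?_ : (x : Fin n) (xs : List (Fin n)) → Dec (x ∈ xs)
  x ∈F? xs = any? (x ≟F_) xs

  unique? : Decidable (Unique {A = Fin n})
  unique? [] = yes []
  unique? (x ∷ xs) with x ∈F? xs | unique? xs
  ... | yes p | _ = no (λ u → unique-∷⁻ u p)
  ... | no p | yes u = yes (unique-∷⁺ p u)
  ... | no p | no ¬u = no (λ { (_ ∷ u) → ¬u u })

module Tuples (n : ℕ) where

  Tup : Set
  Tup = List (Fin n)

  -- Sets are counted through ordered tuples: concatenation makes the counts multiplicative, at the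
  -- price of a bounded factor and of the few tuples with a repeated entry.
  tuples : ℕ → List Tup
  tuples = tuplesOver (allFin n)

  length-allFin : length (allFin n) ≡ n
  length-allFin = length-tabulate id

  length-tuples : ∀ d → length (tuples d) ≡ n ^ d
  length-tuples d = trans (length-tuplesOver (allFin n) d) (cong (_^ d) length-allFin)

  ∈-tuples : ∀ {d} {t : Tup} → length t ≡ d → t ∈ tuples d
  ∈-tuples refl = ∈-tuplesOver⁺ (allFin n) _ (λ _ → ∈-allFin _)

  tuples-length : ∀ d {t : Tup} → t ∈ tuples d → length t ≡ d
  tuples-length = ∈-tuplesOver⁻ (allFin n)

  unique-tuples : ∀ d → Unique (tuples d)
  unique-tuples d = unique-tuplesOver d (Uniqueₚ.allFin⁺ n)

  cnt : ∀ {P : Tup → Set} (d : ℕ) → Decidable P → ℕ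
  cnt d P? = count P? (tuples d)

  cnt-++ : ∀ {P : Tup → Set} (P? : Decidable P) d e → cnt (d + e) P? ≡ ∑ (tuples d) (λ x → cnt e (λ y → P? (x ++ y)))
  cnt-++ P? zero e = sym (+-identityʳ _)
  cnt-++ P? (suc d) e = begin
    count P? (concatMap (λ x → map (x ∷_) (tuples (d + e))) (allFin n))
      ≡⟨ count-concatMap P? _ (allFin n) ⟩
    ∑ (allFin n) (λ x → count P? (map (x ∷_) (tuples (d + e))))
      ≡⟨ ∑-cong (allFin n) (λ {x} _ → trans (count-map P? (x ∷_) (tuples (d + e))) (cnt-++ (P? ∘ (x ∷_)) d e)) ⟩
    ∑ (allFin n) (λ x → ∑ (tuples d) (λ t → cnt e (λ y → P? (x ∷ t ++ y))))
      ≡⟨ ∑-cong (allFin n) (λ {x} _ → sym (∑-map (x ∷_) (tuples d) _)) ⟩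
    ∑ (allFin n) (λ x → ∑ (map (x ∷_) (tuples d)) (λ t → cnt e (λ y → P? (t ++ y))))
      ≡⟨ sym (∑-concatMap (allFin n)) ⟩
    ∑ (tuples (suc d)) (λ t → cnt e (λ y → P? (t ++ y))) ∎
    where
    open ≡-Reasoning
    ∑-concatMap : ∀ xs {f : Tup → ℕ} → ∑ (concatMap (λ x → map (x ∷_) (tuples d)) xs) f ≡ ∑ xs (λ x → ∑ (map (x ∷_) (tuples d)) f)
    ∑-concatMap [] = refl
    ∑-concatMap (x ∷ xs) = trans (∑-++ (map (x ∷_) (tuples d)) _ _) (cong (_ +_) (∑-concatMap xs))

  cnt-× : ∀ {P Q : Tup → Set} (P? : Decidable P) (Q? : Decidable Q) d e →
    cnt (d + e) (λ t → P? (take d t) ×-dec Q? (drop d t)) ≡ cnt d P? * cnt e Q?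
  cnt-× {P} {Q} P? Q? d e = begin
    cnt (d + e) PQ?                                       ≡⟨ cnt-++ PQ? d e ⟩
    ∑ (tuples d) (λ x → cnt e (λ y → PQ? (x ++ y)))       ≡⟨ ∑-cong (tuples d) (λ {x} x∈ → fibre x (tuples-length d x∈)) ⟩
    ∑ (tuples d) (λ x → 𝟙 (P? x) * cnt e Q?)              ≡⟨ ∑-*ʳ (tuples d) (𝟙 ∘ P?) (cnt e Q?) ⟩
    ∑ (tuples d) (𝟙 ∘ P?) * cnt e Q?                      ≡⟨ cong (_* cnt e Q?) (sym (count≡∑ P? (tuples d))) ⟩
    cnt d P? * cnt e Q?                                   ∎
    where
    open ≡-Reasoning
    PQ? = λ t → P? (take d t) ×-dec Q? (drop d t)
    fibre : ∀ x → length x ≡ d → cnt e (λ y → PQ? (x ++ y)) ≡ 𝟙 (P? x) * cnt e Q?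
    fibre x lx with P? x
    ... | yes p = trans (count-cong (λ y → PQ? (x ++ y)) Q? (tuples e)
            (λ {y} _ (_ , q) → subst Q (drop-++-≡ d x lx) q)
            (λ {y} _ q → subst P (sym (take-++-≡ d x lx)) p , subst Q (sym (drop-++-≡ d x lx)) q)) (sym (+-identityʳ _))
    ... | no ¬p = count-none (λ y → PQ? (x ++ y)) (tuples e) (λ {y} _ (p , _) → ¬p (subst P (take-++-≡ d x lx) p))

  always : Decidable {A = Tup} (λ _ → ⊤)
  always _ = yes tt

  cnt-always : ∀ d → cnt d always ≡ n ^ d
  cnt-always d = trans (count-all always (tuples d) (λ _ → tt)) (length-tuples d)

  cnt-take : ∀ {P : Tup → Set} (P? : Decidable P) d e → cnt (d + e) (P? ∘ take d) ≡ cnt d P? * n ^ e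
  cnt-take P? d e = trans (count-cong _ (λ t → P? (take d t) ×-dec always (drop d t)) (tuples (d + e)) (λ _ p → p , tt) (λ _ → proj₁))
    (trans (cnt-× P? always d e) (cong (cnt d P? *_) (cnt-always e)))

  cnt-drop : ∀ {P : Tup → Set} (P? : Decidable P) d e → cnt (d + e) (P? ∘ drop d) ≡ n ^ d * cnt e P?
  cnt-drop P? d e = trans (count-cong _ (λ t → always (take d t) ×-dec P? (drop d t)) (tuples (d + e)) (λ _ p → tt , p) (λ _ → proj₂))
    (trans (cnt-× always P? d e) (cong (_* cnt e P?) (cnt-always d)))

  cnt-∃¬ : ∀ {P : Tup → Set} (P? : Decidable P) d → cnt d P? < n ^ d → ∃[ t ] (length t ≡ d × ¬ P t)
  cnt-∃¬ P? d h with count-< P? (tuples d) (subst (cnt d P? <_) (sym (length-tuples d)) h)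
  ... | t , t∈ , ¬p = t , tuples-length d t∈ , ¬p

  cnt-∈ : ∀ (V : Tup) → count (λ x → x ∈F? V) (allFin n) ≤ length V
  cnt-∈ V = unique-⊆-length (Uniqueₚ.filter⁺ (λ x → x ∈F? V) (Uniqueₚ.allFin⁺ n)) (λ p → proj₂ (∈-filter⁻ (λ x → x ∈F? V) {xs = allFin n} p))

  cnt-snoc : ∀ {P : Tup → Set} (P? : Decidable P) d → cnt (suc d) P? ≡ ∑ (tuples d) (λ t → count (λ x → P? (t ++ x ∷ [])) (allFin n))
  cnt-snoc P? d = trans (cong (λ m → cnt m P?) (sym (+-comm d 1))) (trans (cnt-++ P? d 1)
    (∑-cong (tuples d) (λ {t} _ → trans (count-concatMap (λ y → P? (t ++ y)) (λ x → (x ∷ []) ∷ []) (allFin n))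
      (trans (∑-cong (allFin n) (λ {x} _ → sym (single t x))) (sym (count≡∑ (λ x → P? (t ++ x ∷ [])) (allFin n)))))))
    where
    single : ∀ t x → 𝟙 (P? (t ++ x ∷ [])) ≡ count (λ y → P? (t ++ y)) ((x ∷ []) ∷ [])
    single t x with P? (t ++ x ∷ [])
    ... | yes _ = refl
    ... | no _ = refl

  cnt-¬unique : ∀ d → cnt (suc d) (¬? ∘ unique?) ≤ suc d * suc d * n ^ d
  cnt-¬unique zero = ≤-trans (≤-reflexive (count-none (¬? ∘ unique?) (tuples 1) (λ t∈ ¬u → single (tuples-length 1 t∈) ¬u))) z≤n
    where
    single : ∀ {t : Tup} → length t ≡ 1 → ¬ ¬ Unique t
    single {x ∷ []} _ ¬u = ¬u ([] ∷ [])
  cnt-¬unique (suc d) = begin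
    cnt (suc (suc d)) (¬? ∘ unique?)
      ≡⟨ cnt-snoc (¬? ∘ unique?) (suc d) ⟩
    ∑ (tuples (suc d)) (λ t → count (λ x → ¬? (unique? (t ++ x ∷ []))) (allFin n))
      ≤⟨ ∑-mono (tuples (suc d)) (λ {t} t∈ → fibre t (tuples-length (suc d) t∈)) ⟩
    ∑ (tuples (suc d)) (λ t → 𝟙 (¬? (unique? t)) * n + suc d)
      ≡⟨ ∑-+ (tuples (suc d)) _ _ ⟩
    ∑ (tuples (suc d)) (λ t → 𝟙 (¬? (unique? t)) * n) + ∑ (tuples (suc d)) (λ _ → suc d)
      ≡⟨ cong₂ _+_ (trans (∑-*ʳ (tuples (suc d)) _ n) (cong (_* n) (sym (count≡∑ (¬? ∘ unique?) (tuples (suc d)))))) (∑-const (tuples (suc d)) (suc d)) ⟩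
    cnt (suc d) (¬? ∘ unique?) * n + length (tuples (suc d)) * suc d
      ≡⟨ cong (λ z → cnt (suc d) (¬? ∘ unique?) * n + z) (trans (cong (_* suc d) (length-tuples (suc d))) (*-comm (n ^ suc d) (suc d))) ⟩
    cnt (suc d) (¬? ∘ unique?) * n + suc d * n ^ suc d
      ≤⟨ +-monoˡ-≤ (suc d * n ^ suc d) (*-monoˡ-≤ n (cnt-¬unique d)) ⟩
    suc d * suc d * n ^ d * n + suc d * n ^ suc d
      ≡⟨ cong (_+ suc d * n ^ suc d) (trans (*-assoc (suc d * suc d) (n ^ d) n) (cong (suc d * suc d *_) (*-comm (n ^ d) n))) ⟩
    suc d * suc d * n ^ suc d + suc d * n ^ suc d
      ≡⟨ sym (*-distribʳ-+ (n ^ suc d) (suc d * suc d) (suc d)) ⟩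
    (suc d * suc d + suc d) * n ^ suc d
      ≤⟨ *-monoˡ-≤ (n ^ suc d) (≤-trans (≤-reflexive (+-comm (suc d * suc d) (suc d))) (*-monoʳ-≤ (suc (suc d)) (n≤1+n (suc d)))) ⟩
    suc (suc d) * suc (suc d) * n ^ suc d ∎
    where
    open ≤-Reasoning
    fibre : ∀ t → length t ≡ suc d → count (λ x → ¬? (unique? (t ++ x ∷ []))) (allFin n) ≤ 𝟙 (¬? (unique? t)) * n + suc d
    fibre t lt with unique? t
    ... | no _ = ≤-trans (length-filter (λ x → ¬? (unique? (t ++ x ∷ []))) (allFin n))
      (≤-trans (≤-reflexive (trans length-allFin (sym (+-identityʳ n)))) (m≤m+n (n + 0) (suc d)))
    ... | yes u = ≤-trans (count-mono _ (λ x → x ∈F? t) (allFin n) repeated) (≤-trans (cnt-∈ t) (≤-reflexive lt))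
      where
      repeated : ∀ {x} → x ∈ allFin n → ¬ Unique (t ++ x ∷ []) → x ∈ t
      repeated {x} _ ¬u with x ∈F? t
      ... | yes p = p
      ... | no p = contradiction (unique-++⁺ u ([] ∷ []) (λ { q (here refl) → p q })) ¬u

  meets? : ∀ (V : Tup) → Decidable (Any (_∈ V))
  meets? V = any? (λ x → x ∈F? V)

  cnt-meets : ∀ (V : Tup) d → cnt (suc d) (meets? V) ≤ suc d * length V * n ^ d
  cnt-meets V d = begin
    cnt (suc d) (meets? V)
      ≡⟨ count-concatMap (meets? V) _ (allFin n) ⟩
    ∑ (allFin n) (λ x → count (meets? V) (map (x ∷_) (tuples d)))
      ≤⟨ ∑-mono (allFin n) (λ {x} _ → ≤-trans (≤-reflexive (count-map (meets? V) (x ∷_) (tuples d))) (fibre x)) ⟩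
    ∑ (allFin n) (λ x → 𝟙 (x ∈F? V) * n ^ d + cnt d (meets? V))
      ≡⟨ ∑-+ (allFin n) _ _ ⟩
    ∑ (allFin n) (λ x → 𝟙 (x ∈F? V) * n ^ d) + ∑ (allFin n) (λ _ → cnt d (meets? V))
      ≡⟨ cong₂ _+_ (trans (∑-*ʳ (allFin n) _ (n ^ d)) (cong (_* n ^ d) (sym (count≡∑ (λ x → x ∈F? V) (allFin n)))))
                   (trans (∑-const (allFin n) _) (cong (_* cnt d (meets? V)) length-allFin)) ⟩
    count (λ x → x ∈F? V) (allFin n) * n ^ d + n * cnt d (meets? V)
      ≤⟨ +-mono-≤ (*-monoˡ-≤ (n ^ d) (cnt-∈ V)) (rest d) ⟩
    length V * n ^ d + d * length V * n ^ d
      ≡⟨ sym (*-distribʳ-+ (n ^ d) (length V) (d * length V)) ⟩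
    suc d * length V * n ^ d ∎
    where
    open ≤-Reasoning
    fibre : ∀ x → count (λ t → meets? V (x ∷ t)) (tuples d) ≤ 𝟙 (x ∈F? V) * n ^ d + cnt d (meets? V)
    fibre x = byCase (x ∈F? V)
      where
      byCase : (h : Dec (x ∈ V)) → count (λ t → meets? V (x ∷ t)) (tuples d) ≤ 𝟙 h * n ^ d + cnt d (meets? V)
      byCase (yes p) = ≤-trans (length-filter (λ t → meets? V (x ∷ t)) (tuples d))
        (≤-trans (≤-reflexive (trans (length-tuples d) (sym (+-identityʳ _)))) (m≤m+n _ _))
      byCase (no ¬p) = count-mono (λ t → meets? V (x ∷ t)) (meets? V) (tuples d) (λ { _ (here p) → contradiction p ¬p ; _ (there p) → p })
    rest : ∀ d → n * cnt d (meets? V) ≤ d * length V * n ^ d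
    rest zero = ≤-reflexive (*-zeroʳ n)
    rest (suc d) = ≤-trans (*-monoʳ-≤ n (cnt-meets V d)) (≤-reflexive (begin-equality
      n * (suc d * length V * n ^ d) ≡⟨ sym (*-assoc n (suc d * length V) (n ^ d)) ⟩
      n * (suc d * length V) * n ^ d ≡⟨ cong (_* n ^ d) (*-comm n (suc d * length V)) ⟩
      suc d * length V * n * n ^ d   ≡⟨ *-assoc (suc d * length V) n (n ^ d) ⟩
      suc d * length V * n ^ suc d   ∎))

-- Separating the classes of a family of tuples

∑-max : ∀ (xs : List A) {f : A → ℕ} c → 0 < length xs → length xs * c ≤ ∑ xs f → ∃[ x ] (x ∈ xs × c ≤ f x)
∑-max (x ∷ xs) {f} c _ h with c ≤? f x
... | yes p = x , here refl , p
∑-max (x ∷ []) {f} c _ h | no p = contradiction (subst (_≤ f x) (+-identityʳ c) (subst (c + 0 ≤_) (+-identityʳ (f x)) h)) p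
∑-max (x ∷ y ∷ xs) {f} c _ h | no p
  with ∑-max (y ∷ xs) c (s≤s z≤n) (+-cancelˡ-≤ c _ _ (≤-trans h (+-monoˡ-≤ (∑ (y ∷ xs) f) (<⇒≤ (≰⇒> p)))))
... | z , z∈ , q = z , there z∈ , q

-- All 0/1-labellings of the vertices; averaging over this list replaces the choice of a random
-- bipartition.
bitVectors : ∀ n → List (Vec.Vec Bool n)
bitVectors zero = Vec.[] ∷ []
bitVectors (suc n) = map (true Vec.∷_) (bitVectors n) ++ map (false Vec.∷_) (bitVectors n)

length-bitVectors : ∀ n → length (bitVectors n) ≡ 2 ^ n
length-bitVectors zero = refl
length-bitVectors (suc n) = trans (length-++ (map (true Vec.∷_) (bitVectors n)))
  (cong₂ _+_ (trans (length-map _ (bitVectors n)) (length-bitVectors n))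
             (trans (length-map _ (bitVectors n)) (trans (length-bitVectors n) (sym (+-identityʳ _)))))

count-bitVectors-suc : ∀ n {P : Vec.Vec Bool (suc n) → Set} (P? : Decidable P) →
  count P? (bitVectors (suc n)) ≡ count (P? ∘ (true Vec.∷_)) (bitVectors n) + count (P? ∘ (false Vec.∷_)) (bitVectors n)
count-bitVectors-suc n P? = trans (count-++ P? (map (true Vec.∷_) (bitVectors n)) _)
  (cong₂ _+_ (count-map P? _ (bitVectors n)) (count-map P? _ (bitVectors n)))

count-bit : ∀ n (u : Fin n) b → 2 * count (λ Z → Vec.lookup Z u Boolₚ.≟ b) (bitVectors n) ≡ 2 ^ n
count-bit (suc n) Fin.zero true = cong (2 *_) (trans (count-bitVectors-suc n _)
  (trans (cong₂ _+_ (count-all _ (bitVectors n) (λ _ → refl)) (count-none _ (bitVectors n) (λ _ ()))) (trans (+-identityʳ _) (length-bitVectors n))))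
count-bit (suc n) Fin.zero false = cong (2 *_) (trans (count-bitVectors-suc n _)
  (trans (cong₂ _+_ (count-none _ (bitVectors n) (λ _ ())) (count-all _ (bitVectors n) (λ _ → refl))) (length-bitVectors n)))
count-bit (suc n) (Fin.suc u) b = cong (2 *_) (trans (count-bitVectors-suc n _) (trans (cong (c +_) (sym (+-identityʳ c))) (count-bit n u b)))
  where c = count (λ Z → Vec.lookup Z u Boolₚ.≟ b) (bitVectors n)

separated? : ∀ {n} (u v : Fin n) → Decidable (λ Z → Vec.lookup Z u ≡ true × Vec.lookup Z v ≡ false)
separated? u v Z = (Vec.lookup Z u Boolₚ.≟ true) ×-dec (Vec.lookup Z v Boolₚ.≟ false)

count-separated : ∀ n (u v : Fin n) → u ≢ v → 4 * count (separated? u v) (bitVectors n) ≡ 2 ^ n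
count-separated (suc n) Fin.zero Fin.zero ne = contradiction refl ne
count-separated (suc n) Fin.zero (Fin.suc v) ne = begin
  4 * count (separated? Fin.zero (Fin.suc v)) (bitVectors (suc n))
    ≡⟨ cong (4 *_) (trans (count-bitVectors-suc n _) (cong₂ _+_
         (count-cong _ (λ Z → Vec.lookup Z v Boolₚ.≟ false) (bitVectors n) (λ _ → proj₂) (λ _ p → refl , p))
         (count-none _ (bitVectors n) (λ { _ (() , _) })))) ⟩
  4 * (c + 0) ≡⟨ cong (4 *_) (+-identityʳ c) ⟩
  4 * c       ≡⟨ *-assoc 2 2 c ⟩
  2 * (2 * c) ≡⟨ cong (2 *_) (count-bit n v false) ⟩
  2 ^ suc n   ∎
  where
  open ≡-Reasoning
  c = count (λ Z → Vec.lookup Z v Boolₚ.≟ false) (bitVectors n)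
count-separated (suc n) (Fin.suc u) Fin.zero ne = begin
  4 * count (separated? (Fin.suc u) Fin.zero) (bitVectors (suc n))
    ≡⟨ cong (4 *_) (trans (count-bitVectors-suc n _) (cong₂ _+_
         (count-none _ (bitVectors n) (λ { _ (_ , ()) }))
         (count-cong _ (λ Z → Vec.lookup Z u Boolₚ.≟ true) (bitVectors n) (λ _ → proj₁) (λ _ p → p , refl)))) ⟩
  4 * c       ≡⟨ *-assoc 2 2 c ⟩
  2 * (2 * c) ≡⟨ cong (2 *_) (count-bit n u true) ⟩
  2 ^ suc n   ∎
  where
  open ≡-Reasoning
  c = count (λ Z → Vec.lookup Z u Boolₚ.≟ true) (bitVectors n)
count-separated (suc n) (Fin.suc u) (Fin.suc v) ne = begin
  4 * count (separated? (Fin.suc u) (Fin.suc v)) (bitVectors (suc n)) ≡⟨ cong (4 *_) (count-bitVectors-suc n _) ⟩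
  4 * (c + c)    ≡⟨ *-distribˡ-+ 4 c c ⟩
  4 * c + 4 * c  ≡⟨ cong₂ _+_ ih (trans ih (sym (+-identityʳ _))) ⟩
  2 ^ suc n      ∎
  where
  open ≡-Reasoning
  c = count (separated? u v) (bitVectors n)
  ih : 4 * c ≡ 2 ^ n
  ih = count-separated n u v (ne ∘ cong Fin.suc)

-- Indexing, sublists and bounded search

at : List A → ℕ → Maybe A
at [] i = nothing
at (x ∷ xs) zero = just x
at (x ∷ xs) (suc i) = at xs i

∈⇒at : ∀ {x : A} {xs} → x ∈ xs → ∃[ i ] (i < length xs × at xs i ≡ just x)
∈⇒at (here refl) = 0 , s≤s z≤n , refl
∈⇒at (there p) with ∈⇒at p
... | i , lt , eq = suc i , s≤s lt , eq

sublists : List A → List (List A)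
sublists [] = [] ∷ []
sublists (x ∷ xs) = map (x ∷_) (sublists xs) ++ sublists xs

filter∈sublists : ∀ {P : A → Set} (P? : Decidable P) xs → filter P? xs ∈ sublists xs
filter∈sublists P? [] = here refl
filter∈sublists P? (x ∷ xs) with P? x
... | yes _ = ∈-++⁺ˡ (∈-map⁺ (x ∷_) (filter∈sublists P? xs))
... | no _ = ∈-++⁺ʳ (map (x ∷_) (sublists xs)) (filter∈sublists P? xs)

-- Decides whether a small blocking set exists, the case distinction on which `colouring` recurses.
anyList? : ∀ {n} s {P : List (Fin n) → Set} → Decidable P → Dec (∃[ U ] (length U ≤ s × P U))
anyList? s {P} P? with P? []
... | yes p = yes ([] , z≤n , p)
anyList? zero P? | no ¬p = no λ { ([] , _ , p) → ¬p p }
anyList? (suc s) P? | no ¬p with anyFin? (λ x → anyList? s (λ U → P? (x ∷ U)))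
... | yes (x , U , le , p) = yes (x ∷ U , s≤s le , p)
... | no ¬q = no λ { ([] , _ , p) → ¬p p ; (x ∷ U , s≤s le , p) → ¬q (x , U , le , p) }

-- Kernels in families of tuples

module Kernel (Pos : Set) (_≟P_ : DecidableEquality Pos) (ps : List Pos) (∈ps : ∀ p → p ∈ ps) (s : ℕ) where

  _∈P?_ : (p : Pos) (F : List Pos) → Dec (p ∈ F)
  p ∈P? F = any? (p ≟P_) F

  Colour : Set
  Colour = Maybe (List Pos × Pos × ℕ)

  _≟C_ : DecidableEquality Colour
  _≟C_ = Maybeₚ.≡-dec (Productₚ.≡-dec (Listₚ.≡-dec _≟P_) (Productₚ.≡-dec _≟P_ _≟_))

  colours : List (List Pos) → List Colour
  colours 𝓕 = nothing ∷ concatMap (λ F → concatMap (λ p → map (λ i → just (F , p , i)) (upTo s)) ps) 𝓕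

  length-colours : ∀ 𝓕 → length (colours 𝓕) ≡ suc (length 𝓕 * (length ps * s))
  length-colours 𝓕 = cong suc (trans (length-concatMap _ 𝓕) (trans (∑-cong 𝓕 (λ {F} _ → trans (length-concatMap _ ps)
    (trans (∑-cong ps (λ {p} _ → trans (length-map (λ i → just (F , p , i)) (upTo s)) (length-upTo s))) (∑-const ps s)))) (∑-const 𝓕 _)))

  ∈-colours : ∀ {𝓕 F p i} → F ∈ 𝓕 → i < s → just (F , p , i) ∈ colours 𝓕
  ∈-colours {𝓕} {F} {p} {i} F∈ i< = there (∈-concat⁺′
    (∈-concat⁺′ (∈-map⁺ (λ i → just (F , p , i)) (∈-upTo⁺ i<)) (∈-map⁺ (λ p → map (λ i → just (F , p , i)) (upTo s)) (∈ps p)))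
    (∈-map⁺ (λ F → concatMap (λ p → map (λ i → just (F , p , i)) (upTo s)) ps) F∈))

  -- Each round of `kernels` keeps one colour class and settles one set of `𝓕`. With at most m+1
  -- sets left there are at most 1 + (m+1) · |ps| · s colours: `nothing` and the triples (F , p ,
  -- i).
  kernelBound : ℕ → ℕ
  kernelBound zero = 1
  kernelBound (suc m) = suc (suc m * (length ps * s)) * kernelBound m

  kernelBound≥1 : ∀ m → 1 ≤ kernelBound m
  kernelBound≥1 zero = s≤s z≤n
  kernelBound≥1 (suc m) = ≤-trans (kernelBound≥1 m) (m≤m+n _ _)

  module Family {n : ℕ} {T : Set} (lk : T → Pos → Fin n) where

    Agree : List Pos → T → T → Set
    Agree F G G′ = All (λ p → lk G p ≡ lk G′ p) F

    agree? : ∀ F G → Decidable (Agree F G)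
    agree? F G G′ = all? (λ p → lk G p ≟F lk G′ p) F

    Agree-trans : ∀ {F G G′ G″} → Agree F G G′ → Agree F G′ G″ → Agree F G G″
    Agree-trans p q = All.zipWith (λ (e , f) → trans e f) (p , q)

    Agree-sym : ∀ {F G G′} → Agree F G G′ → Agree F G′ G
    Agree-sym = All.map sym

    Hit : List Pos → List (Fin n) → T → Set
    Hit F U G = Any (λ p → p ∉ F × lk G p ∈ U) ps

    hit? : ∀ F U → Decidable (Hit F U)
    hit? F U G = any? (λ p → ¬? (p ∈P? F) ×-dec (lk G p ∈F? U)) ps

    Det : List T → List Pos → Pos → Set
    Det 𝒢 F p = ∀ {G G′} → G ∈ 𝒢 → G′ ∈ 𝒢 → Agree F G G′ → lk G p ≡ lk G′ p

    Dependent : List T → List Pos → Set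
    Dependent 𝒢 F = ∃[ p ] (p ∉ F × Det 𝒢 F p)

    -- The counterpart of being the kernel of a large sunflower in Füredi's delta-system method: no
    -- `s` vertices meet, outside `F`, all members that agree with `G` on `F`.
    Avoiding : List T → List Pos → Set
    Avoiding 𝒢 F = ∀ {G} → G ∈ 𝒢 → ∀ U → length U ≤ s → ∃[ G′ ] (G′ ∈ 𝒢 × Agree F G G′ × ¬ Hit F U G′)

    -- The colour (F , p , i) is given to the tuples whose entry at p is the i-th element of a small
    -- set U met, outside F, by every remaining tuple agreeing with them on F.
    record Colouring (𝓕 : List (List Pos)) (𝒢 : List T) : Set where
      field
        col : T → Colour
        valid : ∀ {G F p i} → G ∈ 𝒢 → col G ≡ just (F , p , i) → F ∈ 𝓕 × p ∉ F × i < s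
        kept : ∀ {G} → G ∈ 𝒢 → col G ≡ nothing → ∀ {F} → F ∈ 𝓕 → ∀ U → length U ≤ s →
          ∃[ G′ ] (G′ ∈ 𝒢 × col G′ ≡ nothing × Agree F G G′ × ¬ Hit F U G′)
        determined : ∀ {G G′ F p i} → G ∈ 𝒢 → G′ ∈ 𝒢 → col G ≡ just (F , p , i) → col G′ ≡ just (F , p , i) →
          Agree F G G′ → lk G p ≡ lk G′ p

    Blocked : List T → T → List Pos → List (Fin n) → Set
    Blocked 𝒢 G F U = All (λ G′ → Agree F G G′ → Hit F U G′) 𝒢

    blocked? : ∀ 𝒢 G F → Decidable (Blocked 𝒢 G F)
    blocked? 𝒢 G F U = all? (λ G′ → agree? F G G′ →-dec hit? F U G′) 𝒢

    findBlocked : ∀ 𝓕 𝒢 → Dec (Any (λ G → Any (λ F → ∃[ U ] (length U ≤ s × Blocked 𝒢 G F U)) 𝓕) 𝒢)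
    findBlocked 𝓕 𝒢 = any? (λ G → any? (λ F → anyList? s (blocked? 𝒢 G F)) 𝓕) 𝒢

    colourHit : ∀ {G} F U → Dec (Hit F U G) → Colour
    colourHit {G} F U (yes h) with find h
    ... | p , _ , _ , q = just (F , p , proj₁ (∈⇒at q))
    colourHit F U (no _) = nothing

    colourHit-just : ∀ {G F U F′ p i} (h? : Dec (Hit F U G)) → length U ≤ s → colourHit F U h? ≡ just (F′ , p , i) →
      F′ ≡ F × p ∉ F × i < s × at U i ≡ just (lk G p)
    colourHit-just {G} {F} {U} (yes h) le eq with find h
    colourHit-just (yes h) le refl | p , _ , p∉ , q with ∈⇒at q
    ... | i , lt , e = refl , p∉ , <-≤-trans lt le , e

    colourHit-nothing : ∀ {G F U} (h? : Dec (Hit F U G)) → Hit F U G → colourHit F U h? ≢ nothing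
    colourHit-nothing {G} {F} {U} (yes h) _ eq with find h
    colourHit-nothing (yes h) _ () | _
    colourHit-nothing (no ¬h) h _ = ¬h h

    -- While some class of tuples agreeing on an `F` is blocked by a small `U`, the whole class is
    -- coloured and deleted. Deleting it as a whole is what gives `determined`: tuples that agree on
    -- `F` and both have a colour with this `F` were deleted together, so the index i refers to the
    -- same `U`. `m` only bounds the recursion.
    colouring : ∀ 𝓕 m 𝒢 → length 𝒢 ≤ m → Colouring 𝓕 𝒢
    colouring 𝓕 m 𝒢 le with findBlocked 𝓕 𝒢
    ... | no ¬b = record
      { col = λ _ → nothing
      ; valid = λ _ ()
      ; kept = λ {G} G∈ _ {F} F∈ U len → kept′ G∈ F∈ U len
      ; determined = λ _ _ ()
      }
      where
      kept′ : ∀ {G} → G ∈ 𝒢 → ∀ {F} → F ∈ 𝓕 → ∀ U → length U ≤ s → ∃[ G′ ] (G′ ∈ 𝒢 × nothing ≡ nothing × Agree F G G′ × ¬ Hit F U G′)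
      kept′ {G} G∈ {F} F∈ U len with any? (λ G′ → agree? F G G′ ×-dec ¬? (hit? F U G′)) 𝒢
      ... | yes a with find a
      ... | G′ , G′∈ , ag , nh = G′ , G′∈ , refl , ag , nh
      kept′ {G} G∈ {F} F∈ U len | no ¬a = contradiction (lose G∈ (lose F∈ (U , len , All.tabulate blocked))) ¬b
        where
        blocked : ∀ {G′} → G′ ∈ 𝒢 → Agree F G G′ → Hit F U G′
        blocked {G′} G′∈ ag with hit? F U G′
        ... | yes h = h
        ... | no nh = contradiction (lose G′∈ (ag , nh)) ¬a
    colouring 𝓕 zero [] le | yes ()
    colouring 𝓕 (suc m) 𝒢 le | yes b with find b
    ... | G₀ , G₀∈ , b′ with find b′
    ... | F₀ , F₀∈ , U₀ , len , bl = record
      { col = col′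
      ; valid = valid′
      ; kept = kept′
      ; determined = determined′
      }
      where
      rest : List T
      rest = filter (¬? ∘ agree? F₀ G₀) 𝒢
      self : Agree F₀ G₀ G₀
      self = All.tabulate (λ _ → refl)
      rest< : length rest < length 𝒢
      rest< = filter-notAll (¬? ∘ agree? F₀ G₀) 𝒢 (lose G₀∈ (λ ¬a → ¬a self))
      open Colouring (colouring 𝓕 m rest (≤-pred (≤-trans rest< le)))
      choose : ∀ {G} → Dec (Agree F₀ G₀ G) → Colour
      choose {G} (yes _) = colourHit F₀ U₀ (hit? F₀ U₀ G)
      choose {G} (no _) = col G
      col′ : T → Colour
      col′ G = choose (agree? F₀ G₀ G)
      rest∈ : ∀ {G} → G ∈ rest → G ∈ 𝒢 × ¬ Agree F₀ G₀ G
      rest∈ = ∈-filter⁻ (¬? ∘ agree? F₀ G₀)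
      ∈rest : ∀ {G} → G ∈ 𝒢 → ¬ Agree F₀ G₀ G → G ∈ rest
      ∈rest = ∈-filter⁺ (¬? ∘ agree? F₀ G₀)
      valid′ : ∀ {G F p i} → G ∈ 𝒢 → col′ G ≡ just (F , p , i) → F ∈ 𝓕 × p ∉ F × i < s
      valid′ {G} G∈ eq with agree? F₀ G₀ G
      ... | no ¬a = valid (∈rest G∈ ¬a) eq
      ... | yes a with colourHit-just (hit? F₀ U₀ G) len eq
      ... | refl , p∉ , lt , _ = F₀∈ , p∉ , lt
      kept′ : ∀ {G} → G ∈ 𝒢 → col′ G ≡ nothing → ∀ {F} → F ∈ 𝓕 → ∀ U → length U ≤ s →
          ∃[ G′ ] (G′ ∈ 𝒢 × col′ G′ ≡ nothing × Agree F G G′ × ¬ Hit F U G′)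
      kept′ {G} G∈ eq F∈ U len′ with agree? F₀ G₀ G
      ... | yes a = contradiction eq (colourHit-nothing (hit? F₀ U₀ G) (All.lookup bl G∈ a))
      ... | no ¬a with kept (∈rest G∈ ¬a) eq F∈ U len′
      ... | G′ , G′∈ , c , ag , nh = G′ , proj₁ (rest∈ G′∈) , same , ag , nh
        where
        same : col′ G′ ≡ nothing
        same with agree? F₀ G₀ G′
        ... | yes a = contradiction a (proj₂ (rest∈ G′∈))
        ... | no _ = c
      determined′ : ∀ {G G′ F p i} → G ∈ 𝒢 → G′ ∈ 𝒢 → col′ G ≡ just (F , p , i) → col′ G′ ≡ just (F , p , i) →
          Agree F G G′ → lk G p ≡ lk G′ p
      determined′ {G} {G′} G∈ G′∈ e e′ ag with agree? F₀ G₀ G | agree? F₀ G₀ G′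
      ... | no ¬a | no ¬a′ = determined (∈rest G∈ ¬a) (∈rest G′∈ ¬a′) e e′ ag
      ... | yes a | yes a′ with colourHit-just (hit? F₀ U₀ G) len e | colourHit-just (hit? F₀ U₀ G′) len e′
      ... | _ , _ , _ , q | _ , _ , _ , q′ = just-injective (trans (sym q) q′)
      determined′ {G} {G′} G∈ G′∈ e e′ ag | yes a | no ¬a′ with colourHit-just (hit? F₀ U₀ G) len e
      ... | refl , _ = contradiction (Agree-trans a ag) ¬a′
      determined′ {G} {G′} G∈ G′∈ e e′ ag | no ¬a | yes a′ with colourHit-just (hit? F₀ U₀ G′) len e′
      ... | refl , _ = contradiction (Agree-trans a′ (Agree-sym ag)) ¬a

    Kernels : ℕ → List (List Pos) → List T → Set
    Kernels m 𝓕 𝒢 = ∃[ 𝒢* ] ((∀ {G} → G ∈ 𝒢* → G ∈ 𝒢) × (Unique 𝒢 → Unique 𝒢*) ×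
      length 𝒢 ≤ kernelBound m * length 𝒢* × (∀ {F} → F ∈ 𝓕 → Dependent 𝒢* F ⊎ Avoiding 𝒢* F))

    -- Pass to the most frequent colour. If it is `nothing`, the tuples that were never deleted
    -- avoid small sets for every `F` at once. If it is (F₁ , p₁ , i₁), then `F₁` determines `p₁` on
    -- the class; this passes to subfamilies, so `F₁` is settled and leaves `𝓕`. `Avoiding` is not
    -- inherited, hence it is only concluded at the end of the recursion.
    kernels : ∀ m 𝓕 → length 𝓕 ≤ m → ∀ 𝒢 → Kernels m 𝓕 𝒢
    kernels zero [] le 𝒢 = 𝒢 , id , id , ≤-reflexive (sym (+-identityʳ _)) , λ ()
    kernels (suc m) 𝓕 le 𝒢
      with pigeonhole _≟C_ col (colours 𝓕) 𝒢 (s≤s z≤n) (λ {G} G∈ → covered G G∈)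
      where
      open Colouring (colouring 𝓕 (length 𝒢) 𝒢 ≤-refl)
      covered : ∀ G → G ∈ 𝒢 → col G ∈ colours 𝓕
      covered G G∈ with col G in eq
      ... | nothing = here refl
      ... | just (F , p , i) = ∈-colours (proj₁ (valid G∈ eq)) (proj₂ (proj₂ (valid G∈ eq)))
    ... | c , c∈ , big = go c big
      where
      open Colouring (colouring 𝓕 (length 𝒢) 𝒢 ≤-refl)
      κ = suc (suc m * (length ps * s))
      κ-bound : length (colours 𝓕) ≤ κ
      κ-bound = ≤-trans (≤-reflexive (length-colours 𝓕)) (s≤s (*-monoˡ-≤ (length ps * s) le))
      go : ∀ c → length 𝒢 ≤ length (colours 𝓕) * count (λ G → col G ≟C c) 𝒢 →
        Kernels (suc m) 𝓕 𝒢
      go nothing big = filter good? 𝒢 , (λ p → proj₁ (∈-filter⁻ good? p)) , Uniqueₚ.filter⁺ good? , size , λ F∈ → inj₂ (avoid F∈)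
        where
        good? = λ G → col G ≟C nothing
        size : length 𝒢 ≤ kernelBound (suc m) * count good? 𝒢
        size = ≤-trans big (*-monoˡ-≤ (count good? 𝒢) (≤-trans κ-bound
          (≤-trans (≤-reflexive (sym (*-identityʳ κ))) (*-monoʳ-≤ κ (kernelBound≥1 m)))))
        avoid : ∀ {F} → F ∈ 𝓕 → Avoiding (filter good? 𝒢) F
        avoid F∈ G∈ U len with kept (proj₁ (∈-filter⁻ good? {xs = 𝒢} G∈)) (proj₂ (∈-filter⁻ good? {xs = 𝒢} G∈)) F∈ U len
        ... | G′ , G′∈ , e , ag , nh = G′ , ∈-filter⁺ good? G′∈ e , ag , nh
      go (just (F₁ , p₁ , i₁)) big = result
        where
        class? = λ G → col G ≟C just (F₁ , p₁ , i₁)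
        𝒢₁ = filter class? 𝒢
        𝓕₁ = filter (λ F → ¬? (Listₚ.≡-dec _≟P_ F F₁)) 𝓕
        in₁ : ∀ {G} → G ∈ 𝒢₁ → G ∈ 𝒢 × col G ≡ just (F₁ , p₁ , i₁)
        in₁ = ∈-filter⁻ class?
        split : Kernels m 𝓕₁ 𝒢₁ →
           F₁ ∈ 𝓕 → p₁ ∉ F₁ → Kernels (suc m) 𝓕 𝒢
        split (𝒢* , sub , uq , size , alt) F₁∈ p₁∉ = 𝒢* , (λ q → proj₁ (in₁ (sub q))) , (λ u → uq (Uniqueₚ.filter⁺ class? u)) , size′ , alt′
          where
          size′ : length 𝒢 ≤ kernelBound (suc m) * length 𝒢*
          size′ = ≤-trans big (≤-trans (*-mono-≤ κ-bound size) (≤-reflexive (sym (*-assoc κ (kernelBound m) (length 𝒢*)))))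
          alt′ : ∀ {F} → F ∈ 𝓕 → Dependent 𝒢* F ⊎ Avoiding 𝒢* F
          alt′ {F} F∈ with Listₚ.≡-dec _≟P_ F F₁
          ... | no ne = alt (∈-filter⁺ (λ F → ¬? (Listₚ.≡-dec _≟P_ F F₁)) F∈ ne)
          ... | yes refl = inj₁ (p₁ , p₁∉ , λ G∈ G′∈ ag →
            determined (proj₁ (in₁ (sub G∈))) (proj₁ (in₁ (sub G′∈))) (proj₂ (in₁ (sub G∈))) (proj₂ (in₁ (sub G′∈))) ag)
        result : Kernels (suc m) 𝓕 𝒢
        result = byMembers 𝒢₁ refl
          where
          byMembers : ∀ l → 𝒢₁ ≡ l → Kernels (suc m) 𝓕 𝒢
          byMembers [] eq₁ = [] , (λ ()) , (λ _ → []) , empty , λ _ → inj₂ (λ ())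
            where
            empty : length 𝒢 ≤ kernelBound (suc m) * 0
            empty = ≤-trans big (≤-reflexive (trans (cong (λ z → length (colours 𝓕) * length z) eq₁)
              (trans (*-zeroʳ (length (colours 𝓕))) (sym (*-zeroʳ (kernelBound (suc m)))))))
          byMembers (G₁ ∷ _) eq₁ with in₁ (subst (G₁ ∈_) (sym eq₁) (here refl))
          ... | G₁∈ , e₁ with valid G₁∈ e₁
          ... | F₁∈ , p₁∉ , _ = split (kernels m 𝓕₁ len₁ 𝒢₁) F₁∈ p₁∉
            where
            len₁ : length 𝓕₁ ≤ m
            len₁ = ≤-pred (≤-trans (filter-notAll (λ F → ¬? (Listₚ.≡-dec _≟P_ F F₁)) 𝓕 (lose F₁∈ (λ ne → ne refl))) le)

    det? : ∀ 𝒢 X p → Dec (Det 𝒢 X p)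
    det? 𝒢 X p = map′ (λ h {G} {G′} G∈ G′∈ → All.lookup (All.lookup h G∈) G′∈) (λ h → All.tabulate (λ G∈ → All.tabulate (λ G′∈ → h G∈ G′∈)))
      (all? (λ G → all? (λ G′ → agree? X G G′ →-dec (lk G p ≟F lk G′ p)) 𝒢) 𝒢)

    Det-∈ : ∀ {𝒢 X p} → p ∈ X → Det 𝒢 X p
    Det-∈ p∈ _ _ ag = All.lookup ag p∈

    Det-trans : ∀ {𝒢 X Y p} → (∀ {y} → y ∈ Y → Det 𝒢 X y) → Det 𝒢 Y p → Det 𝒢 X p
    Det-trans h d G∈ G′∈ ag = d G∈ G′∈ (All.tabulate (λ y∈ → h y∈ G∈ G′∈ ag))

    Det-mono : ∀ {𝒢 X Y p} → (∀ {y} → y ∈ Y → y ∈ X) → Det 𝒢 Y p → Det 𝒢 X p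
    Det-mono h = Det-trans (λ y∈ → Det-∈ (h y∈))

    Extendable : List T → Set
    Extendable 𝒢 = ∀ X {G} → G ∈ 𝒢 → ∀ U → length U ≤ s →
      ∃[ G′ ] (G′ ∈ 𝒢 × Agree X G G′ × (∀ {p} → ¬ Det 𝒢 X p → lk G′ p ∉ U))

    -- A closed set X⁺ = {p : X determines p} is never Dependent.
    extendable : ∀ 𝒢 → ∃[ 𝒢* ] ((∀ {G} → G ∈ 𝒢* → G ∈ 𝒢) × (Unique 𝒢 → Unique 𝒢*) ×
      length 𝒢 ≤ kernelBound (length (sublists ps)) * length 𝒢* × Extendable 𝒢*)
    extendable 𝒢 with kernels (length (sublists ps)) (sublists ps) ≤-refl 𝒢
    ... | 𝒢* , sub , uq , size , alt = 𝒢* , sub , uq , size , ext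
      where
      ext : Extendable 𝒢*
      ext X {G} G∈ U len = go (alt (filter∈sublists (det? 𝒢* X) ps))
        where
        X⁺ = filter (det? 𝒢* X) ps
        X⁺-det : ∀ {y} → y ∈ X⁺ → Det 𝒢* X y
        X⁺-det y∈ = proj₂ (∈-filter⁻ (det? 𝒢* X) {xs = ps} y∈)
        ∈X⁺ : ∀ {y} → Det 𝒢* X y → y ∈ X⁺
        ∈X⁺ {y} d = ∈-filter⁺ (det? 𝒢* X) (∈ps y) d
        go : Dependent 𝒢* X⁺ ⊎ Avoiding 𝒢* X⁺ → ∃[ G′ ] (G′ ∈ 𝒢* × Agree X G G′ × (∀ {p} → ¬ Det 𝒢* X p → lk G′ p ∉ U))
        go (inj₁ (p , p∉ , d)) = contradiction (∈X⁺ (Det-trans X⁺-det d)) p∉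
        go (inj₂ av) with av G∈ U len
        ... | G′ , G′∈ , ag , nh = G′ , G′∈ , All.tabulate (λ x∈ → All.lookup ag (∈X⁺ (Det-∈ x∈))) ,
          λ {p} ¬d q → nh (lose (∈ps p) ((λ p∈ → ¬d (X⁺-det p∈)) , q))

    -- Each tuple has label 1 at `p` and 0 at `q` in exactly a quarter of all labellings, because
    -- its two entries differ. Some labelling `Z` therefore keeps a quarter of the tuples, and in
    -- these the values at `p` and at `q` come from complementary vertex sets.
    separate₁ : ∀ p q 𝒢 → (∀ {G} → G ∈ 𝒢 → lk G p ≢ lk G q) → ∃[ 𝒢′ ] ((∀ {G} → G ∈ 𝒢′ → G ∈ 𝒢) × (Unique 𝒢 → Unique 𝒢′) ×
      length 𝒢 ≤ 4 * length 𝒢′ × (∀ {G G′} → G ∈ 𝒢′ → G′ ∈ 𝒢′ → lk G p ≢ lk G′ q))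
    separate₁ p q 𝒢 dist with ∑-max (bitVectors n) {λ Z → 4 * count (sat? Z) 𝒢} (length 𝒢) nonempty (≤-reflexive (sym total))
      where
      sat? = λ Z G → separated? (lk G p) (lk G q) Z
      nonempty : 0 < length (bitVectors n)
      nonempty = subst (0 <_) (sym (length-bitVectors n)) (m^n>0 2 n)
      ∑-*ˡ : ∀ {X : Set} (xs : List X) f → ∑ xs (λ x → 4 * f x) ≡ 4 * ∑ xs f
      ∑-*ˡ xs f = trans (∑-cong xs (λ {x} _ → *-comm 4 (f x))) (trans (∑-*ʳ xs f 4) (*-comm (∑ xs f) 4))
      total : ∑ (bitVectors n) (λ Z → 4 * count (sat? Z) 𝒢) ≡ length (bitVectors n) * length 𝒢
      total = begin
        ∑ (bitVectors n) (λ Z → 4 * count (sat? Z) 𝒢) ≡⟨ ∑-*ˡ (bitVectors n) _ ⟩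
        4 * ∑ (bitVectors n) (λ Z → count (sat? Z) 𝒢) ≡⟨ cong (4 *_) (∑-cong (bitVectors n) (λ {Z} _ → count≡∑ (sat? Z) 𝒢)) ⟩
        4 * ∑ (bitVectors n) (λ Z → ∑ 𝒢 (λ G → 𝟙 (sat? Z G))) ≡⟨ cong (4 *_) (∑-swap (bitVectors n) 𝒢 _) ⟩
        4 * ∑ 𝒢 (λ G → ∑ (bitVectors n) (λ Z → 𝟙 (sat? Z G))) ≡⟨ cong (4 *_) (∑-cong 𝒢 (λ {G} _ → sym (count≡∑ (separated? (lk G p) (lk G q)) (bitVectors n)))) ⟩
        4 * ∑ 𝒢 (λ G → count (separated? (lk G p) (lk G q)) (bitVectors n)) ≡⟨ sym (∑-*ˡ 𝒢 _) ⟩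
        ∑ 𝒢 (λ G → 4 * count (separated? (lk G p) (lk G q)) (bitVectors n)) ≡⟨ ∑-cong 𝒢 (λ G∈ → trans (count-separated n _ _ (dist G∈)) (sym (length-bitVectors n))) ⟩
        ∑ 𝒢 (λ _ → length (bitVectors n)) ≡⟨ ∑-const 𝒢 _ ⟩
        length 𝒢 * length (bitVectors n) ≡⟨ *-comm (length 𝒢) _ ⟩
        length (bitVectors n) * length 𝒢 ∎
        where open ≡-Reasoning
    ... | Z , _ , big = filter sat? 𝒢 , (λ h → proj₁ (∈-filter⁻ sat? h)) , Uniqueₚ.filter⁺ sat? , big , apart
      where
      sat? = λ G → separated? (lk G p) (lk G q) Z
      apart : ∀ {G G′} → G ∈ filter sat? 𝒢 → G′ ∈ filter sat? 𝒢 → lk G p ≢ lk G′ q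
      apart G∈ G′∈ e with trans (sym (proj₁ (proj₂ (∈-filter⁻ sat? {xs = 𝒢} G∈)))) (trans (cong (Vec.lookup Z) e) (proj₂ (proj₂ (∈-filter⁻ sat? {xs = 𝒢} G′∈))))
      ... | ()

    Injective′ : List T → Set
    Injective′ 𝒢 = ∀ {G} → G ∈ 𝒢 → ∀ {p q} → p ≢ q → lk G p ≢ lk G q

    Separated : List T → Pos → Pos → Set
    Separated 𝒢 p q = ∀ {G G′} → G ∈ 𝒢 → G′ ∈ 𝒢 → lk G p ≢ lk G′ q

    separate : ∀ (prs : List (Pos × Pos)) 𝒢 → Injective′ 𝒢 → ∃[ 𝒢′ ] ((∀ {G} → G ∈ 𝒢′ → G ∈ 𝒢) × (Unique 𝒢 → Unique 𝒢′) ×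
      length 𝒢 ≤ 4 ^ length prs * length 𝒢′ × (∀ {p q} → (p , q) ∈ prs → p ≢ q → Separated 𝒢′ p q))
    separate [] 𝒢 inj = 𝒢 , id , id , ≤-reflexive (sym (+-identityʳ _)) , λ ()
    separate ((p , q) ∷ prs) 𝒢 inj with separate prs 𝒢 inj
    ... | 𝒢₁ , sub₁ , uq₁ , size₁ , sep₁ with p ≟P q
    ... | yes refl = 𝒢₁ , sub₁ , uq₁ ,
          ≤-trans size₁ (*-monoˡ-≤ (length 𝒢₁) (m≤m+n (4 ^ length prs) _)) ,
          λ { (here refl) ne → contradiction refl ne ; (there h) ne → sep₁ h ne }
    ... | no p≢q with separate₁ p q 𝒢₁ (λ G∈ → inj (sub₁ G∈) p≢q)
    ... | 𝒢₂ , sub₂ , uq₂ , size₂ , sep₂ = 𝒢₂ , (λ h → sub₁ (sub₂ h)) , (λ u → uq₂ (uq₁ u)) , size ,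
          λ { (here refl) _ → sep₂ ; (there h) ne G∈ G′∈ → sep₁ h ne (sub₂ G∈) (sub₂ G′∈) }
      where
      size : length 𝒢 ≤ 4 ^ suc (length prs) * length 𝒢₂
      size = ≤-trans size₁ (≤-trans (*-monoʳ-≤ (4 ^ length prs) size₂)
        (≤-reflexive (trans (sym (*-assoc (4 ^ length prs) 4 (length 𝒢₂))) (cong (_* length 𝒢₂) (*-comm (4 ^ length prs) 4)))))

-- Vertex lists and edges

edge : List (Fin n) → Subset n
edge [] = ∅ˢ
edge (x ∷ xs) = ⁅ x ⁆ ∪ edge xs

∈-edge⁺ : ∀ {x : Fin n} {xs} → x ∈ xs → x ∈ˢ edge xs
∈-edge⁺ {xs = x ∷ xs} (here refl) = x∈p∪q⁺ (inj₁ (x∈⁅x⁆ x))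
∈-edge⁺ {xs = y ∷ xs} (there p) = x∈p∪q⁺ (inj₂ (∈-edge⁺ p))

∈-edge⁻ : ∀ {x : Fin n} xs → x ∈ˢ edge xs → x ∈ xs
∈-edge⁻ [] p = contradiction p ∉⊥
∈-edge⁻ (y ∷ xs) p with x∈p∪q⁻ ⁅ y ⁆ (edge xs) p
... | inj₁ q = here (x∈⁅y⁆⇒x≡y y q)
... | inj₂ q = there (∈-edge⁻ xs q)

edge-cong : ∀ (xs ys : List (Fin n)) → (∀ {x} → x ∈ xs → x ∈ ys) → (∀ {x} → x ∈ ys → x ∈ xs) → edge xs ≡ edge ys
edge-cong xs ys f g = ⊆ˢ-antisym (λ p → ∈-edge⁺ (f (∈-edge⁻ xs p))) (λ p → ∈-edge⁺ (g (∈-edge⁻ ys p)))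

++-swap-∈ : ∀ (xs {ys} : List A) {x} → x ∈ xs ++ ys → x ∈ ys ++ xs
++-swap-∈ xs {ys} p with ∈-++⁻ xs p
... | inj₁ q = ∈-++⁺ʳ ys q
... | inj₂ q = ∈-++⁺ˡ q

edge-swap : ∀ (xs ys : List (Fin n)) → edge (xs ++ ys) ≡ edge (ys ++ xs)
edge-swap xs ys = edge-cong (xs ++ ys) (ys ++ xs) (++-swap-∈ xs) (++-swap-∈ ys)

edge-shift : ∀ (x : Fin n) xs ys → edge (x ∷ xs ++ ys) ≡ edge (xs ++ x ∷ ys)
edge-shift x xs ys = edge-cong (x ∷ xs ++ ys) (xs ++ x ∷ ys) to from
  where
  to : ∀ {y} → y ∈ x ∷ xs ++ ys → y ∈ xs ++ x ∷ ys
  to (here e) = ∈-++⁺ʳ xs (here e)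
  to (there p) with ∈-++⁻ xs p
  ... | inj₁ q = ∈-++⁺ˡ q
  ... | inj₂ q = ∈-++⁺ʳ xs (there q)
  from : ∀ {y} → y ∈ xs ++ x ∷ ys → y ∈ x ∷ xs ++ ys
  from p with ∈-++⁻ xs p
  ... | inj₁ q = there (∈-++⁺ˡ q)
  ... | inj₂ (here e) = here e
  ... | inj₂ (there q) = there (∈-++⁺ʳ xs q)

∣⁅x⁆∪p∣ : ∀ (x : Fin n) p → x ∉ˢ p → ∣ ⁅ x ⁆ ∪ p ∣ ≡ suc ∣ p ∣
∣⁅x⁆∪p∣ Fin.zero (true Vec.∷ p) x∉ = contradiction Vec.here x∉
∣⁅x⁆∪p∣ Fin.zero (false Vec.∷ p) x∉ = cong (suc ∘ ∣_∣) (∪-identityˡ p)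
∣⁅x⁆∪p∣ (Fin.suc x) (true Vec.∷ p) x∉ = cong suc (∣⁅x⁆∪p∣ x p (x∉ ∘ Vec.there))
∣⁅x⁆∪p∣ (Fin.suc x) (false Vec.∷ p) x∉ = ∣⁅x⁆∪p∣ x p (x∉ ∘ Vec.there)

∣edge∣ : ∀ {xs : List (Fin n)} → Unique xs → ∣ edge xs ∣ ≡ length xs
∣edge∣ {n} [] = ∣⊥∣≡0 n
∣edge∣ {xs = x ∷ xs} (x∉ ∷ u) = trans (∣⁅x⁆∪p∣ x (edge xs) (λ p → unique-∷⁻ (x∉ ∷ u) (∈-edge⁻ xs p))) (cong suc (∣edge∣ u))

elements : Subset n → List (Fin n)
elements {n} S = filter (_∈ˢ? S) (allFin n)

∈-elements⁺ : ∀ {S : Subset n} {x} → x ∈ˢ S → x ∈ elements S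
∈-elements⁺ {S = S} {x} p = ∈-filter⁺ (_∈ˢ? S) (∈-allFin x) p

∈-elements⁻ : ∀ {S : Subset n} {x} → x ∈ elements S → x ∈ˢ S
∈-elements⁻ {n} {S} p = proj₂ (∈-filter⁻ (_∈ˢ? S) {xs = allFin n} p)

unique-elements : ∀ (S : Subset n) → Unique (elements S)
unique-elements {n} S = Uniqueₚ.filter⁺ (_∈ˢ? S) (Uniqueₚ.allFin⁺ n)

edge-elements : ∀ (S : Subset n) → edge (elements S) ≡ S
edge-elements S = ⊆ˢ-antisym (λ p → ∈-elements⁻ {S = S} (∈-edge⁻ (elements S) p)) (λ p → ∈-edge⁺ (∈-elements⁺ p))

elements-injective : ∀ {S S′ : Subset n} → elements S ≡ elements S′ → S ≡ S′
elements-injective {S = S} {S′} e = trans (sym (edge-elements S)) (trans (cong edge e) (edge-elements S′))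

length-elements : ∀ (S : Subset n) → length (elements S) ≡ ∣ S ∣
length-elements S = trans (sym (∣edge∣ (unique-elements S))) (cong ∣_∣ (edge-elements S))

_≟ˢ_ : DecidableEquality (Subset n)
_≟ˢ_ = Vecₚ.≡-dec Boolₚ._≟_

_∈H?_ : (e : Subset n) (H : List (Subset n)) → Dec (e ∈ H)
e ∈H? H = any? (e ≟ˢ_) H

∈-image⁻ : ∀ {v} (φ : Fin v → Fin n) (e : Subset v) {y} → y ∈ˢ image φ e → ∃[ i ] (Vec.lookup e i ≡ true × φ i ≡ y)
∈-image⁻ {v = v} φ e = go (allFin v)
  where
  go : ∀ is {y} → y ∈ˢ foldr (λ i acc → if Vec.lookup e i then ⁅ φ i ⁆ ∪ acc else acc) ∅ˢ is → ∃[ i ] (Vec.lookup e i ≡ true × φ i ≡ y)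
  go [] p = contradiction p ∉⊥
  go (i ∷ is) p with Vec.lookup e i in eq
  ... | false = go is p
  ... | true with x∈p∪q⁻ ⁅ φ i ⁆ _ p
  ... | inj₁ q = i , eq , sym (x∈⁅y⁆⇒x≡y (φ i) q)
  ... | inj₂ q = go is q

∈-image⁺ : ∀ {v} (φ : Fin v → Fin n) (e : Subset v) i → Vec.lookup e i ≡ true → φ i ∈ˢ image φ e
∈-image⁺ {v = v} φ e i p = go (allFin v) (∈-allFin i)
  where
  go : ∀ is → i ∈ is → φ i ∈ˢ foldr (λ i acc → if Vec.lookup e i then ⁅ φ i ⁆ ∪ acc else acc) ∅ˢ is
  go (j ∷ is) (here refl) rewrite p = x∈p∪q⁺ (inj₁ (x∈⁅x⁆ (φ i)))
  go (j ∷ is) (there q) with Vec.lookup e j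
  ... | false = go is q
  ... | true = x∈p∪q⁺ (inj₂ (go is q))

lookup-interval⁺ : ∀ v s len (i : Fin v) → s ≤ toℕ i → toℕ i < s + len → Vec.lookup (interval v s len) i ≡ true
lookup-interval⁺ v s len i p q = trans (Vecₚ.lookup∘tabulate _ i) (cong₂ _∧_ (T⇒true (≤⇒≤ᵇ p)) (T⇒true (<⇒<ᵇ q)))
  where
  T⇒true : ∀ {b} → T b → b ≡ true
  T⇒true {true} _ = refl

lookup-interval⁻ : ∀ v s len (i : Fin v) → Vec.lookup (interval v s len) i ≡ true → s ≤ toℕ i × toℕ i < s + len
lookup-interval⁻ v s len i p with trans (sym (Vecₚ.lookup∘tabulate (λ x → (s ≤ᵇ toℕ x) ∧ (toℕ x <ᵇ s + len)) i)) p
... | q with s ≤ᵇ toℕ i in e₁ | toℕ i <ᵇ s + len in e₂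
... | true | true = ≤ᵇ⇒≤ s (toℕ i) (subst T (sym e₁) tt) , <ᵇ⇒< (toℕ i) (s + len) (subst T (sym e₂) tt)

lookup-middle⁻ : ∀ (pre mid post : List A) (i : Fin (length (pre ++ mid ++ post))) → length pre ≤ toℕ i → toℕ i < length pre + length mid →
  lookup (pre ++ mid ++ post) i ∈ mid
lookup-middle⁻ (x ∷ pre) mid post (Fin.suc i) (s≤s p) (s≤s q) = lookup-middle⁻ pre mid post i p q
lookup-middle⁻ [] (x ∷ mid) post Fin.zero p q = here refl
lookup-middle⁻ [] (x ∷ mid) post (Fin.suc i) p (s≤s q) = there (lookup-middle⁻ [] mid post i z≤n q)

lookup-middle⁺ : ∀ (pre mid post : List A) {y} → y ∈ mid →
  ∃[ i ] (length pre ≤ toℕ i × toℕ i < length pre + length mid × lookup (pre ++ mid ++ post) i ≡ y)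
lookup-middle⁺ (x ∷ pre) mid post p with lookup-middle⁺ pre mid post p
... | i , a , b , c = Fin.suc i , s≤s a , s≤s b , c
lookup-middle⁺ [] (x ∷ mid) post (here refl) = Fin.zero , z≤n , s≤s z≤n , refl
lookup-middle⁺ [] (x ∷ mid) post (there p) with lookup-middle⁺ [] mid post p
... | i , a , b , c = Fin.suc i , z≤n , s≤s b , c

-- The dictionary between the intervals of positions in a pattern and consecutive segments of a
-- vertex list.
image-middle : ∀ (pre mid post : List (Fin n)) →
  image (lookup (pre ++ mid ++ post)) (interval (length (pre ++ mid ++ post)) (length pre) (length mid)) ≡ edge mid
image-middle pre mid post = ⊆ˢ-antisym to from
  where
  l = pre ++ mid ++ post
  e = interval (length l) (length pre) (length mid)
  to : image (lookup l) e ⊆ˢ edge mid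
  to p with ∈-image⁻ (lookup l) e p
  ... | i , q , refl = let (a , b) = lookup-interval⁻ _ _ _ i q in ∈-edge⁺ (lookup-middle⁻ pre mid post i a b)
  from : edge mid ⊆ˢ image (lookup l) e
  from p with lookup-middle⁺ pre mid post (∈-edge⁻ mid p)
  ... | i , a , b , refl = ∈-image⁺ (lookup l) e i (lookup-interval⁺ _ _ _ i a b)

lookup-injective : ∀ {xs : List A} → Unique xs → ∀ i j → lookup xs i ≡ lookup xs j → i ≡ j
lookup-injective {xs = x ∷ xs} u Fin.zero Fin.zero e = refl
lookup-injective {xs = x ∷ xs} u Fin.zero (Fin.suc j) e = contradiction (subst (_∈ xs) (sym e) (∈-lookup j)) (unique-∷⁻ u)
lookup-injective {xs = x ∷ xs} u (Fin.suc i) Fin.zero e = contradiction (subst (_∈ xs) e (∈-lookup i)) (unique-∷⁻ u)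
lookup-injective {xs = x ∷ xs} (_ ∷ u) (Fin.suc i) (Fin.suc j) e = cong Fin.suc (lookup-injective u i j e)

-- Paths as lists of blocks

data Alt {A : Set} (a b : ℕ) : List (List A) → Set where
  [] : Alt a b []
  _∷_ : ∀ {x : List A} {xs} → length x ≡ a → Alt b a xs → Alt a b (x ∷ xs)

Joined : List (Subset n) → List (Fin n) → List (Fin n) → Set
Joined H x y = edge (x ++ y) ∈ H

record BlockPath (H : List (Subset n)) (a b L : ℕ) (bs : List (List (Fin n))) : Set where
  constructor blockPath
  field
    alt : Alt a b bs
    len : length bs ≡ suc L
    linked : Linked (Joined H) bs
    uniq : Unique (concat bs)

-- Removing the first block exchanges the roles of `a` and `b`; inductions along a block list use
-- the positions in this form.
pos-suc : ∀ a b j → pos a b (suc j) ≡ a + pos b a j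
pos-suc a b zero = sym (+-identityʳ a)
pos-suc a b (suc zero) = +-identityʳ (a + b)
pos-suc a b (suc (suc j)) = trans (cong (a + b +_) (pos-suc a b j))
  (trans (+-assoc a b _) (cong (a +_) (sym (+-assoc b a _))))

pos-even : ∀ a b i → pos a b (2 * i) ≡ i * (a + b)
pos-even a b zero = refl
pos-even a b (suc i) = trans (cong (pos a b ∘ suc) (+-suc i (i + 0))) (cong (a + b +_) (pos-even a b i))

length-concat-Alt : ∀ {a b} {bs : List (List A)} → Alt a b bs → length (concat bs) ≡ pos a b (length bs)
length-concat-Alt [] = refl
length-concat-Alt {a = a} {b} {x ∷ xs} (p ∷ alt) =
  trans (length-++ x) (trans (cong₂ _+_ p (length-concat-Alt alt)) (sym (pos-suc a b (length xs))))

consecutive : ∀ {H : List (Subset n)} {a b} {bs} → Alt a b bs → Linked (Joined H) bs → ∀ j → suc j < length bs →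
  ∃[ pre ] ∃[ mid ] ∃[ post ] (concat bs ≡ pre ++ mid ++ post × length pre ≡ pos a b j × length mid ≡ a + b × edge mid ∈ H)
consecutive {bs = x ∷ y ∷ bs} (p ∷ q ∷ _) (r ∷ _) zero _ =
  [] , x ++ y , concat bs , sym (++-assoc x y (concat bs)) , refl , trans (length-++ x) (cong₂ _+_ p q) , r
consecutive {a = a} {b} {bs = x ∷ y ∷ bs} (p ∷ alt) (_ ∷ lk) (suc j) (s≤s lt) with consecutive alt lk j lt
... | pre , mid , post , e , l₁ , l₂ , h = x ++ pre , mid , post ,
  trans (cong (x ++_) e) (sym (++-assoc x pre _)) ,
  trans (length-++ x) (trans (cong₂ _+_ p l₁) (sym (pos-suc a b j))) , trans l₂ (+-comm b a) , h
consecutive {bs = x ∷ []} (p ∷ _) lk zero (s≤s ())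
consecutive {bs = x ∷ []} (p ∷ _) lk (suc j) (s≤s ())

contains : ∀ {H : List (Subset n)} {a b L bs v} → BlockPath H a b L bs → v ≡ length (concat bs) → Contains H (v , pathEdges a b v L)
contains {H = H} {a} {b} {L} {bs} (blockPath alt len lk u) refl = lookup (concat bs) , (λ {i} {j} e → lookup-injective u i j e) , All.tabulate each
  where
  each : ∀ {e} → e ∈ pathEdges a b (length (concat bs)) L → image (lookup (concat bs)) e ∈ H
  each e∈ with ∈-map⁻ (λ j → interval (length (concat bs)) (pos a b j) (a + b)) e∈
  ... | j , j∈ , refl with consecutive alt lk j (subst (suc j <_) (sym len) (s≤s (∈-upTo⁻ j∈)))
  ... | pre , mid , post , eq , l₁ , l₂ , h rewrite eq | sym l₁ | sym l₂ = subst (_∈ H) (sym (image-middle pre mid post)) h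

-- The path edges with indices 0, 2, ..., 2k-2 occupy disjoint intervals of length a+b. In a copy
-- each of them needs its own vertex of `V`, which has fewer than `k`.
¬contains-covered : ∀ {a b k v Λ} (H : List (Subset n)) (V : List (Fin n)) → length V < k → (∀ {i} → i < k → 2 * i < Λ) →
  (∀ {e} → e ∈ H → ∃[ x ] (x ∈ V × x ∈ˢ e)) → ¬ Contains H (v , pathEdges a b v Λ)
¬contains-covered {n} {a} {b} {k} {v} {Λ} H V V<k bound cover (φ , inj , all) = <⇒≱ V<k (subst (_≤ length V) (length-tabulate g) short)
  where
  hit : (i : Fin k) → ∃[ p ] (φ p ∈ V × toℕ i * (a + b) ≤ toℕ p × toℕ p < toℕ i * (a + b) + (a + b))
  hit i with cover (All.lookup all (∈-map⁺ (λ j → interval v (pos a b j) (a + b)) (∈-upTo⁺ (bound (toℕ<n i)))))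
  ... | x , x∈ , q with ∈-image⁻ φ (interval v (pos a b (2 * toℕ i)) (a + b)) q
  ... | p , t , refl with lookup-interval⁻ v (pos a b (2 * toℕ i)) (a + b) p t
  ... | l , u = p , x∈ , subst (_≤ toℕ p) (pos-even a b (toℕ i)) l , subst (λ z → toℕ p < z + (a + b)) (pos-even a b (toℕ i)) u
  g : Fin k → Fin n
  g i = φ (proj₁ (hit i))
  disjoint : ∀ i j → toℕ i < toℕ j → proj₁ (hit i) ≢ proj₁ (hit j)
  disjoint i j lt e = <⇒≱ (proj₂ (proj₂ (proj₂ (hit i)))) (begin
    toℕ i * (a + b) + (a + b) ≡⟨ +-comm (toℕ i * (a + b)) (a + b) ⟩
    suc (toℕ i) * (a + b)     ≤⟨ *-monoˡ-≤ (a + b) lt ⟩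
    toℕ j * (a + b)           ≤⟨ proj₁ (proj₂ (proj₂ (hit j))) ⟩
    toℕ (proj₁ (hit j))       ≡⟨ cong toℕ (sym e) ⟩
    toℕ (proj₁ (hit i))       ∎)
    where open ≤-Reasoning
  g-injective : ∀ {i j} → g i ≡ g j → i ≡ j
  g-injective {i} {j} e with <-cmp (toℕ i) (toℕ j)
  ... | tri≈ _ eq _ = toℕ-injective eq
  ... | tri< lt _ _ = contradiction (inj e) (disjoint i j lt)
  ... | tri> _ _ gt = contradiction (sym (inj e)) (disjoint j i gt)
  short : length (tabulate g) ≤ length V
  short = unique-⊆-length (Uniqueₚ.tabulate⁺ g-injective) (λ x∈ → inV (∈-tabulate⁻ x∈))
    where
    inV : ∀ {x} → ∃[ i ] (x ≡ g i) → x ∈ V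
    inV (i , refl) = proj₁ (proj₂ (hit i))

-- One round of a path construction: from the current a-block `c` through a b-block to the next
-- a-block. `U` lists the vertices used so far and `Φ m` is what is known about them before round
-- `m`. The size condition leaves room for a further b-block within the vertex number of
-- P_{2k}(a,b).
Step : List (Subset n) → ℕ → ℕ → ℕ → (ℕ → List (Fin n) → Set) → (ℕ → Fin n → Set) → Set
Step H a b k St Φ = ∀ m c U → m < k → St m c → All (Φ m) U → length U + b ≤ k * (a + b) + a →
  ∃[ x ] ∃[ c′ ] (length x ≡ b × length c′ ≡ a × Unique (x ++ c′) × (∀ {y} → y ∈ x ++ c′ → y ∉ U) ×
    edge (c ++ x) ∈ H × edge (x ++ c′) ∈ H × St (suc m) c′ × All (Φ (suc m)) (x ++ c′))

module Build {n : ℕ} (H : List (Subset n)) (a b k : ℕ) (St : ℕ → List (Fin n) → Set) (Φ : ℕ → Fin n → Set)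
  (Φ-suc : ∀ {m x} → Φ m x → Φ (suc m) x)
  (step : Step H a b k St Φ)
  where

  build : ∀ c → St 0 c → Unique c → length c ≡ a → All (Φ 0) c → ∃[ bs ] BlockPath H a b (2 * k) bs
  build c₀ st₀ u₀ l₀ φ₀ = let (c , bs , _ , p , _) = go k ≤-refl in c ∷ bs , p
    where
    -- New blocks are put in front, so the path is listed backwards; this is harmless because
    -- P_{2k}(a,b) begins and ends with an a-block.
    go : ∀ m → m ≤ k → ∃[ c ] ∃[ bs ] (St m c × BlockPath H a b (2 * m) (c ∷ bs) × All (Φ m) (concat (c ∷ bs)))
    go zero _ = c₀ , [] , st₀ , blockPath (l₀ ∷ []) refl [-] (subst Unique (sym (++-identityʳ c₀)) u₀) , subst (All (Φ 0)) (sym (++-identityʳ c₀)) φ₀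
    go (suc m) lt with go m (<⇒≤ lt)
    ... | c , bs , st , blockPath alt len lk u , φ with step m c (concat (c ∷ bs)) lt st φ size
      where
      size : length (concat (c ∷ bs)) + b ≤ k * (a + b) + a
      size = begin
        length (concat (c ∷ bs)) + b ≡⟨ cong (_+ b) (trans (length-concat-Alt alt) (trans (cong (pos a b) len) (trans (pos-suc a b (2 * m)) (cong (a +_) (pos-even b a m))))) ⟩
        a + m * (b + a) + b          ≡⟨ cong (_+ b) (+-comm a (m * (b + a))) ⟩
        m * (b + a) + a + b          ≡⟨ +-assoc (m * (b + a)) a b ⟩
        m * (b + a) + (a + b)        ≡⟨ cong (λ z → m * z + (a + b)) (+-comm b a) ⟩
        m * (a + b) + (a + b)        ≡⟨ +-comm (m * (a + b)) (a + b) ⟩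
        suc m * (a + b)              ≤⟨ *-monoˡ-≤ (a + b) lt ⟩
        k * (a + b)                  ≤⟨ m≤m+n _ a ⟩
        k * (a + b) + a              ∎
        where open ≤-Reasoning
    ... | x , c′ , lx , lc , ux , dis , e₁ , e₂ , st′ , φ′ = c′ , x ∷ c ∷ bs , st′ ,
      blockPath (lc ∷ lx ∷ alt) (trans (cong (λ z → suc (suc z)) len) (cong (suc ∘ suc) (sym (+-suc m (m + 0)))))
        (subst (_∈ H) (edge-swap x c′) e₂ ∷ subst (_∈ H) (edge-swap c x) e₁ ∷ lk) uq ,
      All.tabulate (λ p → allΦ (∈-++⁻ (c′ ++ x) (subst (_ ∈_) (sym (++-assoc c′ x (c ++ concat bs))) p)))
      where
      uq : Unique (c′ ++ x ++ concat (c ∷ bs))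
      uq = subst Unique (++-assoc c′ x _) (unique-++⁺
        (let (ux , uc , d) = unique-++⁻ x ux in unique-++⁺ uc ux (λ p q → d q p)) u (λ p → dis (++-swap-∈ c′ p)))
      allΦ : ∀ {y} → y ∈ c′ ++ x ⊎ y ∈ concat (c ∷ bs) → Φ (suc m) y
      allΦ (inj₁ p) = All.lookup φ′ (++-swap-∈ c′ p)
      allΦ (inj₂ p) = Φ-suc (All.lookup φ p)

-- Reversal and truncation of block paths

linked-∷ʳ : ∀ {R : A → A → Set} (xs : List A) {y z} → Linked R (xs ∷ʳ y) → R y z → Linked R ((xs ∷ʳ y) ∷ʳ z)
linked-∷ʳ [] [-] r = r ∷ [-]
linked-∷ʳ (x ∷ []) (p ∷ lk) r = p ∷ linked-∷ʳ [] lk r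
linked-∷ʳ (x ∷ x′ ∷ xs) (p ∷ lk) r = p ∷ linked-∷ʳ (x′ ∷ xs) lk r

linked-reverse : ∀ {R : A → A → Set} → (∀ {x y} → R x y → R y x) → ∀ {xs} → Linked R xs → Linked R (reverse xs)
linked-reverse s [] = []
linked-reverse s [-] = [-]
linked-reverse {R = R} s {x ∷ y ∷ xs} (p ∷ lk) = subst (Linked R) (sym eq)
    (linked-∷ʳ (reverse xs) (subst (Linked R) (unfold-reverse y xs) (linked-reverse s lk)) (s p))
  where
  eq : reverse (x ∷ y ∷ xs) ≡ (reverse xs ∷ʳ y) ∷ʳ x
  eq = trans (unfold-reverse x (y ∷ xs)) (cong (_∷ʳ x) (unfold-reverse y xs))

alt-∷ʳ² : ∀ {a b} (k : ℕ) {bs : List (List A)} {x y} → length bs ≡ 2 * k → Alt a b bs → length x ≡ a → length y ≡ b → Alt a b ((bs ∷ʳ x) ∷ʳ y)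
alt-∷ʳ² k l [] p q = p ∷ q ∷ []
alt-∷ʳ² zero () (_ ∷ _) p q
alt-∷ʳ² (suc k) l (_ ∷ []) p q = contradiction (trans (suc-injective l) (+-suc k (k + 0))) (λ ())
alt-∷ʳ² (suc k) l (u ∷ v ∷ alt) p q = u ∷ v ∷ alt-∷ʳ² k (suc-injective (trans (suc-injective l) (+-suc k (k + 0)))) alt p q

alt-reverse : ∀ {a b} (k : ℕ) {bs : List (List A)} → length bs ≡ 2 * k → Alt a b bs → Alt b a (reverse bs)
alt-reverse zero {[]} l [] = []
alt-reverse (suc k) {x ∷ []} l alt = contradiction (trans (suc-injective l) (+-suc k (k + 0))) (λ ())
alt-reverse (suc k) {x ∷ y ∷ bs} l (p ∷ q ∷ alt) = subst (Alt _ _) (sym eq)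
    (alt-∷ʳ² k (trans (length-reverse bs) l′) (alt-reverse k l′ alt) q p)
  where
  l′ = suc-injective (trans (suc-injective l) (+-suc k (k + 0)))
  eq : reverse (x ∷ y ∷ bs) ≡ (reverse bs ∷ʳ y) ∷ʳ x
  eq = trans (unfold-reverse x (y ∷ bs)) (cong (_∷ʳ x) (unfold-reverse y bs))

∈-concat-reverse : ∀ (bs : List (List A)) {x} → x ∈ concat (reverse bs) → x ∈ concat bs
∈-concat-reverse (b ∷ bs) {x} p with ∈-++⁻ (concat (reverse bs)) (subst (x ∈_) (trans (cong concat (unfold-reverse b bs)) (sym (concat-++ (reverse bs) (b ∷ [])))) p)
... | inj₁ q = ∈-++⁺ʳ b (∈-concat-reverse bs q)
... | inj₂ q = ∈-++⁺ˡ (subst (x ∈_) (++-identityʳ b) q)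

unique-concat-reverse : ∀ (bs : List (List A)) → Unique (concat bs) → Unique (concat (reverse bs))
unique-concat-reverse [] u = []
unique-concat-reverse (b ∷ bs) u = subst Unique (sym (trans (cong concat (unfold-reverse b bs)) (sym (concat-++ (reverse bs) (b ∷ [])))))
  (let (ub , ubs , d) = unique-++⁻ b u in
   unique-++⁺ (unique-concat-reverse bs ubs) (subst Unique (sym (++-identityʳ b)) ub)
     (λ p q → d (subst (_ ∈_) (++-identityʳ b) q) (∈-concat-reverse bs p)))

reverse-path : ∀ {H : List (Subset n)} {a b} k {bs} → 1 ≤ k → BlockPath H a b (2 * k ∸ 1) bs → BlockPath H b a (2 * k ∸ 1) (reverse bs)
reverse-path {H = H} (suc k) {bs} _ (blockPath alt len lk u) = blockPath (alt-reverse (suc k) len alt)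
  (trans (length-reverse bs) len) (linked-reverse (λ {x} {y} → subst (_∈ H) (edge-swap x y)) lk) (unique-concat-reverse bs u)

tail-path : ∀ {H : List (Subset n)} {a b} k {c bs} → BlockPath H a b (2 * suc k) (c ∷ bs) → BlockPath H b a (2 * suc k ∸ 1) bs
tail-path k {c} {x ∷ bs} (blockPath (_ ∷ alt) len (_ ∷ lk) u) = blockPath alt (suc-injective len) lk (proj₁ (proj₂ (unique-++⁻ c u)))

odd-path⇒Podd : ∀ {H : List (Subset n)} {a b} k {bs} → 1 ≤ k → BlockPath H a b (2 * k ∸ 1) bs → Contains H (Podd a b k)
odd-path⇒Podd {a = a} {b} (suc k) {bs} _ p = contains p
  (sym (trans (length-concat-Alt (BlockPath.alt p)) (trans (cong (pos a b) (BlockPath.len p)) (pos-even a b (suc k)))))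

even-path⇒Peven : ∀ {H : List (Subset n)} {a b} k {bs} → BlockPath H a b (2 * k) bs → Contains H (Peven a b k)
even-path⇒Peven {a = a} {b} k {bs} p = contains p
  (sym (trans (length-concat-Alt (BlockPath.alt p)) (trans (cong (pos a b) (BlockPath.len p))
    (trans (pos-suc a b (2 * k)) (trans (cong (a +_) (pos-even b a k)) (trans (+-comm a _) (cong (λ z → k * z + a) (+-comm b a))))))))

-- The structure lemma

unique-map-∈ : ∀ (f : A → B) {xs} → (∀ {x y} → x ∈ xs → y ∈ xs → f x ≡ f y → x ≡ y) → Unique xs → Unique (map f xs)
unique-map-∈ f inj [] = []
unique-map-∈ f {x ∷ xs} inj (x∉ ∷ u) = unique-∷⁺ fresh (unique-map-∈ f (λ p q → inj (there p) (there q)) u)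
  where
  fresh : f x ∉ map f xs
  fresh p with ∈-map⁻ f p
  ... | y , y∈ , e with inj (here refl) (there y∈) e
  ... | refl = All.lookup x∉ y∈ refl

another : ∀ {xs : List A} → DecidableEquality A → Unique xs → 2 ≤ length xs → ∀ x → ∃[ y ] (y ∈ xs × y ≢ x)
another {xs = y ∷ z ∷ _} _≟_ (y∉ ∷ _) _ x with y ≟ x
... | no ne = y , here refl , ne
... | yes refl = z , there (here refl) , λ e → All.lookup y∉ (here refl) (sym e)
another {xs = _ ∷ []} _ _ (s≤s ()) _

length-remove : ∀ (_≟_ : DecidableEquality A) {xs : List A} {x} → Unique xs → x ∈ xs → suc (length (filter (λ y → ¬? (y ≟ x)) xs)) ≡ length xs
length-remove _≟_ {y ∷ xs} {x} (y∉ ∷ u) x∈ with y ≟ x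
length-remove _≟_ {y ∷ xs} {x} (y∉ ∷ u) x∈ | yes refl = cong suc (count-all (λ z → ¬? (z ≟ x)) xs (λ z∈ e → All.lookup y∉ z∈ (sym e)))
length-remove _≟_ {y ∷ xs} {x} (y∉ ∷ u) (here e) | no ne = contradiction (sym e) ne
length-remove _≟_ {y ∷ xs} {x} (y∉ ∷ u) (there x∈) | no ne = cong suc (length-remove _≟_ u x∈)

-- A member of the family carries `k` edges through one common a-part `As`; the i-th edge is
-- completed by the colour `w i` and the b-1 coordinates `Bs i`. `Zs i` holds the base coordinates
-- outside that edge. It is empty when all edges extend the same set, and a single coordinate when
-- two sets differing in one vertex are compared.
module Structure (a b k : ℕ) (1≤b : 1 ≤ b) (b<a : b < a)
  (Pos : Set) (_≟P_ : DecidableEquality Pos) (ps : List Pos) (∈ps : ∀ p → p ∈ ps)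
  (d : ℕ) (base : List Pos) (w : Fin k → Pos) (As : List Pos) (Bs Zs : Fin k → List Pos)
  (lenA : length As ≡ a) (lenB : ∀ i → suc (length (Bs i)) ≡ b)
  (lenZ : ∀ i → a + (length (Bs i) + length (Zs i)) ≡ d)
  (unique-e : ∀ i → Unique (w i ∷ As ++ Bs i))
  (base⊆ : ∀ i {p} → p ∈ base → p ∈ As ++ Bs i ++ Zs i)
  (w∉e : ∀ i j → i ≢ j → w i ∉ w j ∷ As ++ Bs j)
  where

  -- The vertex number of P_{2k}(a,b), an upper bound for every set of used vertices that has to be
  -- avoided.
  s : ℕ
  s = k * (a + b) + a

  open Kernel Pos _≟P_ ps ∈ps s

  e : Fin k → List Pos
  e i = w i ∷ As ++ Bs i

  length-e : ∀ i → length (e i) ≡ a + b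
  length-e i = begin
    suc (length (As ++ Bs i))       ≡⟨ cong suc (length-++ As) ⟩
    suc (length As + length (Bs i)) ≡⟨ sym (+-suc (length As) _) ⟩
    length As + suc (length (Bs i)) ≡⟨ cong₂ _+_ lenA (lenB i) ⟩
    a + b                           ∎
    where open ≡-Reasoning

  2≤a : 2 ≤ a
  2≤a = ≤-trans (s≤s 1≤b) b<a

  abstract
    structureBound : ℕ
    structureBound = 4 ^ length (cartesianProduct ps ps) * kernelBound (length (sublists ps))

  module _ {n : ℕ} (H : List (Subset n)) (noPath : ∀ bs → ¬ BlockPath H a b (2 * k) bs) {T : Set} (lk : T → Pos → Fin n) where

    open Family lk

    module Rich (𝒢 : List T) (u𝒢 : Unique 𝒢) (big : n ^ (d ∸ 1) < length 𝒢)
      (ext : Extendable 𝒢) (sep : ∀ {p q} → p ≢ q → Separated 𝒢 p q)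
      (edges∈ : ∀ {G} → G ∈ 𝒢 → ∀ i → edge (map (lk G) (e i)) ∈ H)
      (baseDet : ∀ {G G′} → G ∈ 𝒢 → G′ ∈ 𝒢 → Agree base G G′ → G ≡ G′)
      (wDet : ∀ i → Det 𝒢 (As ++ Bs i) (w i)) where

      lk-injective : ∀ {G p q} → G ∈ 𝒢 → lk G p ≡ lk G q → p ≡ q
      lk-injective {G} {p} {q} G∈ eq with p ≟P q
      ... | yes r = r
      ... | no ne = contradiction eq (sep ne G∈ G∈)

      map-agree : ∀ {G G′} (xs : List Pos) → (∀ {p} → p ∈ xs → lk G p ≡ lk G′ p) → map (lk G) xs ≡ map (lk G′) xs
      map-agree [] h = refl
      map-agree (x ∷ xs) h = cong₂ _∷_ (h (here refl)) (map-agree xs (h ∘ there))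

      -- Such an `X` would make the projection of `𝒢` to its coordinates injective, and there are
      -- only n^(d-1) possible projections. All freedom in the construction is drawn from this.
      ¬determining : ∀ X → length X ≡ d ∸ 1 → (∀ {p} → p ∈ base → Det 𝒢 X p) → ⊥
      ¬determining X lX dets = <⇒≱ big (subst (_≤ n ^ (d ∸ 1)) (length-map proj 𝒢)
        (subst (length (map proj 𝒢) ≤_) (length-tuples (d ∸ 1)) (unique-⊆-length uq sub)))
        where
        open Tuples n
        proj : T → List (Fin n)
        proj G = map (lk G) X
        proj⇒agree : ∀ {G G′} xs → map (lk G) xs ≡ map (lk G′) xs → Agree xs G G′
        proj⇒agree [] eq = []
        proj⇒agree (x ∷ xs) eq = proj₁ (∷-injective eq) ∷ proj⇒agree xs (proj₂ (∷-injective eq))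
        uq : Unique (map proj 𝒢)
        uq = unique-map-∈ proj (λ G∈ G′∈ eq → baseDet G∈ G′∈ (All.tabulate (λ p∈ → dets p∈ G∈ G′∈ (proj⇒agree X eq)))) u𝒢
        sub : ∀ {t} → t ∈ map proj 𝒢 → t ∈ tuples (d ∸ 1)
        sub t∈ with ∈-map⁻ proj t∈
        ... | G , _ , refl = ∈-tuples (trans (length-map (lk G) X) lX)

      -- Free i f: outside f, the edge e i can be moved away from any small set
      -- while f (and the coordinates Zs i, which lie outside the edge) stay fixed.
      Free : Fin k → List Pos → Set
      Free i f = ∀ {x} → x ∈ e i → x ∉ f → ¬ Det 𝒢 (f ++ Zs i) x

      _≢P?_ : ∀ (y x : Pos) → Dec (y ≢ x)
      y ≢P? x = ¬? (y ≟P x)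

      without : Fin k → Pos → List Pos
      without i x = filter (_≢P? x) (e i)

      -- The tied coordinates: those fixed by the rest of the edge and the coordinates outside it.
      Q : Fin k → Pos → Set
      Q i x = Det 𝒢 (without i x ++ Zs i) x

      Q? : ∀ i → Decidable (Q i)
      Q? i x = det? 𝒢 (without i x ++ Zs i) x

      -- If `f` with `Zs i` determined some `x` outside `f`, then `x` would be tied and have a tied
      -- partner `y` outside `f`. The edge without `x` and `y`, together with `Zs i`, has d-1
      -- coordinates; it contains `f`, so it determines `x`, then `y`, then all of `base`.
      paired⇒free : ∀ i f → (∀ {x} → x ∈ f → x ∈ e i) →
        (∀ {x} → x ∈ e i → x ∉ f → Q i x → ∃[ y ] (y ∈ e i × y ∉ f × Q i y × y ≢ x)) → Free i f
      paired⇒free i f f⊆ pair {x} x∈ x∉ dx = ¬determining X lenX (λ p∈ → allDet (base⊆′ p∈))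
        where
        Z = Zs i
        f⊆without : ∀ {p} → p ∈ f ++ Z → p ∈ without i x ++ Z
        f⊆without p∈ with ∈-++⁻ f p∈
        ... | inj₁ p∈f = ∈-++⁺ˡ (∈-filter⁺ (_≢P? x) (f⊆ p∈f) (λ { refl → x∉ p∈f }))
        ... | inj₂ p∈Z = ∈-++⁺ʳ (without i x) p∈Z
        partner = pair x∈ x∉ (Det-mono {X = without i x ++ Z} {Y = f ++ Z} f⊆without dx)
        y = proj₁ partner
        y∈ = proj₁ (proj₂ partner)
        y∉ = proj₁ (proj₂ (proj₂ partner))
        Qy = proj₁ (proj₂ (proj₂ (proj₂ partner)))
        y≢x = proj₂ (proj₂ (proj₂ (proj₂ partner)))
        X′ = filter (_≢P? y) (without i x)
        X = X′ ++ Z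
        lenX : length X ≡ d ∸ 1
        lenX = begin
          length (X′ ++ Z)            ≡⟨ length-++ X′ ⟩
          length X′ + length Z        ≡⟨ cong (λ z → z ∸ 1 + length Z) (suc-injective (trans two (trans (length-e i) (trans (cong (a +_) (sym (lenB i))) (+-suc a _))))) ⟩
          (a + length (Bs i)) ∸ 1 + length Z ≡⟨ sym (+-∸-comm (length Z) (≤-trans (≤-trans (s≤s z≤n) 2≤a) (m≤m+n a _))) ⟩
          (a + length (Bs i) + length Z) ∸ 1 ≡⟨ cong (_∸ 1) (trans (+-assoc a _ _) (lenZ i)) ⟩
          d ∸ 1 ∎
          where
          open ≡-Reasoning
          two : suc (suc (length X′)) ≡ length (e i)
          two = trans (cong suc (length-remove _≟P_ (Uniqueₚ.filter⁺ (_≢P? x) (unique-e i)) (∈-filter⁺ (_≢P? x) y∈ y≢x)))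
                      (length-remove _≟P_ (unique-e i) x∈)
        ∈X : ∀ {p} → p ∈ e i → p ≢ x → p ≢ y → p ∈ X
        ∈X p∈ nx ny = ∈-++⁺ˡ (∈-filter⁺ (_≢P? y) (∈-filter⁺ (_≢P? x) p∈ nx) ny)
        detx : Det 𝒢 X x
        detx = Det-mono {X = X} {Y = f ++ Z} f⊆X dx
          where
          f⊆X : ∀ {p} → p ∈ f ++ Z → p ∈ X
          f⊆X p∈ with ∈-++⁻ f p∈
          ... | inj₁ p∈f = ∈X (f⊆ p∈f) (λ { refl → x∉ p∈f }) (λ { refl → y∉ p∈f })
          ... | inj₂ p∈Z = ∈-++⁺ʳ X′ p∈Z
        dety : Det 𝒢 X y
        dety = Det-trans {X = X} {Y = without i y ++ Z} step Qy
          where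
          step : ∀ {p} → p ∈ without i y ++ Z → Det 𝒢 X p
          step {p} p∈ with ∈-++⁻ (without i y) p∈
          ... | inj₂ p∈Z = Det-∈ (∈-++⁺ʳ X′ p∈Z)
          ... | inj₁ q with p ≟P x
          ... | yes refl = detx
          ... | no nx = Det-∈ (∈X (proj₁ (∈-filter⁻ (_≢P? y) {xs = e i} q)) nx (proj₂ (∈-filter⁻ (_≢P? y) {xs = e i} q)))
        allDet : ∀ {p} → p ∈ e i ++ Z → Det 𝒢 X p
        allDet {p} p∈ with ∈-++⁻ (e i) p∈
        ... | inj₂ p∈Z = Det-∈ (∈-++⁺ʳ X′ p∈Z)
        ... | inj₁ q with p ≟P x | p ≟P y
        ... | yes refl | _ = detx
        ... | no _ | yes refl = dety
        ... | no nx | no ny = Det-∈ (∈X q nx ny)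
        base⊆′ : ∀ {p} → p ∈ base → p ∈ e i ++ Z
        base⊆′ p∈ = there (subst (_ ∈_) (sym (++-assoc As (Bs i) Z)) (base⊆ i p∈))

      -- Either part can be moved while the other is fixed, so this single class of edges already
      -- carries an arbitrarily long alternation of a-blocks and b-blocks, within the budget `s`.
      record Split (i : Fin k) : Set where
        field
          A* B* : List Pos
          lenA* : length A* ≡ a
          lenB* : length B* ≡ b
          unique* : Unique (A* ++ B*)
          to* : ∀ {p} → p ∈ e i → p ∈ A* ++ B*
          from* : ∀ {p} → p ∈ A* ++ B* → p ∈ e i
          freeA* : Free i A*
          freeB* : Free i B*

      -- The two parts can be moved in turn as long as `w i` stays. Such a class is good for one
      -- b-block only, the one that contains `w i`, so `k` different colours are needed.
      record Hub (i : Fin k) : Set where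
        field
          freeA : Free i (w i ∷ As)
          freeB : Free i (w i ∷ Bs i)

      module Dichotomy (i : Fin k) where

        q p′ : List Pos
        q = filter (Q? i) (e i)
        p′ = filter (¬? ∘ Q? i) (e i)

        length-qp : length q + length p′ ≡ a + b
        length-qp = trans (count-¬ (Q? i) (e i)) (length-e i)

        ∈q : ∀ {x} → x ∈ e i → Q i x → x ∈ q
        ∈q = ∈-filter⁺ (Q? i)

        q∈ : ∀ {x} → x ∈ q → x ∈ e i × Q i x
        q∈ = ∈-filter⁻ (Q? i) {xs = e i}

        uq : Unique q
        uq = Uniqueₚ.filter⁺ (Q? i) (unique-e i)

        up : Unique p′
        up = Uniqueₚ.filter⁺ (¬? ∘ Q? i) (unique-e i)

        q∌p : ∀ {x} → x ∈ q → x ∉ p′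
        q∌p x∈ x∈′ = proj₂ (∈-filter⁻ (¬? ∘ Q? i) {xs = e i} x∈′) (proj₂ (q∈ x∈))

        e⇒qp : ∀ {x} → x ∈ e i → x ∈ q ⊎ x ∈ p′
        e⇒qp {x} x∈ with Q? i x
        ... | yes Qx = inj₁ (∈q x∈ Qx)
        ... | no ¬Qx = inj₂ (∈-filter⁺ (¬? ∘ Q? i) x∈ ¬Qx)

        p∈e : ∀ {x} → x ∈ p′ → x ∈ e i
        p∈e x∈ = proj₁ (∈-filter⁻ (¬? ∘ Q? i) {xs = e i} x∈)

        AB⊆without : ∀ {p} → p ∈ As ++ Bs i → p ∈ without i (w i) ++ Zs i
        AB⊆without p∈ = ∈-++⁺ˡ (∈-filter⁺ (_≢P? w i) (there p∈) (λ { refl → unique-∷⁻ (unique-e i) p∈ }))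

        Qw : Q i (w i)
        Qw = Det-mono {X = without i (w i) ++ Zs i} {Y = As ++ Bs i} AB⊆without (wDet i)

        As⊆ : ∀ {x} → x ∈ w i ∷ As → x ∈ e i
        As⊆ (here p) = here p
        As⊆ (there p) = there (∈-++⁺ˡ p)

        Bs⊆ : ∀ {x} → x ∈ w i ∷ Bs i → x ∈ e i
        Bs⊆ (here p) = here p
        Bs⊆ (there p) = there (∈-++⁺ʳ As p)

        -- Only `w i` is tied, and it lies in both fixed parts, so no tied coordinate is left
        -- outside either.
        hub₁ : length q < 2 → Hub i
        hub₁ lt = record
          { freeA = paired⇒free i (w i ∷ As) As⊆ (λ x∈ x∉ Qx → contradiction (here (only (∈q x∈ Qx))) x∉)
          ; freeB = paired⇒free i (w i ∷ Bs i) Bs⊆ (λ x∈ x∉ Qx → contradiction (here (only (∈q x∈ Qx))) x∉)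
          }
          where
          singleton : ∀ {xs : List Pos} {x y} → length xs < 2 → x ∈ xs → y ∈ xs → x ≡ y
          singleton {_ ∷ []} _ (here refl) (here refl) = refl
          singleton {_ ∷ _ ∷ _} (s≤s (s≤s ())) _ _
          only : ∀ {x} → x ∈ q → x ≡ w i
          only x∈ = singleton lt x∈ (∈q (here refl) Qw)

        -- All tied coordinates go into `A*`, padded to size `a`: none lies outside `A*`, and at
        -- least two lie outside `B*`.
        split₁ : 2 ≤ length q → length q ≤ a → Split i
        split₁ 2≤q q≤a = record
          { A* = A* ; B* = B* ; lenA* = lenA*
          ; lenB* = +-cancelˡ-≡ a (length B*) b (trans (cong (_+ length B*) (sym lenA*)) (trans (sym (length-++ A*)) total))
          ; unique* = subst Unique (sym shape) (unique-++⁺ uq up q∌p)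
          ; to* = λ {x} p∈ → subst (x ∈_) (sym shape) ([ ∈-++⁺ˡ , ∈-++⁺ʳ q ]′ (e⇒qp p∈))
          ; from* = λ {x} p∈ → [ (λ r → proj₁ (q∈ r)) , p∈e ]′ (∈-++⁻ q (subst (x ∈_) shape p∈))
          ; freeA* = paired⇒free i A* A*⊆ (λ x∈ x∉ Qx → contradiction (∈-++⁺ˡ (∈q x∈ Qx)) x∉)
          ; freeB* = paired⇒free i B* (λ r → p∈e (∈-drop m r)) (λ {x} _ _ _ → pair x)
          }
          where
          m = a ∸ length q
          A* = q ++ take m p′
          B* = drop m p′
          A*⊆ : ∀ {x} → x ∈ A* → x ∈ e i
          A*⊆ r with ∈-++⁻ q r
          ... | inj₁ x = proj₁ (q∈ x)
          ... | inj₂ x = p∈e (∈-take m x)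
          shape : A* ++ B* ≡ q ++ p′
          shape = trans (++-assoc q (take m p′) B*) (cong (q ++_) (take++drop≡id m p′))
          total : length (A* ++ B*) ≡ a + b
          total = trans (cong length shape) (trans (length-++ q) length-qp)
          m≤ : m ≤ length p′
          m≤ = +-cancelˡ-≤ (length q) m (length p′) (≤-trans (≤-reflexive (m+[n∸m]≡n q≤a)) (≤-trans (m≤m+n a b) (≤-reflexive (sym length-qp))))
          lenA* : length A* ≡ a
          lenA* = trans (length-++ q) (trans (cong (length q +_) (trans (length-take m p′) (m≤n⇒m⊓n≡m m≤))) (m+[n∸m]≡n q≤a))
          pair : ∀ x → ∃[ y ] (y ∈ e i × y ∉ B* × Q i y × y ≢ x)
          pair x with another _≟P_ uq 2≤q x
          ... | y , y∈ , ne = y , proj₁ (q∈ y∈) , (λ r → q∌p y∈ (∈-drop m r)) , proj₂ (q∈ y∈) , ne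

        -- `B*` consists of b ≥ 2 tied coordinates, and at least (a+1) - b ≥ 2 tied ones remain for
        -- `A*`; the last inequality is b < a.
        split₂ : 2 ≤ b → a < length q → Split i
        split₂ 2≤b a<q = record
          { A* = A* ; B* = B*
          ; lenA* = +-cancelʳ-≡ b (length A*) a (trans (cong (length A* +_) (sym lenB*)) (trans (+-comm (length A*) (length B*)) (trans (sym (length-++ B*)) total)))
          ; lenB* = lenB*
          ; unique* = let (u , v , dis) = unique-++⁻ B* uqp in unique-++⁺ v u (λ r t → dis t r)
          ; to* = λ {x} p∈ → ++-swap-∈ B* (subst (x ∈_) (sym shape) ([ ∈-++⁺ˡ , ∈-++⁺ʳ q ]′ (e⇒qp p∈)))
          ; from* = λ {x} p∈ → [ (λ r → proj₁ (q∈ r)) , p∈e ]′ (∈-++⁻ q (subst (x ∈_) shape (++-swap-∈ A* p∈)))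
          ; freeA* = paired⇒free i A* A*⊆ (λ {x} _ _ _ → pairB x)
          ; freeB* = paired⇒free i B* (λ r → proj₁ (q∈ (∈-take b r))) (λ {x} _ _ _ → pairA x)
          }
          where
          B* = take b q
          A* = drop b q ++ p′
          b≤q : b ≤ length q
          b≤q = <⇒≤ (<-trans b<a a<q)
          lenB* : length B* ≡ b
          lenB* = trans (length-take b q) (m≤n⇒m⊓n≡m b≤q)
          shape : B* ++ A* ≡ q ++ p′
          shape = trans (sym (++-assoc B* (drop b q) p′)) (cong (_++ p′) (take++drop≡id b q))
          total : length (B* ++ A*) ≡ a + b
          total = trans (cong length shape) (trans (length-++ q) length-qp)
          uqp : Unique (B* ++ A*)
          uqp = subst Unique (sym shape) (unique-++⁺ uq up q∌p)
          dis : ∀ {x} → x ∈ B* → x ∉ A*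
          dis = proj₂ (proj₂ (unique-++⁻ B* uqp))
          A*⊆ : ∀ {x} → x ∈ A* → x ∈ e i
          A*⊆ r with ∈-++⁻ (drop b q) r
          ... | inj₁ x = proj₁ (q∈ (∈-drop b x))
          ... | inj₂ x = p∈e x
          pairB : ∀ x → ∃[ y ] (y ∈ e i × y ∉ A* × Q i y × y ≢ x)
          pairB x with another _≟P_ (Uniqueₚ.take⁺ b uq) (subst (2 ≤_) (sym lenB*) 2≤b) x
          ... | y , y∈ , ne = y , proj₁ (q∈ (∈-take b y∈)) , dis y∈ , proj₂ (q∈ (∈-take b y∈)) , ne
          2≤drop : 2 ≤ length (drop b q)
          2≤drop = subst (2 ≤_) (sym (length-drop b q)) (m+n≤o⇒m≤o∸n 2 (≤-trans (s≤s b<a) a<q))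
          pairA : ∀ x → ∃[ y ] (y ∈ e i × y ∉ B* × Q i y × y ≢ x)
          pairA x with another _≟P_ (Uniqueₚ.drop⁺ b uq) 2≤drop x
          ... | y , y∈ , ne = y , proj₁ (q∈ (∈-drop b y∈)) , (λ r → dis r (∈-++⁺ˡ y∈)) , proj₂ (q∈ (∈-drop b y∈)) , ne

        -- Every coordinate is tied and `Bs i` is empty. Nothing of the edge lies outside
        -- `w i ∷ As`, while all a ≥ 2 coordinates of `As` lie outside `w i ∷ Bs i`.
        hub₂ : b ≡ 1 → a < length q → Hub i
        hub₂ b≡1 a<q = record
          { freeA = paired⇒free i (w i ∷ As) As⊆ (λ {x} x∈ x∉ _ → contradiction (subst (x ∈_) (cong (w i ∷_) (trans (cong (As ++_) Bs≡[]) (++-identityʳ As))) x∈) x∉)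
          ; freeB = paired⇒free i (w i ∷ Bs i) Bs⊆ (λ {x} _ _ _ → pair x)
          }
          where
          empty : ∀ {xs : List Pos} → length xs ≡ 0 → xs ≡ []
          empty {[]} _ = refl
          Bs≡[] : Bs i ≡ []
          Bs≡[] = empty (suc-injective (trans (lenB i) b≡1))
          p≡[] : p′ ≡ []
          p≡[] = empty (n≤0⇒n≡0 (+-cancelˡ-≤ (length q) _ _ (begin
            length q + length p′ ≡⟨ trans length-qp (cong (a +_) b≡1) ⟩
            a + 1                ≡⟨ +-comm a 1 ⟩
            suc a                ≤⟨ a<q ⟩
            length q             ≡⟨ sym (+-identityʳ _) ⟩
            length q + 0         ∎)))
            where open ≤-Reasoning
          uAs : Unique As
          uAs = proj₁ (unique-++⁻ As (AllPairs.tail (unique-e i)))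
          pair : ∀ x → ∃[ y ] (y ∈ e i × y ∉ w i ∷ Bs i × Q i y × y ≢ x)
          pair x with another _≟P_ uAs (subst (2 ≤_) (sym lenA) 2≤a) x
          ... | y , y∈ , ne = y , y∈e , y∉ , Qy , ne
            where
            y∈e : y ∈ e i
            y∈e = there (∈-++⁺ˡ y∈)
            y∉ : y ∉ w i ∷ Bs i
            y∉ (here refl) = unique-∷⁻ (unique-e i) (∈-++⁺ˡ y∈)
            y∉ (there r) = contradiction (subst (y ∈_) Bs≡[] r) (λ ())
            Qy : Q i y
            Qy with e⇒qp y∈e
            ... | inj₁ r = proj₂ (q∈ r)
            ... | inj₂ r = contradiction (subst (y ∈_) p≡[] r) (λ ())

        dichotomy : Hub i ⊎ Split i
        dichotomy with 2 ≤? length q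
        ... | no ¬2≤q = inj₁ (hub₁ (≰⇒> ¬2≤q))
        ... | yes 2≤q with length q ≤? a
        ... | yes q≤a = inj₂ (split₁ 2≤q q≤a)
        ... | no q≰a with 2 ≤? b
        ... | yes 2≤b = inj₂ (split₂ 2≤b (≰⇒> q≰a))
        ... | no 2≰b = inj₁ (hub₂ (≤-antisym (≤-pred (≰⇒> 2≰b)) 1≤b) (≰⇒> q≰a))

      -- Two moves: first `K` is fixed and the rest of the edge gets new values, which yields the
      -- b-block; then `Bx` is fixed and `Ax` is renewed. For a split `K` is `Ax`; for a hub it also
      -- contains `w i`, whose value does not move and must be new for another reason, `safe`. The
      -- second move also avoids the b-block just chosen, hence the summand `b` in the size
      -- condition.
      alternate : ∀ i (Ax Bx K : List Pos) → length Ax ≡ a → length Bx ≡ b → Unique Ax → Unique Bx →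
        (∀ {p} → p ∈ e i → p ∈ Ax ++ Bx) → (∀ {p} → p ∈ Ax ++ Bx → p ∈ e i) → (∀ {p} → p ∈ Ax → p ∈ K) → (∀ {p} → p ∈ Ax → p ∉ Bx) →
        Free i K → Free i Bx → ∀ {G} → G ∈ 𝒢 → ∀ U → length U + b ≤ s → (∀ {p} → p ∈ Bx → p ∈ K → lk G p ∉ U) →
        ∃[ G′ ] ∃[ G″ ] (G′ ∈ 𝒢 × G″ ∈ 𝒢 × let x = map (lk G′) Bx ; c′ = map (lk G″) Ax in
          length x ≡ b × length c′ ≡ a × Unique (x ++ c′) × (∀ {y} → y ∈ x ++ c′ → y ∉ U) ×
          edge (map (lk G) Ax ++ x) ∈ H × edge (x ++ c′) ∈ H)
      alternate i Ax Bx K lAx lBx uAx uBx toAB fromAB Ax⊆K Ax∌B freeK freeBx {G} G∈ U lenU safe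
        with ext (K ++ Zs i) G∈ U (≤-trans (m≤m+n (length U) b) lenU)
      ... | G′ , G′∈ , ag , av with ext (Bx ++ Zs i) G′∈ (map (lk G′) Bx ++ U) lenxU
        where
        lenxU : length (map (lk G′) Bx ++ U) ≤ s
        lenxU = ≤-trans (≤-reflexive (trans (length-++ (map (lk G′) Bx)) (trans (cong (_+ length U) (trans (length-map (lk G′) Bx) lBx)) (+-comm b (length U))))) lenU
      ... | G″ , G″∈ , ag′ , av′ = G′ , G″ , G′∈ , G″∈ , trans (length-map (lk G′) Bx) lBx , trans (length-map (lk G″) Ax) lAx , uxc , avoid , e₁ , e₂
        where
        x = map (lk G′) Bx
        c′ = map (lk G″) Ax
        c′-avoids : ∀ {y} → y ∈ c′ → y ∉ x ++ U
        c′-avoids y∈ with ∈-map⁻ (lk G″) y∈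
        ... | p , p∈ , refl = av′ (freeBx (fromAB (∈-++⁺ˡ p∈)) (Ax∌B p∈))
        x-avoids : ∀ {y} → y ∈ x → y ∉ U
        x-avoids y∈ with ∈-map⁻ (lk G′) y∈
        ... | p , p∈ , refl with p ∈P? K
        ... | no p∉K = av (freeK (fromAB (∈-++⁺ʳ Ax p∈)) p∉K)
        ... | yes p∈K = λ r → safe p∈ p∈K (subst (_∈ U) (sym (All.lookup ag (∈-++⁺ˡ p∈K))) r)
        uxc : Unique (x ++ c′)
        uxc = unique-++⁺ (Uniqueₚ.map⁺ (lk-injective G′∈) uBx) (Uniqueₚ.map⁺ (lk-injective G″∈) uAx)
          (λ y∈x y∈c → c′-avoids y∈c (∈-++⁺ˡ y∈x))
        avoid : ∀ {y} → y ∈ x ++ c′ → y ∉ U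
        avoid y∈ r with ∈-++⁻ x y∈
        ... | inj₁ p = x-avoids p r
        ... | inj₂ p = c′-avoids p (∈-++⁺ʳ x r)
        edgeOf : ∀ {G} → G ∈ 𝒢 → edge (map (lk G) Ax ++ map (lk G) Bx) ∈ H
        edgeOf {G} G∈ = subst (_∈ H) (edge-cong _ _ to from) (edges∈ G∈ i)
          where
          to : ∀ {y} → y ∈ map (lk G) (e i) → y ∈ map (lk G) Ax ++ map (lk G) Bx
          to y∈ with ∈-map⁻ (lk G) y∈
          ... | p , p∈ , refl = subst (lk G p ∈_) (map-++ (lk G) Ax Bx) (∈-map⁺ (lk G) (toAB p∈))
          from : ∀ {y} → y ∈ map (lk G) Ax ++ map (lk G) Bx → y ∈ map (lk G) (e i)
          from {y} y∈ with ∈-map⁻ (lk G) (subst (y ∈_) (sym (map-++ (lk G) Ax Bx)) y∈)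
          ... | p , p∈ , refl = ∈-map⁺ (lk G) (fromAB p∈)
        e₁ : edge (map (lk G) Ax ++ x) ∈ H
        e₁ = subst (λ z → edge (z ++ x) ∈ H) (sym (map-agree Ax (λ p∈ → All.lookup ag (∈-++⁺ˡ (Ax⊆K p∈))))) (edgeOf G′∈)
        e₂ : edge (x ++ c′) ∈ H
        e₂ = subst (λ z → edge (z ++ c′) ∈ H) (sym (map-agree Bx (λ p∈ → All.lookup ag′ (∈-++⁺ˡ p∈))))
          (subst (_∈ H) (edge-swap c′ (map (lk G″) Bx)) (edgeOf G″∈))

      member : ∃[ G ] (G ∈ 𝒢)
      member = go 𝒢 (≤-trans (s≤s z≤n) big)
        where
        go : ∀ (xs : List T) → 1 ≤ length xs → ∃[ G ] (G ∈ xs)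
        go (x ∷ _) _ = x , here refl

      split⇒⊥ : ∀ i → Split i → ⊥
      split⇒⊥ i sp = noPath _ (proj₂ (build (map (lk G₀) A*) (G₀ , G₀∈ , refl) (Uniqueₚ.map⁺ (lk-injective G₀∈) uA)
          (trans (length-map (lk G₀) A*) lenA*) (All.tabulate (λ _ → tt))))
        where
        open Split sp
        uA = proj₁ (unique-++⁻ A* unique*)
        uB = proj₁ (proj₂ (unique-++⁻ A* unique*))
        dis = proj₂ (proj₂ (unique-++⁻ A* unique*))
        G₀ = proj₁ member
        G₀∈ = proj₂ member
        St : ℕ → List (Fin n) → Set
        St m c = ∃[ G ] (G ∈ 𝒢 × c ≡ map (lk G) A*)
        step : Step H a b k St (λ _ _ → ⊤)
        step m c U _ (G , G∈ , refl) _ lenU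
          with alternate i A* B* A* lenA* lenB* uA uB to* from* id dis freeA* freeB* G∈ U lenU (λ p q → contradiction p (dis q))
        ... | G′ , G″ , G′∈ , G″∈ , lx , lc , u , av , e₁ , e₂ = _ , _ , lx , lc , u , av , e₁ , e₂ , (G″ , G″∈ , refl) , All.tabulate (λ _ → tt)
        open Build H a b k St (λ _ _ → ⊤) id step

      -- Round m uses the edge `e m` and enters and leaves it by values of `As`, which all `k` edges
      -- share; so consecutive rounds fit together. `Φ m` records that no vertex used before round m
      -- is a value of a colour coordinate `w i` with i ≥ m.
      hubs⇒⊥ : (∀ i → Hub i) → 1 ≤ k → ⊥
      hubs⇒⊥ hub 1≤k = noPath _ (proj₂ (build (map (lk G₀) As) (G₀ , G₀∈ , refl) (Uniqueₚ.map⁺ (lk-injective G₀∈) uA)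
          (trans (length-map (lk G₀) As) lenA) (All.tabulate φ₀)))
        where
        G₀ = proj₁ member
        G₀∈ = proj₂ member
        u-e : ∀ i → w i ∉ As ++ Bs i × Unique (As ++ Bs i)
        u-e i = unique-∷⁻ (unique-e i) , AllPairs.tail (unique-e i)
        uA : Unique As
        uA = proj₁ (unique-++⁻ As (proj₂ (u-e (fromℕ< 1≤k))))
        St : ℕ → List (Fin n) → Set
        St m c = ∃[ G ] (G ∈ 𝒢 × c ≡ map (lk G) As)
        Φ : ℕ → Fin n → Set
        Φ m u = ∃[ G ] ∃[ p ] (G ∈ 𝒢 × u ≡ lk G p × (∀ i → m ≤ toℕ i → p ≢ w i))
        φ₀ : ∀ {u} → u ∈ map (lk G₀) As → Φ 0 u
        φ₀ u∈ with ∈-map⁻ (lk G₀) u∈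
        ... | p , p∈ , refl = G₀ , p , G₀∈ , refl , λ { i _ refl → proj₁ (u-e i) (∈-++⁺ˡ p∈) }
        step : Step H a b k St Φ
        step m c U m<k (G , G∈ , refl) φ lenU
          with alternate i As (w i ∷ Bs i) (w i ∷ As) lenA (lenB i) uA uB to from there dis (Hub.freeA (hub i)) (Hub.freeB (hub i)) G∈ U lenU safe
          where
          i = fromℕ< m<k
          parts = unique-++⁻ As (proj₂ (u-e i))
          uB : Unique (w i ∷ Bs i)
          uB = unique-∷⁺ (λ r → proj₁ (u-e i) (∈-++⁺ʳ As r)) (proj₁ (proj₂ parts))
          dis : ∀ {p} → p ∈ As → p ∉ w i ∷ Bs i
          dis p∈ (here refl) = proj₁ (u-e i) (∈-++⁺ˡ p∈)
          dis p∈ (there q) = proj₂ (proj₂ parts) p∈ q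
          to : ∀ {p} → p ∈ e i → p ∈ As ++ w i ∷ Bs i
          to (here refl) = ∈-++⁺ʳ As (here refl)
          to (there p∈) with ∈-++⁻ As p∈
          ... | inj₁ r = ∈-++⁺ˡ r
          ... | inj₂ r = ∈-++⁺ʳ As (there r)
          from : ∀ {p} → p ∈ As ++ w i ∷ Bs i → p ∈ e i
          from p∈ with ∈-++⁻ As p∈
          ... | inj₁ r = there (∈-++⁺ˡ r)
          ... | inj₂ (here refl) = here refl
          ... | inj₂ (there r) = there (∈-++⁺ʳ As r)
          -- vertices in the class of w i are used for the first time at step i
          safe : ∀ {p} → p ∈ w i ∷ Bs i → p ∈ w i ∷ As → lk G p ∉ U
          safe p∈ (there q) = contradiction p∈ (dis q)
          safe _ (here refl) r with All.lookup φ r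
          ... | G₁ , p₁ , G₁∈ , eq , new = sep (λ z → new i (≤-reflexive (sym (toℕ-fromℕ< m<k))) (sym z)) G∈ G₁∈ eq
        ... | G′ , G″ , G′∈ , G″∈ , lx , lc , u , av , e₁ , e₂ =
          _ , _ , lx , lc , u , av , e₁ , e₂ , (G″ , G″∈ , refl) , All.tabulate φ′
          where
          i = fromℕ< m<k
          later : ∀ {p} → p ∈ e i → ∀ j → suc m ≤ toℕ j → p ≢ w j
          later p∈ j lt refl = w∉e j i (λ { refl → <-irrefl (sym (toℕ-fromℕ< m<k)) lt }) p∈
          φ′ : ∀ {y} → y ∈ map (lk G′) (w i ∷ Bs i) ++ map (lk G″) As → Φ (suc m) y
          φ′ y∈ with ∈-++⁻ (map (lk G′) (w i ∷ Bs i)) y∈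
          φ′ y∈ | inj₁ r with ∈-map⁻ (lk G′) r
          ... | p , here refl , refl = G′ , p , G′∈ , refl , later (here refl)
          ... | p , there p∈ , refl = G′ , p , G′∈ , refl , later (there (∈-++⁺ʳ As p∈))
          φ′ y∈ | inj₂ r with ∈-map⁻ (lk G″) r
          ... | p , p∈ , refl = G″ , p , G″∈ , refl , later (there (∈-++⁺ˡ p∈))
        Φ-suc : ∀ {m x} → Φ m x → Φ (suc m) x
        Φ-suc (G , p , G∈ , eq , h) = G , p , G∈ , eq , λ i lt → h i (<⇒≤ lt)
        open Build H a b k St Φ Φ-suc step

      impossible : 1 ≤ k → ⊥
      impossible 1≤k with anyFin? {P = λ i → ∃[ sp ] (Dichotomy.dichotomy i ≡ inj₂ sp)} isSplit
        where
        isSplit : ∀ i → Dec (∃[ sp ] (Dichotomy.dichotomy i ≡ inj₂ sp))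
        isSplit i with Dichotomy.dichotomy i
        ... | inj₁ _ = no (λ { (_ , ()) })
        ... | inj₂ sp = yes (sp , refl)
      ... | yes (i , sp , _) = split⇒⊥ i sp
      ... | no none = hubs⇒⊥ hub 1≤k
        where
        hub : ∀ i → Hub i
        hub i with Dichotomy.dichotomy i in eq
        ... | inj₁ h = h
        ... | inj₂ sp = contradiction (i , sp , eq) none

    abstract
      structure : 1 ≤ k → ∀ (𝒢 : List T) → Unique 𝒢 → Injective′ 𝒢 →
        (∀ {G} → G ∈ 𝒢 → ∀ i → edge (map (lk G) (e i)) ∈ H) →
        (∀ {G G′} → G ∈ 𝒢 → G′ ∈ 𝒢 → Agree base G G′ → G ≡ G′) →
        (∀ i → Det 𝒢 (As ++ Bs i) (w i)) →
        length 𝒢 ≤ structureBound * n ^ (d ∸ 1)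
      -- Separation comes first because it passes to subfamilies; extendability does not.
      structure 1≤k 𝒢 u inj edges∈ baseDet wDet with separate (cartesianProduct ps ps) 𝒢 inj
      ... | 𝒢₁ , sub₁ , uq₁ , size₁ , sep₁ with extendable 𝒢₁
      ... | 𝒢₂ , sub₂ , uq₂ , size₂ , ext with length 𝒢₂ ≤? n ^ (d ∸ 1)
      ... | yes small = ≤-trans size₁ (≤-trans (*-monoʳ-≤ (4 ^ length (cartesianProduct ps ps)) (≤-trans size₂ (*-monoʳ-≤ (kernelBound (length (sublists ps))) small)))
            (≤-reflexive (sym (*-assoc (4 ^ length (cartesianProduct ps ps)) (kernelBound (length (sublists ps))) (n ^ (d ∸ 1))))))
      ... | no large = ⊥-elim (Rich.impossible 𝒢₂ (uq₂ (uq₁ u)) (≰⇒> large) ext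
            (λ {p} {q} ne G∈ G′∈ → sep₁ (∈-cartesianProduct⁺ (∈ps p) (∈ps q)) ne (sub₂ G∈) (sub₂ G′∈))
            (λ G∈ → edges∈ (sub₁ (sub₂ G∈)))
            (λ G∈ G′∈ → baseDet (sub₁ (sub₂ G∈)) (sub₁ (sub₂ G′∈)))
            (λ i G∈ G′∈ → wDet i (sub₁ (sub₂ G∈)) (sub₁ (sub₂ G′∈))) 1≤k)

-- Subsets of a given size

allSub : ∀ n → ℕ → List (Subset n)
allSub zero zero = Vec.[] ∷ []
allSub zero (suc j) = []
allSub (suc n) zero = map (false Vec.∷_) (allSub n zero)
allSub (suc n) (suc j) = map (true Vec.∷_) (allSub n j) ++ map (false Vec.∷_) (allSub n (suc j))

∈-allSub : ∀ (S : Subset n) → S ∈ allSub n ∣ S ∣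
∈-allSub Vec.[] = here refl
∈-allSub {suc n} (true Vec.∷ S) = ∈-++⁺ˡ (∈-map⁺ (true Vec.∷_) (∈-allSub S))
∈-allSub {suc n} (false Vec.∷ S) with ∣ S ∣ | ∈-allSub S
... | zero | p = ∈-map⁺ (false Vec.∷_) p
... | suc j | p = ∈-++⁺ʳ (map (true Vec.∷_) (allSub n j)) (∈-map⁺ (false Vec.∷_) p)

allSub-size : ∀ n j {S : Subset n} → S ∈ allSub n j → ∣ S ∣ ≡ j
allSub-size zero zero (here refl) = refl
allSub-size (suc n) zero p with ∈-map⁻ (false Vec.∷_) p
... | S , q , refl = allSub-size n zero q
allSub-size (suc n) (suc j) p with ∈-++⁻ (map (true Vec.∷_) (allSub n j)) p
... | inj₁ q with ∈-map⁻ (true Vec.∷_) q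
... | S , r , refl = cong suc (allSub-size n j r)
allSub-size (suc n) (suc j) p | inj₂ q with ∈-map⁻ (false Vec.∷_) q
... | S , r , refl = allSub-size n (suc j) r

unique-allSub : ∀ n j → Unique (allSub n j)
unique-allSub zero zero = [] ∷ []
unique-allSub zero (suc j) = []
unique-allSub (suc n) zero = Uniqueₚ.map⁺ Vecₚ.∷-injectiveʳ (unique-allSub n zero)
unique-allSub (suc n) (suc j) = unique-++⁺ (Uniqueₚ.map⁺ Vecₚ.∷-injectiveʳ (unique-allSub n j))
  (Uniqueₚ.map⁺ Vecₚ.∷-injectiveʳ (unique-allSub n (suc j))) apart
  where
  apart : ∀ {S} → S ∈ map (true Vec.∷_) (allSub n j) → S ∉ map (false Vec.∷_) (allSub n (suc j))
  apart p q with ∈-map⁻ (true Vec.∷_) p | ∈-map⁻ (false Vec.∷_) q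
  ... | _ , _ , refl | _ , _ , ()

length-allSub : ∀ n j → length (allSub n j) ≡ n C j
length-allSub zero zero = refl
length-allSub zero (suc j) = refl
length-allSub (suc n) zero = trans (length-map (false Vec.∷_) (allSub n zero)) (trans (length-allSub n zero) (trans (nC0≡1 n) (sym (nC0≡1 (suc n)))))
  where
  nC0≡1 : ∀ m → m C 0 ≡ 1
  nC0≡1 m = trans (nCk≡nC[n∸k] {0} {m} z≤n) (nCn≡1 m)
length-allSub (suc n) (suc j) = trans (length-++ (map (true Vec.∷_) (allSub n j)))
  (trans (cong₂ _+_ (trans (length-map (true Vec.∷_) (allSub n j)) (length-allSub n j)) (trans (length-map (false Vec.∷_) (allSub n (suc j))) (length-allSub n (suc j))))
    (nCk+nC[k+1]≡[n+1]C[k+1] n j))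

⊆-size⇒≡ : ∀ {p q : Subset n} → p ⊆ˢ q → ∣ q ∣ ≤ ∣ p ∣ → p ≡ q
⊆-size⇒≡ {p = p} {q} sub le with any? (λ x → ¬? (x ∈ˢ? p)) (elements q)
... | yes h = let (x , x∈ , x∉) = find h in contradiction le (<⇒≱ (p⊂q⇒∣p∣<∣q∣ (sub , x , ∈-elements⁻ x∈ , x∉)))
... | no ¬h = ⊆ˢ-antisym sub (λ {x} x∈ → decidable-stable (x ∈ˢ? p) (All.lookup (¬Any⇒All¬ (elements q) ¬h) (∈-elements⁺ x∈)))

∈-⊈ : ∀ (xs ys : List (Fin n)) → Unique xs → length ys < length xs → ∃[ x ] (x ∈ xs × x ∉ ys)
∈-⊈ xs ys u lt with any? (λ x → ¬? (x ∈F? ys)) xs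
... | yes h = find h
... | no ¬h = contradiction (unique-⊆-length u (λ {x} x∈ → decidable-stable (x ∈F? ys) (All.lookup (¬Any⇒All¬ xs ¬h) x∈))) (<⇒≱ lt)

∑-bump : ∀ {xs : List A} {f g : A → ℕ} {x} v → x ∈ xs → (∀ y → f y ≤ g y) → f x + v ≤ g x → ∑ xs f + v ≤ ∑ xs g
∑-bump {xs = x ∷ xs} {f} {g} v (here refl) le h = begin
  f x + ∑ xs f + v   ≡⟨ +-assoc (f x) (∑ xs f) v ⟩
  f x + (∑ xs f + v) ≡⟨ cong (f x +_) (+-comm (∑ xs f) v) ⟩
  f x + (v + ∑ xs f) ≡⟨ sym (+-assoc (f x) v (∑ xs f)) ⟩
  f x + v + ∑ xs f   ≤⟨ +-mono-≤ h (∑-mono xs (λ {y} _ → le y)) ⟩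
  g x + ∑ xs g       ∎
  where open ≤-Reasoning
∑-bump {xs = y ∷ xs} {f} {g} v (there p) le h =
  ≤-trans (≤-reflexive (+-assoc (f y) (∑ xs f) v)) (+-mono-≤ (le y) (∑-bump v p le h))

-- Charging each edge to one of its facets

nbrs : List (Subset n) → Subset n → List (Fin n)
nbrs {n} H S = filter (λ x → ¬? (x ∈ˢ? S) ×-dec ((⁅ x ⁆ ∪ S) ∈H? H)) (allFin n)

∈-nbrs⁺ : ∀ {H : List (Subset n)} {S x} → x ∉ˢ S → (⁅ x ⁆ ∪ S) ∈ H → x ∈ nbrs H S
∈-nbrs⁺ {H = H} {S} {x} p q = ∈-filter⁺ (λ x → ¬? (x ∈ˢ? S) ×-dec ((⁅ x ⁆ ∪ S) ∈H? H)) (∈-allFin x) (p , q)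

∈-nbrs⁻ : ∀ {H : List (Subset n)} {S x} → x ∈ nbrs H S → x ∉ˢ S × (⁅ x ⁆ ∪ S) ∈ H
∈-nbrs⁻ {n} {H} {S} p = proj₂ (∈-filter⁻ (λ x → ¬? (x ∈ˢ? S) ×-dec ((⁅ x ⁆ ∪ S) ∈H? H)) {xs = allFin n} p)

unique-nbrs : ∀ (H : List (Subset n)) S → Unique (nbrs H S)
unique-nbrs {n} H S = Uniqueₚ.filter⁺ (λ x → ¬? (x ∈ˢ? S) ×-dec ((⁅ x ⁆ ∪ S) ∈H? H)) (Uniqueₚ.allFin⁺ n)

_-ˢ_ : Subset n → Fin n → Subset n
e -ˢ x = edge (filter (λ y → ¬? (y ≟F x)) (elements e))

edge-∷-ˢ : ∀ {x : Fin n} {l} → Unique (x ∷ l) → edge (x ∷ l) -ˢ x ≡ edge l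
edge-∷-ˢ {x = x} {l} u = edge-cong (filter (λ y → ¬? (y ≟F x)) (elements (edge (x ∷ l)))) l to from
  where
  to : ∀ {y} → y ∈ filter (λ y → ¬? (y ≟F x)) (elements (edge (x ∷ l))) → y ∈ l
  to y∈ with ∈-filter⁻ (λ y → ¬? (y ≟F x)) {xs = elements (edge (x ∷ l))} y∈
  ... | p , ne with ∈-edge⁻ (x ∷ l) (∈-elements⁻ p)
  ... | here e = contradiction e ne
  ... | there q = q
  from : ∀ {y} → y ∈ l → y ∈ filter (λ y → ¬? (y ≟F x)) (elements (edge (x ∷ l)))
  from y∈ = ∈-filter⁺ (λ y → ¬? (y ≟F x)) (∈-elements⁺ (∈-edge⁺ (there y∈))) (λ { refl → unique-∷⁻ u y∈ })

record Charge (r M : ℕ) (H : List (Subset n)) : Set where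
  field
    W : Subset n → List (Fin n)
    unique-W : ∀ S → Unique (W S)
    W≤ : ∀ S → length (W S) ≤ M
    W⇒edge : ∀ {S x} → x ∈ W S → x ∉ˢ S × (⁅ x ⁆ ∪ S) ∈ H
    total : length H ≤ ∑ (allSub n (r ∸ 1)) (length ∘ W)

blockPath-mono : ∀ {H H′ : List (Subset n)} {a b L bs} → (∀ {e} → e ∈ H′ → e ∈ H) → BlockPath H′ a b L bs → BlockPath H a b L bs
blockPath-mono f (blockPath alt len lk u) = blockPath alt len (Linked.map f lk) u

-- The vertex number of P_{2k}(a,b): a facet of larger degree has a neighbour outside any partial
-- path.
chargeBound : ℕ → ℕ → ℕ → ℕ
chargeBound a b k = k * (a + b) + a

-- If every facet of every edge had large degree, a path could be built greedily.
module Greedy {n : ℕ} (a b k : ℕ) (H : List (Subset n)) (sizes : ∀ {e} → e ∈ H → ∣ e ∣ ≡ a + b)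
  (large : ∀ {e x} → e ∈ H → x ∈ˢ e → chargeBound a b k < length (nbrs H (e -ˢ x))) where

  -- The vertices of `X` are exchanged one at a time. Each new vertex moves over to the side of `Y`,
  -- so it belongs to the facet used for the next exchange.
  replace : ∀ X Y U → length U ≤ chargeBound a b k → Unique (X ++ Y) → edge (X ++ Y) ∈ H →
    ∃[ X′ ] (length X′ ≡ length X × Unique (X′ ++ Y) × edge (X′ ++ Y) ∈ H × (∀ {y} → y ∈ X′ → y ∉ U))
  replace [] Y U _ u h = [] , refl , u , h , λ ()
  replace (x ∷ X) Y U lenU (x∉ ∷ u) h
    with ∈-⊈ (nbrs H (edge (X ++ Y))) U (unique-nbrs H (edge (X ++ Y)))
           (≤-trans (s≤s lenU) (subst (λ S → chargeBound a b k < length (nbrs H S)) (edge-∷-ˢ {l = X ++ Y} (x∉ ∷ u)) (large h (∈-edge⁺ {xs = x ∷ X ++ Y} (here refl)))))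
  ... | x′ , x′∈ , x′∉U with ∈-nbrs⁻ x′∈
  ... | x′∉ , h′ with replace X (x′ ∷ Y) U lenU u′ (subst (_∈ H) (edge-shift x′ X Y) h′)
    where
    u′ : Unique (X ++ x′ ∷ Y)
    u′ = let (uX , uY , d) = unique-++⁻ X u in
      unique-++⁺ uX (unique-∷⁺ (λ p → x′∉ (∈-edge⁺ (∈-++⁺ʳ X p))) uY)
        (λ { p (here refl) → x′∉ (∈-edge⁺ (∈-++⁺ˡ p)) ; p (there q) → d p q })
  ... | X′ , l , u′ , h″ , av = x′ ∷ X′ , cong suc l ,
      (let (uX , uY , d) = unique-++⁻ X′ u′ in unique-∷⁺ (λ p → fresh uY d (∈-++⁻ X′ p))
        (unique-++⁺ uX (AllPairs.tail uY) (λ p q → d p (there q)))) ,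
      subst (_∈ H) (sym (edge-shift x′ X′ Y)) h″ ,
      λ { (here refl) → x′∉U ; (there p) → av p }
    where
    fresh : Unique (x′ ∷ Y) → (∀ {x} → x ∈ X′ → x ∉ x′ ∷ Y) → ¬ (x′ ∈ X′ ⊎ x′ ∈ Y)
    fresh _ d (inj₁ p) = d p (here refl)
    fresh uY _ (inj₂ p) = unique-∷⁻ uY p

  St : ℕ → List (Fin n) → Set
  St m c = length c ≡ a × ∃[ Y ] (length Y ≡ b × Unique (c ++ Y) × edge (c ++ Y) ∈ H)

  step : Step H a b k St (λ _ _ → ⊤)
  step m c U _ (lc , Y , lY , u , h) _ lenU
    with replace Y c U (≤-trans (m≤m+n _ b) lenU) (let (uc , uY , d) = unique-++⁻ c u in unique-++⁺ uY uc (λ p q → d q p)) (subst (_∈ H) (edge-swap c Y) h)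
  ... | x , lx , ux , hx , avx
    with replace c x U (≤-trans (m≤m+n _ b) lenU) (let (uc , uY , d) = unique-++⁻ x ux in unique-++⁺ uY uc (λ p q → d q p)) (subst (_∈ H) (edge-swap x c) hx)
  ... | c′ , lc′ , uc′ , hc′ , avc = x , c′ , trans lx lY , trans lc′ lc ,
    (let (uc , uY , d) = unique-++⁻ c′ uc′ in unique-++⁺ uY uc (λ p q → d q p)) ,
    (λ y∈ → [ avx , avc ]′ (∈-++⁻ x y∈)) ,
    subst (_∈ H) (edge-swap x c) hx , subst (_∈ H) (edge-swap c′ x) hc′ ,
    (trans lc′ lc , x , trans lx lY , uc′ , hc′) , All.tabulate (λ _ → tt)

  open Build H a b k St (λ _ _ → ⊤) id step

  greedyPath : ∀ {e} → e ∈ H → ∃[ bs ] BlockPath H a b (2 * k) bs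
  greedyPath {e} e∈ = build c st (Uniqueₚ.take⁺ a (unique-elements e)) lc (All.tabulate (λ _ → tt))
    where
    c = take a (elements e)
    len-e : length (elements e) ≡ a + b
    len-e = trans (length-elements e) (sizes e∈)
    lc : length c ≡ a
    lc = trans (length-take a (elements e)) (trans (cong (a ⊓_) len-e) (m≤n⇒m⊓n≡m (m≤m+n a b)))
    st : St 0 c
    st = lc , drop a (elements e) , trans (length-drop a (elements e)) (trans (cong (_∸ a) len-e) (m+n∸m≡n a b)) ,
      subst Unique (sym (take++drop≡id a (elements e))) (unique-elements e) ,
      subst (_∈ H) (sym (trans (cong edge (take++drop≡id a (elements e))) (edge-elements e))) e∈

-- As long as edges remain, some facet `S` has degree at most `M`, since otherwise the greedy path
-- exists. All edges above `S` are charged to it and deleted. No remaining edge contains `S`, so the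
-- recursive charge is empty at `S` and overwriting it there loses nothing.
charge : ∀ {n} a b k (H : List (Subset n)) → 1 ≤ b → (∀ bs → ¬ BlockPath H a b (2 * k) bs) →
  IsRGraph (a + b) n H → Charge (a + b) (chargeBound a b k) H
charge {n} a b k H 1≤b noPath (uH , sH) = go (length H) H ≤-refl noPath uH (All.lookup sH)
  where
  M = chargeBound a b k
  go : ∀ m H → length H ≤ m → (∀ bs → ¬ BlockPath H a b (2 * k) bs) → Unique H → (∀ {e} → e ∈ H → ∣ e ∣ ≡ a + b) → Charge (a + b) M H
  go m [] _ _ _ _ = record { W = λ _ → [] ; unique-W = λ _ → [] ; W≤ = λ _ → z≤n ; W⇒edge = λ () ; total = z≤n }
  go (suc m) H@(e₁ ∷ _) le noPath uH sH
    with any? (λ e → any? (λ x → length (nbrs H (e -ˢ x)) ≤? M) (elements e)) H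
  ... | no none = ⊥-elim (noPath _ (proj₂ (Greedy.greedyPath a b k H sH large (here refl))))
    where
    large : ∀ {e x} → e ∈ H → x ∈ˢ e → M < length (nbrs H (e -ˢ x))
    large {e} {x} e∈ x∈ = ≰⇒> (All.lookup (¬Any⇒All¬ (elements e) (All.lookup (¬Any⇒All¬ H none) e∈)) (∈-elements⁺ x∈))
  ... | yes some = let (e , e∈ , some′) = find some ; (x , x∈ , small) = find some′ in step (e , x , e∈ , x∈ , small)
    where
    step : ∃[ e ] ∃[ x ] (e ∈ H × x ∈ elements e × length (nbrs H (e -ˢ x)) ≤ M) → Charge (a + b) M H
    step (e₀ , x₀ , e₀∈ , x₀∈ , small) = record
      { W = W′ ; unique-W = unique-W′ ; W≤ = W′≤ ; W⇒edge = W′⇒edge ; total = total′ }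
      where
      S = e₀ -ˢ x₀
      others = filter (λ y → ¬? (y ≟F x₀)) (elements e₀)
      ∣S∣ : suc ∣ S ∣ ≡ a + b
      ∣S∣ = begin
        suc ∣ S ∣           ≡⟨ cong suc (∣edge∣ uo) ⟩
        suc (length others) ≡⟨ sym (∣edge∣ (unique-∷⁺ x₀∉ uo)) ⟩
        ∣ edge (x₀ ∷ others) ∣ ≡⟨ cong ∣_∣ (trans (edge-cong (x₀ ∷ others) (elements e₀) to from) (edge-elements e₀)) ⟩
        ∣ e₀ ∣              ≡⟨ sH e₀∈ ⟩
        a + b               ∎
        where
        open ≡-Reasoning
        uo : Unique others
        uo = Uniqueₚ.filter⁺ (λ y → ¬? (y ≟F x₀)) (unique-elements e₀)
        x₀∉ : x₀ ∉ others
        x₀∉ p = proj₂ (∈-filter⁻ (λ y → ¬? (y ≟F x₀)) {xs = elements e₀} p) refl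
        to : ∀ {y} → y ∈ x₀ ∷ others → y ∈ elements e₀
        to (here refl) = x₀∈
        to (there p) = proj₁ (∈-filter⁻ (λ y → ¬? (y ≟F x₀)) p)
        from : ∀ {y} → y ∈ elements e₀ → y ∈ x₀ ∷ others
        from {y} p with y ≟F x₀
        ... | yes e = here e
        ... | no ne = there (∈-filter⁺ (λ y → ¬? (y ≟F x₀)) p ne)
      S⊆e₀ : S ⊆ˢ e₀
      S⊆e₀ p = ∈-elements⁻ (proj₁ (∈-filter⁻ (λ y → ¬? (y ≟F x₀)) (∈-edge⁻ others p)))
      above? = λ (e : Subset n) → S ⊆ˢ? e
      H′ = filter (¬? ∘ above?) H
      H′⊆ : ∀ {e} → e ∈ H′ → e ∈ H
      H′⊆ p = proj₁ (∈-filter⁻ (¬? ∘ above?) p)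
      shorter : length H′ < length H
      shorter = filter-notAll (¬? ∘ above?) H (lose e₀∈ (λ ¬s → ¬s S⊆e₀))
      open Charge (go m H′ (≤-pred (≤-trans shorter le)) (λ bs p → noPath bs (blockPath-mono H′⊆ p))
        (Uniqueₚ.filter⁺ (¬? ∘ above?) uH) (λ p → sH (H′⊆ p)))
      choose : ∀ T → Dec (T ≡ S) → List (Fin n)
      choose T (yes _) = nbrs H S
      choose T (no _) = W T
      W′ : Subset n → List (Fin n)
      W′ T = choose T (T ≟ˢ S)
      unique-W′ : ∀ T → Unique (W′ T)
      unique-W′ T with T ≟ˢ S
      ... | yes _ = unique-nbrs H S
      ... | no _ = unique-W T
      W′≤ : ∀ T → length (W′ T) ≤ M
      W′≤ T with T ≟ˢ S
      ... | yes _ = small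
      ... | no _ = W≤ T
      W′⇒edge : ∀ {T x} → x ∈ W′ T → x ∉ˢ T × (⁅ x ⁆ ∪ T) ∈ H
      W′⇒edge {T} p with T ≟ˢ S
      ... | yes refl = ∈-nbrs⁻ p
      ... | no _ = proj₁ (W⇒edge p) , H′⊆ (proj₂ (W⇒edge p))
      WS-empty : length (W S) ≡ 0
      WS-empty with W S in eq
      ... | [] = refl
      ... | x ∷ _ = contradiction (λ {y} y∈ → x∈p∪q⁺ (inj₂ y∈)) (proj₂ (∈-filter⁻ (¬? ∘ above?) {xs = H} (proj₂ (W⇒edge (subst (x ∈_) (sym eq) (here refl))))))
      W≤W′ : ∀ T → length (W T) ≤ length (W′ T)
      W≤W′ T with T ≟ˢ S
      ... | yes refl = ≤-trans (≤-reflexive WS-empty) z≤n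
      ... | no _ = ≤-refl
      atS : length (W S) + length (nbrs H S) ≤ length (W′ S)
      atS with S ≟ˢ S
      ... | yes _ = ≤-reflexive (cong (_+ length (nbrs H S)) WS-empty)
      ... | no ne = contradiction refl ne
      above≤ : count above? H ≤ length (nbrs H S)
      above≤ = subst (count above? H ≤_) (length-map (λ x → ⁅ x ⁆ ∪ S) (nbrs H S))
        (unique-⊆-length (Uniqueₚ.filter⁺ above? uH) sub)
        where
        sub : ∀ {e} → e ∈ filter above? H → e ∈ map (λ x → ⁅ x ⁆ ∪ S) (nbrs H S)
        sub {e} p with ∈-filter⁻ above? {xs = H} p
        ... | e∈ , S⊆e with ∈-⊈ (elements e) (elements S) (unique-elements e)
             (≤-reflexive (trans (cong suc (length-elements S)) (trans ∣S∣ (sym (trans (length-elements e) (sH e∈))))))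
        ... | x , x∈ , x∉ = subst (_∈ map (λ x → ⁅ x ⁆ ∪ S) (nbrs H S)) eq (∈-map⁺ (λ x → ⁅ x ⁆ ∪ S) (∈-nbrs⁺ x∉S (subst (_∈ H) (sym eq) e∈)))
          where
          x∉S : x ∉ˢ S
          x∉S r = x∉ (∈-elements⁺ r)
          eq : ⁅ x ⁆ ∪ S ≡ e
          eq = ⊆-size⇒≡ (λ {y} r → [ (λ s → subst (_∈ˢ e) (sym (x∈⁅y⁆⇒x≡y x s)) (∈-elements⁻ x∈)) , S⊆e ]′ (x∈p∪q⁻ ⁅ x ⁆ S r))
            (≤-reflexive (trans (sH e∈) (trans (sym ∣S∣) (sym (∣⁅x⁆∪p∣ x S x∉S)))))
      S∈ : S ∈ allSub n (a + b ∸ 1)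
      S∈ = subst (λ z → S ∈ allSub n z) (cong (_∸ 1) ∣S∣) (∈-allSub S)
      total′ : length H ≤ ∑ (allSub n (a + b ∸ 1)) (length ∘ W′)
      total′ = begin
        length H                              ≡⟨ sym (count-¬ above? H) ⟩
        count above? H + length H′            ≡⟨ +-comm (count above? H) (length H′) ⟩
        length H′ + count above? H            ≤⟨ +-mono-≤ total above≤ ⟩
        ∑ (allSub n (a + b ∸ 1)) (length ∘ W) + length (nbrs H S) ≤⟨ ∑-bump (length (nbrs H S)) S∈ W≤W′ atS ⟩
        ∑ (allSub n (a + b ∸ 1)) (length ∘ W′) ∎
        where open ≤-Reasoning

-- Sets with many colours

nth : A → List A → ℕ → A
nth v [] i = v
nth v (x ∷ xs) zero = x
nth v (x ∷ xs) (suc i) = nth v xs i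

nth-∈ : ∀ (v : A) xs {i} → i < length xs → nth v xs i ∈ xs
nth-∈ v (x ∷ xs) {zero} _ = here refl
nth-∈ v (x ∷ xs) {suc i} (s≤s lt) = there (nth-∈ v xs lt)

nth-∈-take : ∀ (v : A) xs {i c} → i < length xs → i < c → nth v xs i ∈ take c xs
nth-∈-take v (x ∷ xs) {zero} {suc c} _ _ = here refl
nth-∈-take v (x ∷ xs) {suc i} {suc c} (s≤s p) (s≤s q) = there (nth-∈-take v xs p q)

nth-injective : ∀ (v : A) {xs} → Unique xs → ∀ {i j} → i < length xs → j < length xs → nth v xs i ≡ nth v xs j → i ≡ j
nth-injective v {x ∷ xs} u {zero} {zero} p q e = refl
nth-injective v {x ∷ xs} u {zero} {suc j} p (s≤s q) e = contradiction (subst (_∈ xs) (sym e) (nth-∈ v xs q)) (unique-∷⁻ u)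
nth-injective v {x ∷ xs} u {suc i} {zero} (s≤s p) q e = contradiction (subst (_∈ xs) e (nth-∈ v xs p)) (unique-∷⁻ u)
nth-injective v {x ∷ xs} (_ ∷ u) {suc i} {suc j} (s≤s p) (s≤s q) e = cong suc (nth-injective v u p q e)

map-nth : ∀ (v : A) xs {d} → length xs ≡ d → map (λ j → nth v xs (toℕ {d} j)) (allFin d) ≡ xs
map-nth v [] refl = refl
map-nth v (x ∷ xs) refl = cong (x ∷_) (trans (map-tabulate Fin.suc (λ j → nth v (x ∷ xs) (toℕ j))) (trans (sym (map-tabulate id (λ j → nth v xs (toℕ j)))) (map-nth v xs refl)))

Position : ℕ → ℕ → Set
Position d k = Fin d ⊎ Fin k

_≟⊎_ : ∀ {d k} → DecidableEquality (Position d k)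
_≟⊎_ = Sumₚ.≡-dec _≟F_ _≟F_

positions : ∀ d k → List (Position d k)
positions d k = map inj₁ (allFin d) ++ map inj₂ (allFin k)

∈-positions : ∀ d k (p : Position d k) → p ∈ positions d k
∈-positions d k (inj₁ i) = ∈-++⁺ˡ (∈-map⁺ inj₁ (∈-allFin i))
∈-positions d k (inj₂ i) = ∈-++⁺ʳ (map inj₁ (allFin d)) (∈-map⁺ inj₂ (∈-allFin i))

∉-map-inj₁ : ∀ {y : B} {xs : List A} → inj₂ y ∉ map inj₁ xs
∉-map-inj₁ p with ∈-map⁻ inj₁ p
... | _ , _ , ()

agree⇒≡ : ∀ {T P : Set} {n : ℕ} (lk : T → P → Fin n) {t t′} xs → All (λ p → lk t p ≡ lk t′ p) xs → map (lk t) xs ≡ map (lk t′) xs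
agree⇒≡ lk [] [] = refl
agree⇒≡ lk (x ∷ xs) (e ∷ es) = cong₂ _∷_ e (agree⇒≡ lk xs es)

edge-∷-∈ : ∀ {n} {H : List (Subset n)} {l l′ : List (Fin n)} {x} → (⁅ x ⁆ ∪ edge l) ∈ H →
  (∀ {y} → y ∈ l → y ∈ l′) → (∀ {y} → y ∈ l′ → y ∈ l) → edge (x ∷ l′) ∈ H
edge-∷-∈ {H = H} {l} {l′} {x} h f g = subst (_∈ H) (cong (⁅ x ⁆ ∪_) (edge-cong l l′ f g)) h

module ManyColours (a b′ k : ℕ) (b<a : suc b′ < a) (1≤k : 1 ≤ k) where

  private
    b = suc b′
    d = a + b′

  As Bs : List (Position d k)
  As = map inj₁ (take a (allFin d))
  Bs = map inj₁ (drop a (allFin d))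

  As++Bs : As ++ Bs ≡ map inj₁ (allFin d)
  As++Bs = trans (sym (map-++ inj₁ (take a (allFin d)) (drop a (allFin d)))) (cong (map inj₁) (take++drop≡id a (allFin d)))

  lenA : length As ≡ a
  lenA = trans (length-map inj₁ (take a (allFin d))) (trans (length-take a (allFin d)) (trans (cong (a ⊓_) (length-tabulate {n = d} id)) (m≤n⇒m⊓n≡m (m≤m+n a b′))))

  lenB : length Bs ≡ b′
  lenB = trans (length-map inj₁ (drop a (allFin d))) (trans (length-drop a (allFin d)) (trans (cong (_∸ a) (length-tabulate {n = d} id)) (m+n∸m≡n a b′)))

  unique-base : Unique (As ++ Bs)
  unique-base = subst Unique (sym As++Bs) (Uniqueₚ.map⁺ inj₁-injective (Uniqueₚ.allFin⁺ d))

  w∉AB : ∀ (i : Fin k) → inj₂ i ∉ As ++ Bs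
  w∉AB i p = ∉-map-inj₁ (subst (inj₂ i ∈_) As++Bs p)

  w∉e : ∀ (i j : Fin k) → i ≢ j → inj₂ i ∉ inj₂ j ∷ As ++ Bs
  w∉e i .i ne (here refl) = ne refl
  w∉e i j ne (there p) = w∉AB i p

  open Structure a b k (s≤s z≤n) b<a (Position d k) _≟⊎_ (positions d k) (∈-positions d k) d
    (map inj₁ (allFin d)) inj₂ As (λ _ → Bs) (λ _ → []) lenA (λ _ → cong suc lenB)
    (λ _ → cong (a +_) (trans (+-identityʳ _) lenB))
    (λ i → unique-∷⁺ (w∉AB i) unique-base)
    (λ i {p} p∈ → subst (p ∈_) (trans (sym As++Bs) (cong (As ++_) (sym (++-identityʳ Bs)))) p∈)
    w∉e
    using (structureBound; structure)

  module _ {n : ℕ} (v₀ : Fin n) (H : List (Subset n)) (noPath : ∀ bs → ¬ BlockPath H a b (2 * k) bs)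
    {M : ℕ} (ch : Charge (a + b) M H) where

    open Charge ch
    open Tuples n

    lk : Tup → Position d k → Fin n
    lk t (inj₁ j) = nth v₀ t (toℕ j)
    lk t (inj₂ i) = nth v₀ (W (edge t)) (toℕ i)

    rich? : Decidable (λ t → Unique t × k ≤ length (W (edge t)))
    rich? t = unique? t ×-dec (k ≤? length (W (edge t)))

    𝒢 : List Tup
    𝒢 = filter rich? (tuples d)

    𝒢⁻ : ∀ {t} → t ∈ 𝒢 → length t ≡ d × Unique t × k ≤ length (W (edge t))
    𝒢⁻ t∈ = tuples-length d (proj₁ (∈-filter⁻ rich? t∈)) , proj₂ (∈-filter⁻ rich? {xs = tuples d} t∈)

    map-lk : ∀ t → length t ≡ d → map (lk t) (As ++ Bs) ≡ t
    map-lk t lt = trans (cong (map (lk t)) As++Bs) (trans (sym (map-∘ (allFin d))) (map-nth v₀ t lt))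

    -- All `k` edges extend the same set, so no base coordinate lies outside an edge; and the
    -- colours depend only on that set, which the `d` base coordinates spell out.
    few-rich : length 𝒢 ≤ structureBound * n ^ (d ∸ 1)
    few-rich = structure H noPath lk 1≤k 𝒢 (Uniqueₚ.filter⁺ rich? (unique-tuples d)) injective edges∈ determine
      (λ i {t} {t′} t∈ t′∈ ag → cong (λ z → lk z (inj₂ i)) (same t∈ t′∈ (agree⇒≡ lk (As ++ Bs) ag)))
      where
      same : ∀ {t t′} → t ∈ 𝒢 → t′ ∈ 𝒢 → map (lk t) (As ++ Bs) ≡ map (lk t′) (As ++ Bs) → t ≡ t′
      same {t} {t′} t∈ t′∈ eq = trans (sym (map-lk t (proj₁ (𝒢⁻ t∈)))) (trans eq (map-lk t′ (proj₁ (𝒢⁻ t′∈))))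
      determine : ∀ {t t′} → t ∈ 𝒢 → t′ ∈ 𝒢 → All (λ p → lk t p ≡ lk t′ p) (map inj₁ (allFin d)) → t ≡ t′
      determine t∈ t′∈ ag = same t∈ t′∈ (agree⇒≡ lk (As ++ Bs) (subst (All _) (sym As++Bs) ag))
      edges∈ : ∀ {t} → t ∈ 𝒢 → ∀ i → edge (map (lk t) (inj₂ i ∷ As ++ Bs)) ∈ H
      edges∈ {t} t∈ i with 𝒢⁻ t∈
      ... | lt , u , kW = subst (λ z → edge (lk t (inj₂ i) ∷ z) ∈ H) (sym (map-lk t lt))
            (proj₂ (W⇒edge (nth-∈ v₀ (W (edge t)) (<-≤-trans (toℕ<n i) kW))))
      injective : ∀ {t} → t ∈ 𝒢 → ∀ {p q} → p ≢ q → lk t p ≢ lk t q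
      injective {t} t∈ {p} {q} ne eq with 𝒢⁻ t∈
      ... | lt , u , kW = ne (go p q eq)
        where
        j< : ∀ (j : Fin d) → toℕ j < length t
        j< j = subst (toℕ j <_) (sym lt) (toℕ<n j)
        i< : ∀ (i : Fin k) → toℕ i < length (W (edge t))
        i< i = <-≤-trans (toℕ<n i) kW
        apart : ∀ i j → nth v₀ (W (edge t)) (toℕ {k} i) ≢ nth v₀ t (toℕ {d} j)
        apart i j e = proj₁ (W⇒edge (nth-∈ v₀ (W (edge t)) (i< i))) (subst (_∈ˢ edge t) (sym e) (∈-edge⁺ (nth-∈ v₀ t (j< j))))
        go : ∀ p q → lk t p ≡ lk t q → p ≡ q
        go (inj₁ i) (inj₁ j) e = cong inj₁ (toℕ-injective (nth-injective v₀ u (j< i) (j< j) e))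
        go (inj₁ i) (inj₂ j) e = contradiction (sym e) (apart j i)
        go (inj₂ i) (inj₁ j) e = contradiction e (apart i j)
        go (inj₂ i) (inj₂ j) e = cong inj₂ (toℕ-injective (nth-injective v₀ (unique-W (edge t)) (i< i) (i< j) e))

    few-colourful : count (λ S → k ≤? length (W S)) (allSub n d) ≤ structureBound * n ^ (d ∸ 1)
    few-colourful = ≤-trans (subst (_≤ length 𝒢) (length-map elements many) (unique-⊆-length uq sub)) few-rich
      where
      many? = λ S → k ≤? length (W S)
      many = filter many? (allSub n d)
      uq : Unique (map elements many)
      uq = Uniqueₚ.map⁺ elements-injective
        (Uniqueₚ.filter⁺ many? (unique-allSub n d))
      sub : ∀ {t} → t ∈ map elements many → t ∈ 𝒢
      sub t∈ with ∈-map⁻ elements t∈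
      ... | S , S∈ , refl with ∈-filter⁻ many? {xs = allSub n d} S∈
      ... | S∈′ , big = ∈-filter⁺ rich? (∈-tuples (trans (length-elements S) (allSub-size n d S∈′)))
        (unique-elements S , subst (λ z → k ≤ length (W z)) (sym (edge-elements S)) big)

  abstract
    -- The order of quantifiers is the point: the constant is fixed before `n`, `H` and the charge,
    -- so it can enter the threshold for `n`.
    few-colourful-sets : ∃[ K ] (∀ {n} (v₀ : Fin n) (H : List (Subset n)) → (∀ bs → ¬ BlockPath H a b (2 * k) bs) → ∀ {M} (ch : Charge (a + b) M H) →
      count (λ S → k ≤? length (Charge.W ch S)) (allSub n d) ≤ K * n ^ (d ∸ 1))
    few-colourful-sets = structureBound , few-colourful

-- Neighbouring sets have the same colours

-- A tuple of a+b vertices holds two sets: the old one omits its last entry, the new one its first.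
-- The first `c` edges use the old set and its colours, the last edge the new set and one new
-- colour, which makes k = c+1. `As` is cut from the common middle, so the exchanged entries belong
-- to the parts `Bs`, which are nonempty because b ≥ 2.
module ColourChange (a b″ c : ℕ) (b<a : suc (suc b″) < a) where

  private
    k = suc c
    b = suc (suc b″)
    d = suc (a + suc b″)

  Pos : Set
  Pos = Position d k

  first middle As₀ rest₂ Bt₀ last₀ : List (Fin d)
  first = Fin.zero ∷ []
  middle = tabulate Fin.suc
  As₀ = take a middle
  rest₂ = drop a middle
  Bt₀ = take b″ rest₂
  last₀ = drop b″ rest₂

  lmiddle : length middle ≡ a + suc b″
  lmiddle = length-tabulate Fin.suc

  lAs₀ : length As₀ ≡ a
  lAs₀ = trans (length-take a middle) (trans (cong (a ⊓_) lmiddle) (m≤n⇒m⊓n≡m (m≤m+n a (suc b″))))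

  lrest₂ : length rest₂ ≡ suc b″
  lrest₂ = trans (length-drop a middle) (trans (cong (_∸ a) lmiddle) (m+n∸m≡n a (suc b″)))

  lBt₀ : length Bt₀ ≡ b″
  lBt₀ = trans (length-take b″ rest₂) (trans (cong (b″ ⊓_) lrest₂) (m≤n⇒m⊓n≡m (n≤1+n b″)))

  llast₀ : length last₀ ≡ 1
  llast₀ = trans (length-drop b″ rest₂) (trans (cong (_∸ b″) lrest₂) (m+n∸n≡m 1 b″))

  whole : first ++ As₀ ++ Bt₀ ++ last₀ ≡ allFin d
  whole = cong (Fin.zero ∷_) (trans (cong (As₀ ++_) (take++drop≡id b″ rest₂)) (take++drop≡id a middle))

  unique-whole : Unique (first ++ As₀ ++ Bt₀ ++ last₀)
  unique-whole = subst Unique (sym whole) (Uniqueₚ.allFin⁺ d)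

  isOld? : (i : Fin k) → Dec (toℕ i < c)
  isOld? i = toℕ i <? c

  Bs₀ Zs₀ : ∀ {P : Set} → Dec P → List (Fin d)
  Bs₀ (yes _) = first ++ Bt₀
  Bs₀ (no _) = Bt₀ ++ last₀
  Zs₀ (yes _) = last₀
  Zs₀ (no _) = first

  As : List Pos
  As = map inj₁ As₀

  Bs Zs : Fin k → List Pos
  Bs i = map inj₁ (Bs₀ (isOld? i))
  Zs i = map inj₁ (Zs₀ (isOld? i))

  ∈-cases : ∀ {x} (P : Set) → (x ∈ first → P) → (x ∈ As₀ → P) → (x ∈ Bt₀ → P) → (x ∈ last₀ → P) → x ∈ first ++ As₀ ++ Bt₀ ++ last₀ → P
  ∈-cases P f g h l (here e) = f (here e)
  ∈-cases P f g h l (there p) with ∈-++⁻ As₀ p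
  ... | inj₁ q = g q
  ... | inj₂ q with ∈-++⁻ Bt₀ q
  ... | inj₁ r = h r
  ... | inj₂ r = l r

  lenBs₀ : ∀ {P : Set} (q : Dec P) → length (Bs₀ q) ≡ suc b″
  lenBs₀ (yes _) = cong suc lBt₀
  lenBs₀ (no _) = trans (length-++ Bt₀) (trans (cong₂ _+_ lBt₀ llast₀) (+-comm b″ 1))

  lenZs₀ : ∀ {P : Set} (q : Dec P) → length (Zs₀ q) ≡ 1
  lenZs₀ (yes _) = llast₀
  lenZs₀ (no _) = refl

  unique-AB₀ : ∀ {P : Set} (q : Dec P) → Unique (As₀ ++ Bs₀ q)
  unique-AB₀ q with unique-++⁻ first unique-whole
  ... | _ , u , d₁ with unique-++⁻ As₀ u
  ... | uA , u₂ , d₂ with unique-++⁻ Bt₀ u₂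
  unique-AB₀ (yes _) | _ , u , d₁ | uA , u₂ , d₂ | uB , _ , _ = unique-++⁺ uA
    (unique-∷⁺ (λ p → d₁ (here refl) (∈-++⁺ʳ As₀ (∈-++⁺ˡ p))) uB)
    λ { p (here refl) → d₁ (here refl) (∈-++⁺ˡ p) ; p (there r) → d₂ p (∈-++⁺ˡ r) }
  unique-AB₀ (no _) | _ , u , d₁ | uA , u₂ , d₂ | _ = u

  ⊆ABZ : ∀ {P : Set} (q : Dec P) {x} → x ∈ allFin d → x ∈ As₀ ++ Bs₀ q ++ Zs₀ q
  ⊆ABZ q {x} x∈ = ∈-cases _ (f q) ∈-++⁺ˡ (h q) (l q) (subst (x ∈_) (sym whole) x∈)
    where
    f : ∀ {P : Set} (q : Dec P) → x ∈ first → x ∈ As₀ ++ Bs₀ q ++ Zs₀ q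
    f (yes _) p = ∈-++⁺ʳ As₀ (∈-++⁺ˡ (∈-++⁺ˡ {xs = first} {ys = Bt₀} p))
    f (no _) p = ∈-++⁺ʳ As₀ (∈-++⁺ʳ (Bt₀ ++ last₀) p)
    h : ∀ {P : Set} (q : Dec P) → x ∈ Bt₀ → x ∈ As₀ ++ Bs₀ q ++ Zs₀ q
    h (yes _) p = ∈-++⁺ʳ As₀ (∈-++⁺ˡ (∈-++⁺ʳ first p))
    h (no _) p = ∈-++⁺ʳ As₀ (∈-++⁺ˡ (∈-++⁺ˡ p))
    l : ∀ {P : Set} (q : Dec P) → x ∈ last₀ → x ∈ As₀ ++ Bs₀ q ++ Zs₀ q
    l (yes _) p = ∈-++⁺ʳ As₀ (∈-++⁺ʳ (first ++ Bt₀) p)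
    l (no _) p = ∈-++⁺ʳ As₀ (∈-++⁺ˡ (∈-++⁺ʳ Bt₀ p))

  AB-map : ∀ i → As ++ Bs i ≡ map inj₁ (As₀ ++ Bs₀ (isOld? i))
  AB-map i = sym (map-++ inj₁ As₀ (Bs₀ (isOld? i)))

  w∉AB : ∀ i j → inj₂ i ∉ As ++ Bs j
  w∉AB i j p = ∉-map-inj₁ (subst (inj₂ i ∈_) (AB-map j) p)

  base⊆ : ∀ i {p} → p ∈ map inj₁ (allFin d) → p ∈ As ++ Bs i ++ Zs i
  base⊆ i p∈ with ∈-map⁻ inj₁ p∈
  ... | x , x∈ , refl = subst (inj₁ x ∈_)
    (trans (map-++ inj₁ As₀ _) (cong (As ++_) (map-++ inj₁ (Bs₀ (isOld? i)) (Zs₀ (isOld? i)))))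
    (∈-map⁺ inj₁ (⊆ABZ (isOld? i) x∈))

  w∉e : ∀ i j → i ≢ j → inj₂ i ∉ inj₂ j ∷ As ++ Bs j
  w∉e i .i ne (here refl) = ne refl
  w∉e i j ne (there p) = w∉AB i j p

  open Structure a b k (s≤s z≤n) b<a Pos _≟⊎_ (positions d k) (∈-positions d k) d
    (map inj₁ (allFin d)) inj₂ As Bs Zs
    (trans (length-map inj₁ As₀) lAs₀)
    (λ i → cong suc (trans (length-map inj₁ (Bs₀ (isOld? i))) (lenBs₀ (isOld? i))))
    (λ i → trans (cong (a +_) (trans (cong₂ _+_ (trans (length-map inj₁ (Bs₀ (isOld? i))) (lenBs₀ (isOld? i))) (trans (length-map inj₁ (Zs₀ (isOld? i))) (lenZs₀ (isOld? i)))) (+-comm (suc b″) 1))) (+-suc a (suc b″)))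
    (λ i → unique-∷⁺ (w∉AB i i) (subst Unique (sym (AB-map i)) (Uniqueₚ.map⁺ inj₁-injective (unique-AB₀ (isOld? i)))))
    base⊆
    w∉e
    using (structureBound; structure)

  module _ {n : ℕ} (v₀ : Fin n) (H : List (Subset n)) (noPath : ∀ bs → ¬ BlockPath H a b (2 * k) bs)
    {M : ℕ} (ch : Charge (a + b) M H) (ι : ℕ) (ι<c : ι < c) where

    open Charge ch
    open Tuples n

    oldW newW : Tup → List (Fin n)
    oldW t = W (edge (take (a + suc b″) t))
    newW t = W (edge (drop 1 t))

    colour : Tup → ∀ {P : Set} → Dec P → Fin k → Fin n
    colour t (yes _) i = nth v₀ (oldW t) (toℕ i)
    colour t (no _) i = nth v₀ (newW t) ι

    lk : Tup → Pos → Fin n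
    lk t (inj₁ j) = nth v₀ t (toℕ j)
    lk t (inj₂ i) = colour t (isOld? i) i

    -- If `edge t` were an edge, the entry omitted by one set could itself be a colour of that set,
    -- and the coordinates of the tuple would not be distinct; hence the condition `edge t ∉ H`.
    Changing : Tup → Set
    Changing t = Unique t × edge t ∉ H × c ≤ length (oldW t) × c ≤ length (newW t) × nth v₀ (newW t) ι ∉ take c (oldW t)

    changing? : Decidable Changing
    changing? t = unique? t ×-dec ¬? (edge t ∈H? H) ×-dec (c ≤? length (oldW t)) ×-dec (c ≤? length (newW t)) ×-dec ¬? (nth v₀ (newW t) ι ∈F? take c (oldW t))

    𝒢 : List Tup
    𝒢 = filter changing? (tuples d)

    𝒢⁻ : ∀ {t} → t ∈ 𝒢 → length t ≡ d × Changing t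
    𝒢⁻ t∈ = tuples-length d (proj₁ (∈-filter⁻ changing? t∈)) , proj₂ (∈-filter⁻ changing? {xs = tuples d} t∈)

    val : Tup → List (Fin d) → List (Fin n)
    val t = map (λ j → nth v₀ t (toℕ j))

    map-lk : ∀ t l → map (lk t) (map inj₁ l) ≡ val t l
    map-lk t l = sym (map-∘ l)

    val-whole : ∀ {t} → length t ≡ d → val t (first ++ As₀ ++ Bt₀ ++ last₀) ≡ t
    val-whole {t} lt = trans (cong (val t) whole) (map-nth v₀ t lt)

    oldList : List (Fin d)
    oldList = first ++ As₀ ++ Bt₀

    newList : List (Fin d)
    newList = As₀ ++ Bt₀ ++ last₀

    val-old : ∀ {t} → length t ≡ d → take (a + suc b″) t ≡ val t oldList
    val-old {t} lt = begin
      take (a + suc b″) t ≡⟨ cong (take (a + suc b″)) (sym (val-whole {t} lt)) ⟩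
      take (a + suc b″) (val t (first ++ As₀ ++ Bt₀ ++ last₀)) ≡⟨ cong (λ z → take (a + suc b″) (val t (Fin.zero ∷ z))) (sym (++-assoc As₀ Bt₀ last₀)) ⟩
      take (a + suc b″) (val t (oldList ++ last₀)) ≡⟨ cong (take (a + suc b″)) (map-++ (λ j → nth v₀ t (toℕ j)) oldList last₀) ⟩
      take (a + suc b″) (val t oldList ++ val t last₀) ≡⟨ take-++-≡ (a + suc b″) (val t oldList) len ⟩
      val t oldList ∎
      where
      open ≡-Reasoning
      len : length (val t oldList) ≡ a + suc b″
      len = trans (length-map (λ j → nth v₀ t (toℕ j)) oldList) (trans (cong suc (trans (length-++ As₀) (cong₂ _+_ lAs₀ lBt₀))) (sym (+-suc a b″)))

    val-new : ∀ {t} → length t ≡ d → drop 1 t ≡ val t newList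
    val-new {t} lt = cong (drop 1) (sym (val-whole {t} lt))

    val-∈⁺ : ∀ {t x l} → x ∈ l → nth v₀ t (toℕ x) ∈ val t l
    val-∈⁺ {t} = ∈-map⁺ (λ j → nth v₀ t (toℕ j))

    val-mono : ∀ {t l l′ y} → (∀ {x} → x ∈ l → x ∈ l′) → y ∈ val t l → y ∈ val t l′
    val-mono {t} f y∈ with ∈-map⁻ (λ j → nth v₀ t (toℕ j)) y∈
    ... | x , x∈ , refl = val-∈⁺ {t} (f x∈)

    AB⇒old : ∀ {x} → x ∈ As₀ ++ first ++ Bt₀ → x ∈ oldList
    AB⇒old p with ∈-++⁻ As₀ p
    ... | inj₁ q = there (∈-++⁺ˡ q)
    ... | inj₂ (here e) = here e
    ... | inj₂ (there q) = there (∈-++⁺ʳ As₀ q)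

    old⇒AB : ∀ {x} → x ∈ oldList → x ∈ As₀ ++ first ++ Bt₀
    old⇒AB (here e) = ∈-++⁺ʳ As₀ (here e)
    old⇒AB (there p) with ∈-++⁻ As₀ p
    ... | inj₁ q = ∈-++⁺ˡ q
    ... | inj₂ q = ∈-++⁺ʳ As₀ (there q)

    old-edge : ∀ {t x} → length t ≡ d → x ∈ oldW t → x ∉ val t oldList × (⁅ x ⁆ ∪ edge (val t oldList)) ∈ H
    old-edge {t} {x} lt x∈ with W⇒edge x∈
    ... | p , q = (λ r → p (subst (λ z → x ∈ˢ edge z) (sym (val-old {t} lt)) (∈-edge⁺ r))) , subst (λ z → (⁅ x ⁆ ∪ edge z) ∈ H) (val-old {t} lt) q

    new-edge : ∀ {t x} → length t ≡ d → x ∈ newW t → x ∉ val t newList × (⁅ x ⁆ ∪ edge (val t newList)) ∈ H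
    new-edge {t} {x} lt x∈ with W⇒edge x∈
    ... | p , q = (λ r → p (subst (λ z → x ∈ˢ edge z) (sym (val-new {t} lt)) (∈-edge⁺ r))) , subst (λ z → (⁅ x ⁆ ∪ edge z) ∈ H) (val-new {t} lt) q

    singleton-≡ : ∀ {xs : List (Fin d)} {x y} → length xs ≡ 1 → x ∈ xs → y ∈ xs → x ≡ y
    singleton-≡ {_ ∷ []} _ (here refl) (here refl) = refl

    old∌t : ∀ {t x} → length t ≡ d → edge t ∉ H → x ∈ oldW t → x ∉ t
    old∌t {t} {x} lt e∉ x∈ x∈t with ∈-map⁻ (λ j → nth v₀ t (toℕ j)) (subst (x ∈_) (sym (val-whole {t} lt)) x∈t)
    ... | j , j∈ , refl = ∈-cases ⊥ (λ p → inOld (∈-++⁺ˡ p)) (λ p → inOld (there (∈-++⁺ˡ p))) (λ p → inOld (there (∈-++⁺ʳ As₀ p))) atLast j∈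
      where
      inOld : j ∈ oldList → ⊥
      inOld p = proj₁ (old-edge {t} lt x∈) (val-∈⁺ {t} p)
      atLast : j ∈ last₀ → ⊥
      atLast p = e∉ (subst (_∈ H) (edge-cong (nth v₀ t (toℕ j) ∷ val t oldList) t to from) (proj₂ (old-edge {t} lt x∈)))
        where
        to : ∀ {y} → y ∈ nth v₀ t (toℕ j) ∷ val t oldList → y ∈ t
        to (here refl) = x∈t
        to {y} (there q) = subst (y ∈_) (val-whole {t} lt) (val-mono {t} {oldList} (λ {z} r → subst (z ∈_) (cong (Fin.zero ∷_) (++-assoc As₀ Bt₀ last₀)) (∈-++⁺ˡ {ys = last₀} r)) q)
        from : ∀ {y} → y ∈ t → y ∈ nth v₀ t (toℕ j) ∷ val t oldList
        from {y} q with ∈-map⁻ (λ j → nth v₀ t (toℕ j)) (subst (y ∈_) (sym (val-whole {t} lt)) q)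
        ... | i , i∈ , refl = ∈-cases (nth v₀ t (toℕ i) ∈ nth v₀ t (toℕ j) ∷ val t oldList) (λ r → there (val-∈⁺ {t} (∈-++⁺ˡ r))) (λ r → there (val-∈⁺ {t} {l = oldList} (there (∈-++⁺ˡ r)))) (λ r → there (val-∈⁺ {t} {l = oldList} (there (∈-++⁺ʳ As₀ r))))
                (λ r → here (cong (λ z → nth v₀ t (toℕ z)) (singleton-≡ llast₀ r p))) i∈

    new∌t : ∀ {t x} → length t ≡ d → edge t ∉ H → x ∈ newW t → x ∉ t
    new∌t {t} {x} lt e∉ x∈ x∈t with ∈-map⁻ (λ j → nth v₀ t (toℕ j)) (subst (x ∈_) (sym (val-whole {t} lt)) x∈t)
    ... | j , there j∈ , refl = proj₁ (new-edge {t} lt x∈) (val-∈⁺ {t} j∈)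
    ... | _ , here refl , refl = e∉ (subst (λ z → edge z ∈ H) (val-whole {t} lt) (proj₂ (new-edge {t} lt x∈)))

    few-changing : length 𝒢 ≤ structureBound * n ^ (d ∸ 1)
    few-changing = structure H noPath lk (s≤s z≤n) 𝒢 (Uniqueₚ.filter⁺ changing? (unique-tuples d)) injective edges∈ determine wDet
      where
      determine : ∀ {t t′} → t ∈ 𝒢 → t′ ∈ 𝒢 → All (λ p → lk t p ≡ lk t′ p) (map inj₁ (allFin d)) → t ≡ t′
      determine {t} {t′} t∈ t′∈ ag = trans (sym (map-nth v₀ t (proj₁ (𝒢⁻ t∈)))) (trans
        (trans (sym (map-lk t (allFin d))) (trans (agree⇒≡ lk (map inj₁ (allFin d)) ag) (map-lk t′ (allFin d)))) (map-nth v₀ t′ (proj₁ (𝒢⁻ t′∈))))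
      wDet : ∀ i {t t′} → t ∈ 𝒢 → t′ ∈ 𝒢 → All (λ p → lk t p ≡ lk t′ p) (As ++ Bs i) → lk t (inj₂ i) ≡ lk t′ (inj₂ i)
      wDet i {t} {t′} t∈ t′∈ ag = byCase (isOld? i) (trans (sym (map-lk t _)) (trans (cong (map (lk t)) (sym (AB-map i)))
          (trans (agree⇒≡ lk (As ++ Bs i) ag) (trans (cong (map (lk t′)) (AB-map i)) (map-lk t′ _)))))
        where
        lt = proj₁ (𝒢⁻ t∈)
        lt′ = proj₁ (𝒢⁻ t′∈)
        byCase : ∀ {P : Set} (q : Dec P) → val t (As₀ ++ Bs₀ q) ≡ val t′ (As₀ ++ Bs₀ q) → colour t q i ≡ colour t′ q i
        byCase (yes _) eq = cong (λ z → nth v₀ (W z) (toℕ i)) (trans (setOf {t} lt) (trans (cong edge eq) (sym (setOf {t′} lt′))))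
          where
          setOf : ∀ {t} → length t ≡ d → edge (take (a + suc b″) t) ≡ edge (val t (As₀ ++ first ++ Bt₀))
          setOf {t} lt = trans (cong edge (val-old {t} lt)) (edge-cong (val t oldList) (val t (As₀ ++ first ++ Bt₀)) (val-mono {t} {oldList} {As₀ ++ first ++ Bt₀} old⇒AB) (val-mono {t} {As₀ ++ first ++ Bt₀} {oldList} AB⇒old))
        byCase (no _) eq = cong (λ z → nth v₀ (W (edge z)) ι) (trans (val-new {t} lt) (trans eq (sym (val-new {t′} lt′))))
      edges∈ : ∀ {t} → t ∈ 𝒢 → ∀ i → edge (map (lk t) (inj₂ i ∷ As ++ Bs i)) ∈ H
      edges∈ {t} t∈ i with 𝒢⁻ t∈
      ... | lt , _ , _ , cO , cN , _ = subst (λ z → edge (lk t (inj₂ i) ∷ z) ∈ H) (sym (trans (cong (map (lk t)) (AB-map i)) (map-lk t _))) (byCase (isOld? i))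
        where
        byCase : (q : Dec (toℕ i < c)) → edge (colour t q i ∷ val t (As₀ ++ Bs₀ q)) ∈ H
        byCase (yes i<c) = edge-∷-∈ {l = val t oldList} (proj₂ (old-edge {t} lt (nth-∈ v₀ (oldW t) (<-≤-trans i<c cO)))) (val-mono {t} {oldList} {As₀ ++ first ++ Bt₀} old⇒AB) (val-mono {t} {As₀ ++ first ++ Bt₀} {oldList} AB⇒old)
        byCase (no _) = proj₂ (new-edge {t} lt (nth-∈ v₀ (newW t) (<-≤-trans ι<c cN)))
      injective : ∀ {t} → t ∈ 𝒢 → ∀ {p q} → p ≢ q → lk t p ≢ lk t q
      injective {t} t∈ {p} {q} ne eq with 𝒢⁻ t∈
      ... | lt , u , e∉ , cO , cN , new = ne (go p q eq)
        where
        j< : ∀ (j : Fin d) → toℕ j < length t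
        j< j = subst (toℕ j <_) (sym lt) (toℕ<n j)
        apart : ∀ i j → lk t (inj₂ i) ≢ lk t (inj₁ j)
        apart i j e = byCase (isOld? i) (subst (_∈ t) (sym e) (nth-∈ v₀ t (j< j)))
          where
          byCase : (q : Dec (toℕ i < c)) → colour t q i ∉ t
          byCase (yes i<c) = old∌t {t} lt e∉ (nth-∈ v₀ (oldW t) (<-≤-trans i<c cO))
          byCase (no _) = new∌t {t} lt e∉ (nth-∈ v₀ (newW t) (<-≤-trans ι<c cN))
        go₂ : ∀ i j (q : Dec (toℕ {k} i < c)) (q′ : Dec (toℕ {k} j < c)) → colour t q i ≡ colour t q′ j → toℕ i ≡ toℕ j
        go₂ i j (yes i<) (yes j<) e = nth-injective v₀ (unique-W (edge (take (a + suc b″) t))) (<-≤-trans i< cO) (<-≤-trans j< cO) e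
        go₂ i j (yes i<) (no _) e = contradiction (subst (_∈ take c (oldW t)) e (nth-∈-take v₀ (oldW t) (<-≤-trans i< cO) i<)) new
        go₂ i j (no _) (yes j<) e = contradiction (subst (_∈ take c (oldW t)) (sym e) (nth-∈-take v₀ (oldW t) (<-≤-trans j< cO) j<)) new
        -- Only the index `c` is not old, so both indices equal `c`.
        go₂ i j (no i≮) (no j≮) e = ≤-antisym (≤-trans (≤-pred (toℕ<n i)) (≮⇒≥ j≮)) (≤-trans (≤-pred (toℕ<n j)) (≮⇒≥ i≮))
        go : ∀ p q → lk t p ≡ lk t q → p ≡ q
        go (inj₁ i) (inj₁ j) e = cong inj₁ (toℕ-injective (nth-injective v₀ u (j< i) (j< j) e))
        go (inj₁ i) (inj₂ j) e = contradiction (sym e) (apart j i)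
        go (inj₂ i) (inj₁ j) e = contradiction e (apart i j)
        go (inj₂ i) (inj₂ j) e = cong inj₂ (toℕ-injective (go₂ i j (isOld? i) (isOld? j) e))

  abstract
    few-changing-tuples : ∃[ K ] (∀ {n} (v₀ : Fin n) (H : List (Subset n)) (noPath : ∀ bs → ¬ BlockPath H a b (2 * k) bs) {M} (ch : Charge (a + b) M H) ι (ι<c : ι < c) →
      Tuples.cnt n d (changing? v₀ H noPath ch ι ι<c) ≤ K * n ^ (d ∸ 1))
    few-changing-tuples = structureBound , few-changing

-- Asymptotic bounds

^-pred : ∀ n {d} → 1 ≤ d → n * n ^ (d ∸ 1) ≡ n ^ d
^-pred n {suc d} _ = refl

+-thin : ∀ {A B} K D X → A ≤ K * X → B ≤ D * X → A + B ≤ (K + D) * X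
+-thin K D X p q = ≤-trans (+-mono-≤ p q) (≤-reflexive (sym (*-distribʳ-+ X K D)))

module Thin (n : ℕ) where

  open Tuples n

  length-allSub≤ : ∀ j → length (allSub n j) ≤ n ^ j
  length-allSub≤ j = subst (length (allSub n j) ≤_) (length-tuples j)
    (subst (_≤ length (tuples j)) (length-map elements (allSub n j)) (unique-⊆-length uq sub))
    where
    uq : Unique (map elements (allSub n j))
    uq = Uniqueₚ.map⁺ elements-injective (unique-allSub n j)
    sub : ∀ {t} → t ∈ map elements (allSub n j) → t ∈ tuples j
    sub t∈ with ∈-map⁻ elements t∈
    ... | S , S∈ , refl = ∈-tuples (trans (length-elements S) (allSub-size n j S∈))

  -- Translates a bound on sets into a bound on tuples: an m-set contains the entries of m^j tuples
  -- of length j.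
  cnt-edge : ∀ (𝒮 : List (Subset n)) {m} → (∀ {S} → S ∈ 𝒮 → ∣ S ∣ ≡ m) → ∀ j {P : Tup → Set} (P? : Decidable P) →
    (∀ {t} → t ∈ tuples j → P t → ∃[ S ] (S ∈ 𝒮 × (∀ {x} → x ∈ t → x ∈ˢ S))) → cnt j P? ≤ length 𝒮 * m ^ j
  cnt-edge 𝒮 {m} size j P? f = ≤-trans (unique-⊆-length (Uniqueₚ.filter⁺ P? (unique-tuples j)) sub)
    (≤-reflexive (trans (length-concatMap (λ S → tuplesOver (elements S) j) 𝒮)
      (trans (∑-cong 𝒮 (λ {S} S∈ → trans (length-tuplesOver (elements S) j) (cong (_^ j) (trans (length-elements S) (size S∈))))) (∑-const 𝒮 (m ^ j)))))
    where
    sub : ∀ {t} → t ∈ filter P? (tuples j) → t ∈ concatMap (λ S → tuplesOver (elements S) j) 𝒮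
    sub {t} t∈ with ∈-filter⁻ P? {xs = tuples j} t∈
    ... | t∈′ , p = let (S , S∈ , sub) = f t∈′ p in
      ∈-concat⁺′ (subst (λ z → t ∈ tuplesOver (elements S) z) (tuples-length j t∈′) (∈-tuplesOver⁺ (elements S) t (λ x∈ → ∈-elements⁺ (sub x∈))))
        (∈-map⁺ (λ S → tuplesOver (elements S) j) S∈)

  -- The m-w entries outside the window are free, so losing one power of n on the window loses one
  -- power of n on the whole tuple, with the same constant.
  thin-window : ∀ {P : Tup → Set} (P? : Decidable P) w m i K → 1 ≤ w → i + w ≤ m → cnt w P? ≤ K * n ^ (w ∸ 1) →
    cnt m (λ t → P? (take w (drop i t))) ≤ K * n ^ (m ∸ 1)
  thin-window P? w m i K 1≤w le h = subst (λ z → cnt z (λ t → P? (take w (drop i t))) ≤ K * n ^ (z ∸ 1)) m≡ main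
    where
    j = m ∸ (i + w)
    m≡ : i + (w + j) ≡ m
    m≡ = trans (sym (+-assoc i w j)) (m+[n∸m]≡n le)
    open ≤-Reasoning
    main : cnt (i + (w + j)) (λ t → P? (take w (drop i t))) ≤ K * n ^ (i + (w + j) ∸ 1)
    main = begin
      cnt (i + (w + j)) (λ t → P? (take w (drop i t))) ≡⟨ cnt-drop (P? ∘ take w) i (w + j) ⟩
      n ^ i * cnt (w + j) (P? ∘ take w)                ≡⟨ cong (n ^ i *_) (cnt-take P? w j) ⟩
      n ^ i * (cnt w P? * n ^ j)                       ≤⟨ *-monoʳ-≤ (n ^ i) (*-monoˡ-≤ (n ^ j) h) ⟩
      n ^ i * (K * n ^ (w ∸ 1) * n ^ j)                ≡⟨ cong (n ^ i *_) (*-assoc K (n ^ (w ∸ 1)) (n ^ j)) ⟩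
      n ^ i * (K * (n ^ (w ∸ 1) * n ^ j))              ≡⟨ sym (*-assoc (n ^ i) K _) ⟩
      n ^ i * K * (n ^ (w ∸ 1) * n ^ j)                ≡⟨ cong (_* (n ^ (w ∸ 1) * n ^ j)) (*-comm (n ^ i) K) ⟩
      K * n ^ i * (n ^ (w ∸ 1) * n ^ j)                ≡⟨ *-assoc K (n ^ i) _ ⟩
      K * (n ^ i * (n ^ (w ∸ 1) * n ^ j))              ≡⟨ cong (λ z → K * (n ^ i * z)) (sym (^-distribˡ-+-* n (w ∸ 1) j)) ⟩
      K * (n ^ i * n ^ (w ∸ 1 + j))                    ≡⟨ cong (K *_) (sym (^-distribˡ-+-* n i (w ∸ 1 + j))) ⟩
      K * n ^ (i + (w ∸ 1 + j))                        ≡⟨ cong (λ z → K * n ^ z) (trans (cong (i +_) (sym (+-∸-comm j 1≤w))) (sym (+-∸-assoc i (≤-trans 1≤w (m≤m+n w j))))) ⟩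
      K * n ^ (i + (w + j) ∸ 1)                        ∎

module Upper (a b′ k : ℕ) (b<a : suc b′ < a) (1≤k : 1 ≤ k) where

  private
    b = suc b′
    d = a + b′
    M = chargeBound a b k

  open ManyColours a b′ k b<a 1≤k using (few-colourful-sets)

  colourBound : ℕ
  colourBound = proj₁ few-colourful-sets

  ab∸1 : a + b ∸ 1 ≡ d
  ab∸1 = cong (_∸ 1) (+-suc a b′)

  module _ {n : ℕ} (v₀ : Fin n) (H : List (Subset n)) (noPath : ∀ bs → ¬ BlockPath H a b (2 * k) bs)
    (ch : Charge (a + b) M H) where

    open Charge ch

    total′ : length H ≤ ∑ (allSub n d) (length ∘ W)
    total′ = subst (λ z → length H ≤ ∑ (allSub n z) (length ∘ W)) ab∸1 total

    many? : Decidable (λ S → k ≤ length (W S))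
    many? S = k ≤? length (W S)

    few? : Decidable (λ S → length (W S) < k ∸ 1)
    few? S = length (W S) <? (k ∸ 1)

    pointwise : ∀ S → length (W S) + 𝟙 (few? S) ≤ (k ∸ 1) + 𝟙 (many? S) * M
    pointwise S with few? S | many? S
    ... | yes p | _ = ≤-trans (≤-trans (≤-reflexive (+-comm _ 1)) p) (m≤m+n _ _)
    ... | no _ | yes _ = ≤-trans (≤-reflexive (+-identityʳ _)) (≤-trans (W≤ S) (≤-trans (m≤n+m M (k ∸ 1)) (+-monoʳ-≤ (k ∸ 1) (≤-reflexive (sym (+-identityʳ M))))))
    ... | no _ | no q = ≤-trans (≤-reflexive (+-identityʳ _)) (≤-trans (lower (≰⇒> q)) (m≤m+n _ _))
      where
      lower : ∀ {m} → m < k → m ≤ k ∸ 1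
      lower lt = ∸-monoˡ-≤ 1 lt

    -- Each set with fewer than k-1 colours costs at least one edge. Keeping these sets on the left
    -- gives the upper bound now, and for a graph of nearly maximal size a bound on their number in
    -- the stability argument.
    counted : length H + count few? (allSub n d) ≤ (k ∸ 1) * (n C d) + M * colourBound * n ^ (d ∸ 1)
    counted = begin
      length H + count few? (allSub n d)
        ≤⟨ +-monoˡ-≤ _ total′ ⟩
      ∑ (allSub n d) (length ∘ W) + count few? (allSub n d)
        ≡⟨ cong (∑ (allSub n d) (length ∘ W) +_) (count≡∑ few? (allSub n d)) ⟩
      ∑ (allSub n d) (length ∘ W) + ∑ (allSub n d) (𝟙 ∘ few?)
        ≡⟨ sym (∑-+ (allSub n d) _ _) ⟩
      ∑ (allSub n d) (λ S → length (W S) + 𝟙 (few? S))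
        ≤⟨ ∑-mono (allSub n d) (λ {S} _ → pointwise S) ⟩
      ∑ (allSub n d) (λ S → (k ∸ 1) + 𝟙 (many? S) * M)
        ≡⟨ ∑-+ (allSub n d) _ _ ⟩
      ∑ (allSub n d) (λ _ → k ∸ 1) + ∑ (allSub n d) (λ S → 𝟙 (many? S) * M)
        ≡⟨ cong₂ _+_ (trans (∑-const (allSub n d) (k ∸ 1)) (trans (*-comm _ (k ∸ 1)) (cong ((k ∸ 1) *_) (length-allSub n d))))
                     (trans (∑-*ʳ (allSub n d) (𝟙 ∘ many?) M) (cong (_* M) (sym (count≡∑ many? (allSub n d))))) ⟩
      (k ∸ 1) * (n C d) + count many? (allSub n d) * M
        ≤⟨ +-monoʳ-≤ ((k ∸ 1) * (n C d)) (≤-trans (≤-reflexive (*-comm (count many? (allSub n d)) M)) (*-monoʳ-≤ M (proj₂ few-colourful-sets v₀ H noPath ch))) ⟩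
      (k ∸ 1) * (n C d) + M * (colourBound * n ^ (d ∸ 1))
        ≡⟨ cong ((k ∸ 1) * (n C d) +_) (sym (*-assoc M colourBound (n ^ (d ∸ 1)))) ⟩
      (k ∸ 1) * (n C d) + M * colourBound * n ^ (d ∸ 1) ∎
      where open ≤-Reasoning

    length-H : length H ≤ M * n ^ d
    length-H = begin
      length H                    ≤⟨ total′ ⟩
      ∑ (allSub n d) (length ∘ W) ≤⟨ ∑-mono (allSub n d) (λ {S} _ → W≤ S) ⟩
      ∑ (allSub n d) (λ _ → M)    ≡⟨ ∑-const (allSub n d) M ⟩
      length (allSub n d) * M     ≤⟨ *-monoˡ-≤ M (Thin.length-allSub≤ n d) ⟩
      n ^ d * M                   ≡⟨ *-comm (n ^ d) M ⟩
      M * n ^ d                   ∎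
      where open ≤-Reasoning

upper-bound : ∀ a b k → 1 ≤ b → b < a → 1 ≤ k → ∃[ K ] (∀ n (H : List (Subset n)) → 1 ≤ n → IsRGraph (a + b) n H →
  (∀ bs → ¬ BlockPath H a b (2 * k) bs) → length H ≤ (k ∸ 1) * (n C (a + b ∸ 1)) + K * n ^ (a + b ∸ 2))
upper-bound a (suc b′) k _ b<a 1≤k = M * colourBound , bound
  where
  open Upper a b′ k b<a 1≤k
  M = chargeBound a (suc b′) k
  bound : ∀ n (H : List (Subset n)) → 1 ≤ n → IsRGraph (a + suc b′) n H → (∀ bs → ¬ BlockPath H a (suc b′) (2 * k) bs) →
    length H ≤ (k ∸ 1) * (n C (a + suc b′ ∸ 1)) + M * colourBound * n ^ (a + suc b′ ∸ 2)
  bound n H 1≤n rg noPath = subst (λ z → length H ≤ (k ∸ 1) * (n C (z ∸ 1)) + M * colourBound * n ^ (z ∸ 2)) (sym (+-suc a b′))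
    (≤-trans (m≤m+n _ _) (counted (fromℕ< 1≤n) H noPath (charge a (suc b′) k H (s≤s z≤n) noPath rg)))

-- Stability

Good : ∀ {n} → List (Subset n) → List (Fin n) → List (Fin n) → Set
Good H L y = Unique y × All (λ x → x ∉ y × edge (x ∷ y) ∈ H) L

good? : ∀ {n} (H : List (Subset n)) L → Decidable (Good H L)
good? H L y = unique? y ×-dec all? (λ x → ¬? (x ∈F? y) ×-dec (edge (x ∷ y) ∈H? H)) L

module Stability (a b″ c : ℕ) (b<a : suc (suc b″) < a) where

  private
    k = suc c
    b = suc (suc b″)
    d = a + suc b″
    M = chargeBound a b k

  1≤d : 1 ≤ d
  1≤d = ≤-trans (≤-trans (s≤s z≤n) b<a) (m≤m+n a (suc b″))

  CU CV : ℕ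
  CU = proj₁ (ManyColours.few-colourful-sets a (suc b″) k b<a (s≤s z≤n))
  CV = proj₁ (ColourChange.few-changing-tuples a b″ c b<a)

  -- One summand per kind of exception. `shortBound`: repeated entries, and tuples drawn from sets
  -- with fewer than `c` colours. `differBound`: repeated entries, tuples spanning an edge, either
  -- window short, and each of `c` positions for a new colour. `goodBound`: short tuples, and those
  -- whose colours differ from the centre's, reached by `d` exchanges.
  shortBound differBound goodBound : ℕ → ℕ
  shortBound C₂ = d * d + (C₂ + M * CU) * d ^ d
  differBound C₂ = suc d * suc d + (M * suc d ^ suc d + ((shortBound C₂ + shortBound C₂) + c * CV))
  goodBound C₂ = shortBound C₂ + d * differBound C₂

  module _ {n : ℕ} (H : List (Subset n)) (rg : IsRGraph (a + b) n H) (noPath : ∀ bs → ¬ BlockPath H a b (2 * k) bs)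
    (ch : Charge (a + b) M H) (C₂ : ℕ) (lower : c * (n C d) ≤ length H + C₂ * n ^ (d ∸ 1)) (v₀ : Fin n) (large : goodBound C₂ < n) where

    open Tuples n
    open Thin n
    open Upper a (suc b″) k b<a (s≤s z≤n) hiding (many?; few?)

    open Charge ch

    few? : Decidable (λ S → length (W S) < c)
    few? S = length (W S) <? c

    fewSets : count few? (allSub n d) ≤ (C₂ + M * CU) * n ^ (d ∸ 1)
    fewSets = +-cancelˡ-≤ (length H) _ _ (begin
      length H + count few? (allSub n d)                         ≤⟨ counted v₀ H noPath ch ⟩
      c * (n C d) + M * CU * n ^ (d ∸ 1)                         ≤⟨ +-monoˡ-≤ _ lower ⟩
      length H + C₂ * n ^ (d ∸ 1) + M * CU * n ^ (d ∸ 1)         ≡⟨ +-assoc (length H) _ _ ⟩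
      length H + (C₂ * n ^ (d ∸ 1) + M * CU * n ^ (d ∸ 1))       ≡⟨ cong (length H +_) (sym (*-distribʳ-+ (n ^ (d ∸ 1)) C₂ (M * CU))) ⟩
      length H + (C₂ + M * CU) * n ^ (d ∸ 1)                     ∎)
      where open ≤-Reasoning

    Short : Tup → Set
    Short t = ¬ Unique t ⊎ (Unique t × length t ≡ d × length (W (edge t)) < c)

    short? : Decidable Short
    short? t = ¬? (unique? t) ⊎-dec (unique? t ×-dec (length t ≟ d) ×-dec (length (W (edge t)) <? c))

    short-bound : cnt d short? ≤ shortBound C₂ * n ^ (d ∸ 1)
    short-bound = ≤-trans (count-⊎ short? (¬? ∘ unique?) fewT? (tuples d) (λ _ p → p)) (+-thin (d * d) _ (n ^ (d ∸ 1)) nonunique fewT)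
      where
      fewT? : Decidable (λ t → Unique t × length t ≡ d × length (W (edge t)) < c)
      fewT? t = unique? t ×-dec (length t ≟ d) ×-dec (length (W (edge t)) <? c)
      nonunique : cnt d (¬? ∘ unique?) ≤ d * d * n ^ (d ∸ 1)
      nonunique = go d 1≤d
        where
        go : ∀ d → 1 ≤ d → cnt d (¬? ∘ unique?) ≤ d * d * n ^ (d ∸ 1)
        go (suc d) _ = cnt-¬unique d
      fewT : cnt d fewT? ≤ (C₂ + M * CU) * d ^ d * n ^ (d ∸ 1)
      fewT = begin
        cnt d fewT? ≤⟨ cnt-edge (filter few? (allSub n d)) (λ S∈ → allSub-size n d (proj₁ (∈-filter⁻ few? S∈))) d fewT?
           (λ {t} _ (u , l , lt) → edge t , ∈-filter⁺ few? (subst (λ z → edge t ∈ allSub n z) (trans (∣edge∣ u) l) (∈-allSub (edge t))) lt , ∈-edge⁺) ⟩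
        count few? (allSub n d) * d ^ d ≤⟨ *-monoˡ-≤ (d ^ d) fewSets ⟩
        (C₂ + M * CU) * n ^ (d ∸ 1) * d ^ d ≡⟨ *-assoc (C₂ + M * CU) _ _ ⟩
        (C₂ + M * CU) * (n ^ (d ∸ 1) * d ^ d) ≡⟨ cong ((C₂ + M * CU) *_) (*-comm (n ^ (d ∸ 1)) (d ^ d)) ⟩
        (C₂ + M * CU) * (d ^ d * n ^ (d ∸ 1)) ≡⟨ sym (*-assoc (C₂ + M * CU) _ _) ⟩
        (C₂ + M * CU) * d ^ d * n ^ (d ∸ 1) ∎
        where open ≤-Reasoning

    -- Colours beyond the first `c` are cut off so that generic values have one size, and the result
    -- is a set because `W` may list the same colours in different orders.
    f : Tup → Subset n
    f l = edge (take c (W (edge l)))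

    Differ : Tup → Set
    Differ t = f (take d t) ≢ f (drop 1 t)

    differ? : Decidable Differ
    differ? t = ¬? (f (take d t) ≟ˢ f (drop 1 t))

    ∣f∣ : ∀ l → c ≤ length (W (edge l)) → ∣ f l ∣ ≡ c
    ∣f∣ l le = trans (∣edge∣ (Uniqueₚ.take⁺ c (unique-W (edge l)))) (trans (length-take c (W (edge l))) (m≤n⇒m⊓n≡m le))

    changing : ℕ → Tup → Set
    changing ι t = Unique t × edge t ∉ H × c ≤ length (W (edge (take d t))) × c ≤ length (W (edge (drop 1 t))) ×
      nth v₀ (W (edge (drop 1 t))) ι ∉ take c (W (edge (take d t)))

    changing? : ∀ ι → Decidable (changing ι)
    changing? ι t = unique? t ×-dec ¬? (edge t ∈H? H) ×-dec (c ≤? length (W (edge (take d t)))) ×-dec (c ≤? length (W (edge (drop 1 t)))) ×-dec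
      ¬? (nth v₀ (W (edge (drop 1 t))) ι ∈F? take c (W (edge (take d t))))

    take-nth : ∀ {A : Set} (v : A) c xs {x} → x ∈ take c xs → ∃[ i ] (i < c × x ≡ nth v xs i)
    take-nth v (suc c) (x ∷ xs) (here refl) = 0 , s≤s z≤n , refl
    take-nth v (suc c) (x ∷ xs) (there p) with take-nth v c xs p
    ... | i , lt , e = suc i , s≤s lt , e

    -- When none of the exceptions occurs, no colour of the new set is foreign to the old one; both
    -- colour sets have `c` elements, so the inclusion is an equality.
    differ-cases : ∀ {t} → length t ≡ suc d → Differ t → ¬ Unique t ⊎ (edge t ∈ H ⊎ ((Short (take d t) ⊎ Short (drop 1 t)) ⊎ Any (λ ι → changing ι t) (upTo c)))
    differ-cases {t} lt df with unique? t | edge t ∈H? H | short? (take d t) | short? (drop 1 t) | any? (λ ι → changing? ι t) (upTo c)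
    ... | no ¬u | _ | _ | _ | _ = inj₁ ¬u
    ... | yes _ | yes e∈ | _ | _ | _ = inj₂ (inj₁ e∈)
    ... | yes _ | no _ | yes s | _ | _ = inj₂ (inj₂ (inj₁ (inj₁ s)))
    ... | yes _ | no _ | no _ | yes s | _ = inj₂ (inj₂ (inj₁ (inj₂ s)))
    ... | yes _ | no _ | no _ | no _ | yes h = inj₂ (inj₂ (inj₂ h))
    ... | yes u | no e∉ | no s | no s′ | no h = contradiction (sym equal) df
      where
      uT = Uniqueₚ.take⁺ d u
      uD = Uniqueₚ.drop⁺ 1 u
      lT : length (take d t) ≡ d
      lT = trans (length-take d t) (trans (cong (d ⊓_) lt) (m≤n⇒m⊓n≡m (n≤1+n d)))
      lD : length (drop 1 t) ≡ d
      lD = trans (length-drop 1 t) (cong (_∸ 1) lt)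
      cT : c ≤ length (W (edge (take d t)))
      cT = ≮⇒≥ (λ lt → s (inj₂ (uT , lT , lt)))
      cD : c ≤ length (W (edge (drop 1 t)))
      cD = ≮⇒≥ (λ lt → s′ (inj₂ (uD , lD , lt)))
      sub : ∀ {x} → x ∈ take c (W (edge (drop 1 t))) → x ∈ take c (W (edge (take d t)))
      sub {x} x∈ with take-nth v₀ c (W (edge (drop 1 t))) x∈
      ... | ι , ι<c , refl = decidable-stable (_ ∈F? take c (W (edge (take d t))))
              (λ new → h (lose (∈-upTo⁺ ι<c) (u , e∉ , cT , cD , new)))
      equal : f (drop 1 t) ≡ f (take d t)
      equal = ⊆-size⇒≡ (λ {x} x∈ → ∈-edge⁺ (sub (∈-edge⁻ (take c (W (edge (drop 1 t)))) x∈)))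
        (≤-reflexive (trans (∣f∣ (take d t) cT) (sym (∣f∣ (drop 1 t) cD))))

    differ-bound : cnt (suc d) differ? ≤ differBound C₂ * n ^ d
    differ-bound = begin
      cnt (suc d) differ?
        ≤⟨ count-⊎ differ? (¬? ∘ unique?) e₁? (tuples (suc d)) (λ t∈ df → differ-cases (tuples-length (suc d) t∈) df) ⟩
      cnt (suc d) (¬? ∘ unique?) + cnt (suc d) e₁?
        ≤⟨ +-thin (suc d * suc d) _ (n ^ d) (cnt-¬unique d) (≤-trans (count-⊎ e₁? inH? e₂? (tuples (suc d)) (λ _ p → p)) (+-thin (M * suc d ^ suc d) _ (n ^ d) inH
            (≤-trans (count-⊎ e₂? e₃? ch? (tuples (suc d)) (λ _ p → p)) (+-thin (shortBound C₂ + shortBound C₂) (c * CV) (n ^ d)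
              (≤-trans (count-⊎ e₃? (short? ∘ take d) (short? ∘ drop 1) (tuples (suc d)) (λ _ p → p)) (+-thin (shortBound C₂) (shortBound C₂) (n ^ d) sT sD))
              changes)))) ⟩
      differBound C₂ * n ^ d ∎
      where
      open ≤-Reasoning
      inH? : Decidable (λ t → edge t ∈ H)
      inH? t = edge t ∈H? H
      ch? : Decidable (λ t → Any (λ ι → changing ι t) (upTo c))
      ch? t = any? (λ ι → changing? ι t) (upTo c)
      e₃? : Decidable (λ t → Short (take d t) ⊎ Short (drop 1 t))
      e₃? t = short? (take d t) ⊎-dec short? (drop 1 t)
      e₂? = λ t → e₃? t ⊎-dec ch? t
      e₁? = λ t → inH? t ⊎-dec e₂? t
      inH : cnt (suc d) inH? ≤ M * suc d ^ suc d * n ^ d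
      inH = begin
        cnt (suc d) inH?          ≤⟨ cnt-edge H (λ e∈ → trans (All.lookup (proj₂ rg) e∈) (+-suc a (suc b″))) (suc d) inH? (λ {t} _ e∈ → edge t , e∈ , ∈-edge⁺) ⟩
        length H * suc d ^ suc d  ≤⟨ *-monoˡ-≤ (suc d ^ suc d) (length-H v₀ H noPath ch) ⟩
        M * n ^ d * suc d ^ suc d ≡⟨ *-assoc M (n ^ d) (suc d ^ suc d) ⟩
        M * (n ^ d * suc d ^ suc d) ≡⟨ cong (M *_) (*-comm (n ^ d) (suc d ^ suc d)) ⟩
        M * (suc d ^ suc d * n ^ d) ≡⟨ sym (*-assoc M (suc d ^ suc d) (n ^ d)) ⟩
        M * suc d ^ suc d * n ^ d ∎
      window : ∀ i → i + d ≤ suc d → cnt (suc d) (λ t → short? (take d (drop i t))) ≤ shortBound C₂ * n ^ d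
      window i le = thin-window short? d (suc d) i (shortBound C₂) 1≤d le short-bound
      sT : cnt (suc d) (short? ∘ take d) ≤ shortBound C₂ * n ^ d
      sT = window 0 (n≤1+n d)
      sD : cnt (suc d) (short? ∘ drop 1) ≤ shortBound C₂ * n ^ d
      sD = ≤-trans (count-mono _ (λ t → short? (take d (drop 1 t))) (tuples (suc d))
        (λ {t} t∈ → subst Short (sym (take-all d (drop 1 t) (≤-reflexive (trans (length-drop 1 t) (cong (_∸ 1) (tuples-length (suc d) t∈)))))))) (window 1 ≤-refl)
      changes : cnt (suc d) ch? ≤ c * CV * n ^ d
      changes = begin
        cnt (suc d) ch?                              ≤⟨ count-Any changing? (upTo c) (tuples (suc d)) ⟩
        ∑ (upTo c) (λ ι → cnt (suc d) (changing? ι)) ≤⟨ ∑-mono (upTo c) (λ {ι} ι∈ → proj₂ (ColourChange.few-changing-tuples a b″ c b<a) v₀ H noPath ch ι (∈-upTo⁻ ι∈)) ⟩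
        ∑ (upTo c) (λ _ → CV * n ^ d)                ≡⟨ trans (∑-const (upTo c) _) (cong (_* (CV * n ^ d)) (length-upTo c)) ⟩
        c * (CV * n ^ d)                             ≡⟨ sym (*-assoc c CV (n ^ d)) ⟩
        c * CV * n ^ d                               ∎

    Apart : Tup → Set
    Apart t = f (take d t) ≢ f (drop d t)

    apart? : Decidable Apart
    apart? t = ¬? (f (take d t) ≟ˢ f (drop d t))

    -- Sliding a window of length d along a tuple of length 2d exchanges one vertex at a time.
    slide : ∀ {t} → length t ≡ d + d → Apart t → Any (λ i → Differ (take (suc d) (drop i t))) (upTo d)
    slide {t} lt ap with any? (λ i → differ? (take (suc d) (drop i t))) (upTo d)
    ... | yes h = h
    ... | no none = contradiction (sym (trans (cong f (sym lastWindow)) (chain d ≤-refl))) ap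
      where
      lastWindow : take d (drop d t) ≡ drop d t
      lastWindow = take-all d (drop d t) (≤-reflexive (trans (length-drop d t) (trans (cong (_∸ d) lt) (m+n∸n≡m d d))))
      drop-1-take : ∀ {A : Set} m (xs : List A) → drop 1 (take (suc m) xs) ≡ take m (drop 1 xs)
      drop-1-take m [] = sym (take-all m [] z≤n)
      drop-1-take m (x ∷ xs) = refl
      step : ∀ {i} → i < d → f (take d (drop (suc i) t)) ≡ f (take d (drop i t))
      step {i} lt′ = sym (trans (cong f (sym (trans (take-take d (suc d) (drop i t)) (cong (λ z → take z (drop i t)) (m≤n⇒m⊓n≡m (n≤1+n d))))))
        (trans same (cong f (trans (drop-1-take d (drop i t)) (cong (take d) (trans (drop-drop i 1 t) (cong (λ z → drop z t) (+-comm i 1))))))))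
        where
        same : f (take d (take (suc d) (drop i t))) ≡ f (drop 1 (take (suc d) (drop i t)))
        same = decidable-stable (_ ≟ˢ _) (All.lookup (¬Any⇒All¬ (upTo d) none) (∈-upTo⁺ lt′))
      chain : ∀ i → i ≤ d → f (take d (drop i t)) ≡ f (take d t)
      chain zero _ = refl
      chain (suc i) le = trans (step le) (chain i (<⇒≤ le))

    apart-bound : cnt (d + d) apart? ≤ d * differBound C₂ * n ^ (d + d ∸ 1)
    apart-bound = begin
      cnt (d + d) apart?
        ≤⟨ count-mono apart? (λ t → any? (λ i → differ? (take (suc d) (drop i t))) (upTo d)) (tuples (d + d)) (λ t∈ → slide (tuples-length (d + d) t∈)) ⟩
      cnt (d + d) (λ t → any? (λ i → differ? (take (suc d) (drop i t))) (upTo d))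
        ≤⟨ count-Any (λ i t → differ? (take (suc d) (drop i t))) (upTo d) (tuples (d + d)) ⟩
      ∑ (upTo d) (λ i → cnt (d + d) (λ t → differ? (take (suc d) (drop i t))))
        ≤⟨ ∑-mono (upTo d) (λ {i} i∈ → thin-window differ? (suc d) (d + d) i (differBound C₂) (s≤s z≤n) (subst (_≤ d + d) (sym (+-suc i d)) (+-monoˡ-≤ d (∈-upTo⁻ i∈))) differ-bound) ⟩
      ∑ (upTo d) (λ _ → differBound C₂ * n ^ (d + d ∸ 1))
        ≡⟨ trans (∑-const (upTo d) _) (cong (_* (differBound C₂ * n ^ (d + d ∸ 1))) (length-upTo d)) ⟩
      d * (differBound C₂ * n ^ (d + d ∸ 1))
        ≡⟨ sym (*-assoc d _ _) ⟩
      d * differBound C₂ * n ^ (d + d ∸ 1) ∎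
      where open ≤-Reasoning

    D = d * differBound C₂

    -- A tuple of length 2d is read as a pair (x , y); averaging over x turns few bad pairs into one
    -- x that agrees with almost all y.
    centre : ∃[ x ] (x ∈ tuples d × cnt d (λ y → ¬? (f x ≟ˢ f y)) ≤ D * n ^ (d ∸ 1))
    centre = ∑-average (tuples d) (D * n ^ (d ∸ 1)) nonempty (begin
      ∑ (tuples d) (λ x → cnt d (λ y → ¬? (f x ≟ˢ f y)))
        ≡⟨ ∑-cong (tuples d) (λ {x} x∈ → count-cong (λ y → ¬? (f x ≟ˢ f y)) (λ y → apart? (x ++ y)) (tuples d)
             (λ {y} _ ne → subst (λ z → f z ≢ f (drop d (x ++ y))) (sym (take-++-≡ d x (tuples-length d x∈))) (subst (λ z → f x ≢ f z) (sym (drop-++-≡ d x (tuples-length d x∈))) ne))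
             (λ {y} _ ne → subst (λ z → f x ≢ f z) (drop-++-≡ d x (tuples-length d x∈)) (subst (λ z → f z ≢ f (drop d (x ++ y))) (take-++-≡ d x (tuples-length d x∈)) ne))) ⟩
      ∑ (tuples d) (λ x → cnt d (λ y → apart? (x ++ y)))
        ≡⟨ sym (cnt-++ apart? d d) ⟩
      cnt (d + d) apart?
        ≤⟨ apart-bound ⟩
      D * n ^ (d + d ∸ 1)
        ≡⟨ cong (λ z → D * n ^ z) (+-∸-assoc d 1≤d) ⟩
      D * n ^ (d + (d ∸ 1))
        ≡⟨ cong (D *_) (^-distribˡ-+-* n d (d ∸ 1)) ⟩
      D * (n ^ d * n ^ (d ∸ 1))
        ≡⟨ trans (sym (*-assoc D _ _)) (trans (cong (_* n ^ (d ∸ 1)) (*-comm D (n ^ d))) (*-assoc (n ^ d) D _)) ⟩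
      n ^ d * (D * n ^ (d ∸ 1))
        ≡⟨ cong (_* (D * n ^ (d ∸ 1))) (sym (length-tuples d)) ⟩
      length (tuples d) * (D * n ^ (d ∸ 1)) ∎)
      where
      open ≤-Reasoning
      instance
        _ : NonZero n
        _ = >-nonZero (≤-trans (s≤s z≤n) large)
      nonempty : 0 < length (tuples d)
      nonempty = subst (0 <_) (sym (length-tuples d)) (m^n>0 n d)

    around : ∀ x → cnt d (λ y → ¬? (f x ≟ˢ f y)) ≤ D * n ^ (d ∸ 1) →
      ∃[ L ] (Unique L × length L ≡ c × cnt d (¬? ∘ good? H L) ≤ goodBound C₂ * n ^ (d ∸ 1))
    around x close = L , Uniqueₚ.take⁺ c (unique-W (edge x)) , trans (length-take c (W (edge x))) (m≤n⇒m⊓n≡m cx) , goodCount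
      where
      L = take c (W (edge x))
      bad? = λ y → short? y ⊎-dec ¬? (f x ≟ˢ f y)
      bad-bound : cnt d bad? ≤ goodBound C₂ * n ^ (d ∸ 1)
      bad-bound = ≤-trans (count-⊎ bad? short? (λ y → ¬? (f x ≟ˢ f y)) (tuples d) (λ _ p → p)) (+-thin (shortBound C₂) D (n ^ (d ∸ 1)) short-bound close)
      instance
        _ : NonZero n
        _ = >-nonZero (≤-trans (s≤s z≤n) large)
      bad< : cnt d bad? < n ^ d
      bad< = ≤-<-trans bad-bound (subst (goodBound C₂ * n ^ (d ∸ 1) <_) (^-pred n 1≤d) (*-monoˡ-< (n ^ (d ∸ 1)) {{m^n≢0 n (d ∸ 1)}} large))
      ¬bad : ∀ {y} → length y ≡ d → ¬ (Short y ⊎ f x ≢ f y) → Unique y × c ≤ length (W (edge y)) × f x ≡ f y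
      ¬bad {y} ly nb = u , ≮⇒≥ (λ lt → nb (inj₁ (inj₂ (u , ly , lt)))) , decidable-stable (f x ≟ˢ f y) (λ ne → nb (inj₂ ne))
        where
        u : Unique y
        u = decidable-stable (unique? y) (λ ¬u → nb (inj₁ (inj₁ ¬u)))
      -- The averaging may have picked an `x` with too few colours. Since `goodBound C₂ < n`, some
      -- tuple y is not exceptional; it has `c` colours and f x = f y, so `x` has them too.
      cx : c ≤ length (W (edge x))
      cx = begin
        c                          ≡⟨ sym (∣f∣ y cy) ⟩
        ∣ f y ∣                    ≡⟨ cong ∣_∣ (sym eq) ⟩
        ∣ f x ∣                    ≡⟨ ∣edge∣ (Uniqueₚ.take⁺ c (unique-W (edge x))) ⟩
        length (take c (W (edge x))) ≡⟨ length-take c (W (edge x)) ⟩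
        c ⊓ length (W (edge x))    ≤⟨ m⊓n≤n c _ ⟩
        length (W (edge x))        ∎
        where
        open ≤-Reasoning
        witness = cnt-∃¬ bad? d bad<
        y = proj₁ witness
        facts = ¬bad (proj₁ (proj₂ witness)) (proj₂ (proj₂ witness))
        cy = proj₁ (proj₂ facts)
        eq = proj₂ (proj₂ facts)
      goodCount : cnt d (¬? ∘ good? H L) ≤ goodBound C₂ * n ^ (d ∸ 1)
      goodCount = ≤-trans (count-mono (¬? ∘ good? H L) bad? (tuples d) (λ {y} y∈ ng → decidable-stable (bad? y) (λ nb → ng (isGood (tuples-length d y∈) nb)))) bad-bound
        where
        isGood : ∀ {y} → length y ≡ d → ¬ (Short y ⊎ f x ≢ f y) → Good H L y
        isGood {y} ly nb with ¬bad ly nb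
        ... | u , _ , eq = u , All.tabulate each
          where
          each : ∀ {z} → z ∈ L → z ∉ y × edge (z ∷ y) ∈ H
          each {z} z∈ with W⇒edge (∈-take c (∈-edge⁻ (take c (W (edge y))) (subst (z ∈ˢ_) eq (∈-edge⁺ z∈))))
          ... | z∉ , h = (λ p → z∉ (∈-edge⁺ p)) , h

    stability : ∃[ L ] (Unique L × length L ≡ c × cnt d (¬? ∘ good? H L) ≤ goodBound C₂ * n ^ (d ∸ 1))
    stability = around (proj₁ centre) (proj₂ (proj₂ centre))

-- Exactness

meetsˢ? : ∀ {n} (L : List (Fin n)) → Decidable (λ (e : Subset n) → Any (_∈ˢ e) L)
meetsˢ? L e = any? (_∈ˢ? e) L

star : ∀ {n} → ℕ → List (Fin n) → List (Subset n)
star {n} r L = filter (meetsˢ? L) (allSub n r)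

-- Without its first a-block, P_{2k}(a,b) is P_{2k-1}(b,a), which read backwards is P_{2k-1}(a,b).
-- Results on graphs without P_{2k}(a,b) thus apply to graphs without P_{2k-1}(a,b).
noOdd⇒noEven : ∀ {n} {H : List (Subset n)} {a b} c → (∀ bs → ¬ BlockPath H a b (2 * suc c ∸ 1) bs) → ∀ bs → ¬ BlockPath H a b (2 * suc c) bs
noOdd⇒noEven c noOdd [] p = contradiction (BlockPath.len p) (λ ())
noOdd⇒noEven c noOdd (x ∷ bs) p = noOdd (reverse bs) (reverse-path (suc c) (s≤s z≤n) (tail-path c p))

module Exact (a₁ b₁ c₁ : ℕ) (b≤a₁ : suc b₁ ≤ a₁) where

  private
    a = suc a₁
    b = suc b₁
    c = suc c₁
    k = suc c
    d = b + a₁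
    r = suc d
    M = chargeBound a b k
    -- Each of the `c` vertices of `L` is accompanied in the path by a-1 vertices of its a-block and
    -- a following b-block, `d` in all. Below, `j` is what is left of a facet after two disjoint
    -- b-sets: d = b + b + j.
    m = c * d
    j = a₁ ∸ b

  a₁≡ : b + j ≡ a₁
  a₁≡ = m+[n∸m]≡n b≤a₁

  a+b≡r : a + b ≡ r
  a+b≡r = cong suc (+-comm a₁ b)

  d≤m : d ≤ m
  d≤m = m≤m+n d (c₁ * d)

  a₁≤m : a₁ ≤ m
  a₁≤m = ≤-trans (m≤n+m a₁ b) d≤m

  -- Each a-block receives one vertex of `ws`, and `t` is otherwise read in order; so every edge
  -- between two of these blocks is a vertex of `ws` together with `d` consecutive entries of `t`.
  blocks : ∀ {A : Set} → List A → List A → List (List A)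
  blocks [] t = []
  blocks (w ∷ ws) t = (w ∷ take a₁ t) ∷ take b (drop a₁ t) ∷ blocks ws (drop b (drop a₁ t))

  lengths : ∀ {A : Set} {t : List A} x → length t ≡ d + x → length (take a₁ t) ≡ a₁ × length (take b (drop a₁ t)) ≡ b × length (drop b (drop a₁ t)) ≡ x
  lengths {t = t} x lt = trans (length-take a₁ t) (m≤n⇒m⊓n≡m (≤-trans (≤-trans (m≤n+m a₁ b) (m≤m+n d x)) (≤-reflexive (sym lt)))) ,
    trans (length-take b (drop a₁ t)) (m≤n⇒m⊓n≡m (≤-trans (m≤m+n b x) (≤-reflexive (sym ld)))) ,
    trans (length-drop b (drop a₁ t)) (trans (cong (_∸ b) ld) (m+n∸m≡n b x))
    where
    ld : length (drop a₁ t) ≡ b + x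
    ld = trans (length-drop a₁ t) (trans (cong (_∸ a₁) (trans lt (trans (cong (_+ x) (+-comm b a₁)) (+-assoc a₁ b x)))) (m+n∸m≡n a₁ (b + x)))

  blocks-alt : ∀ {A : Set} (ws : List A) t → length t ≡ length ws * d → Alt a b (blocks ws t)
  blocks-alt [] t lt = []
  blocks-alt (w ∷ ws) t lt = let (l₁ , l₂ , l₃) = lengths {t = t} (length ws * d) lt in cong suc l₁ ∷ l₂ ∷ blocks-alt ws _ l₃

  blocks-length : ∀ {A : Set} (ws t : List A) → length (blocks ws t) ≡ 2 * length ws
  blocks-length [] t = refl
  blocks-length (w ∷ ws) t = trans (cong (suc ∘ suc) (blocks-length ws _)) (cong suc (sym (+-suc (length ws) (length ws + 0))))

  ∈-blocks : ∀ {A : Set} (ws : List A) t {x} → x ∈ concat (blocks ws t) → x ∈ ws ⊎ x ∈ t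
  ∈-blocks (w ∷ ws) t (here e) = inj₁ (here e)
  ∈-blocks (w ∷ ws) t (there p) with ∈-++⁻ (take a₁ t) p
  ... | inj₁ q = inj₂ (∈-take a₁ q)
  ... | inj₂ q with ∈-++⁻ (take b (drop a₁ t)) q
  ... | inj₁ q′ = inj₂ (∈-drop a₁ (∈-take b q′))
  ... | inj₂ q′ with ∈-blocks ws _ q′
  ... | inj₁ s = inj₁ (there s)
  ... | inj₂ s = inj₂ (∈-drop a₁ (∈-drop b s))

  blocks-unique : ∀ {A : Set} (ws t : List A) → Unique ws → Unique t → (∀ {x} → x ∈ ws → x ∉ t) → Unique (concat (blocks ws t))
  blocks-unique [] t _ _ _ = []
  blocks-unique (w ∷ ws) t (w∉ ∷ uw) ut dis = unique-∷⁺ fresh (unique-++⁺ uX (unique-++⁺ uY uZ YZ) XYZ)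
    where
    X = take a₁ t
    Y = take b (drop a₁ t)
    t′ = drop b (drop a₁ t)
    Z = concat (blocks ws t′)
    uX = Uniqueₚ.take⁺ a₁ ut
    uY = Uniqueₚ.take⁺ b (Uniqueₚ.drop⁺ a₁ ut)
    uZ = blocks-unique ws t′ uw (Uniqueₚ.drop⁺ b (Uniqueₚ.drop⁺ a₁ ut)) (λ p q → dis (there p) (∈-drop a₁ (∈-drop b q)))
    splitX = proj₂ (proj₂ (unique-++⁻ X (subst Unique (sym (take++drop≡id a₁ t)) ut)))
    splitY = proj₂ (proj₂ (unique-++⁻ Y (subst Unique (sym (take++drop≡id b (drop a₁ t))) (Uniqueₚ.drop⁺ a₁ ut))))
    YZ : ∀ {x} → x ∈ Y → x ∉ Z
    YZ x∈ p with ∈-blocks ws t′ p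
    ... | inj₁ q = dis (there q) (∈-drop a₁ (∈-take b x∈))
    ... | inj₂ q = splitY x∈ q
    XYZ : ∀ {x} → x ∈ X → x ∉ Y ++ Z
    XYZ x∈ p with ∈-++⁻ Y p
    ... | inj₁ q = splitX x∈ (∈-take b q)
    ... | inj₂ q with ∈-blocks ws t′ q
    ... | inj₁ s = dis (there s) (∈-take a₁ x∈)
    ... | inj₂ s = splitX x∈ (∈-drop b s)
    fresh : w ∉ X ++ Y ++ Z
    fresh p with ∈-++⁻ X p
    ... | inj₁ q = dis (here refl) (∈-take a₁ q)
    ... | inj₂ q with ∈-++⁻ Y q
    ... | inj₁ s = dis (here refl) (∈-drop a₁ (∈-take b s))
    ... | inj₂ s with ∈-blocks ws t′ s
    ... | inj₁ z = All.lookup w∉ z refl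
    ... | inj₂ z = dis (here refl) (∈-drop a₁ (∈-drop b z))

  module _ {n : ℕ} (H : List (Subset n)) (L : List (Fin n)) where

    Windows : List (Fin n) → Set
    Windows t = ∀ i → i + d ≤ length t → Good H L (take d (drop i t))

    -- The window at 0 gives the edge inside a round, the window at a-1 the edge to the next round.
    -- The edge from `P` to the first block is no window of `t` and is supplied from outside.
    links : ∀ ws t P → (∀ {w} → w ∈ ws → w ∈ L) → length t ≡ length ws * d → Windows t →
      (∀ {w ws′} → ws ≡ w ∷ ws′ → edge (P ++ w ∷ take a₁ t) ∈ H) → Linked (Joined H) (P ∷ blocks ws t)
    links [] t P _ _ _ _ = [-]
    links (w ∷ ws) t P ws⊆ lt win first = first refl ∷ second ∷ links ws t′ Y (ws⊆ ∘ there) l₃ win′ third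
      where
      Y = take b (drop a₁ t)
      t′ = drop b (drop a₁ t)
      l₃ = proj₂ (proj₂ (lengths {t = t} (length ws * d) lt))
      second : edge ((w ∷ take a₁ t) ++ Y) ∈ H
      second = subst (λ z → edge (w ∷ z) ∈ H) (sym (trans (take-+ a₁ b t) (cong (λ z → take z t) (+-comm a₁ b))))
        (proj₂ (All.lookup (proj₂ (win 0 (≤-trans (m≤m+n d (length ws * d)) (≤-reflexive (sym lt))))) (ws⊆ (here refl))))
      win′ : Windows t′
      win′ i le = subst (λ z → Good H L (take d z)) (sym (trans (drop-drop b i (drop a₁ t)) (drop-drop a₁ (b + i) t)))
        (win (a₁ + (b + i)) (≤-trans (≤-reflexive shape) (≤-trans (+-monoʳ-≤ d (≤-trans le (≤-reflexive l₃))) (≤-reflexive (sym lt)))))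
        where
        shape : a₁ + (b + i) + d ≡ d + (i + d)
        shape = trans (cong (_+ d) (trans (sym (+-assoc a₁ b i)) (cong (_+ i) (+-comm a₁ b)))) (+-assoc d i d)
      third : ∀ {w′ ws′} → ws ≡ w′ ∷ ws′ → edge (Y ++ w′ ∷ take a₁ t′) ∈ H
      third {w′} {ws′} eq = subst (_∈ H) (trans (cong (λ z → edge (w′ ∷ z)) (sym (take-+ b a₁ (drop a₁ t)))) (edge-shift w′ Y (take a₁ t′)))
        (proj₂ (All.lookup (proj₂ (win a₁ bound)) (ws⊆ (there (subst (w′ ∈_) (sym eq) (here refl))))))
        where
        1≤ : 1 ≤ length ws
        1≤ = subst (λ z → 1 ≤ length z) (sym eq) (s≤s z≤n)
        bound : a₁ + d ≤ length t
        bound = ≤-trans (+-mono-≤ (m≤n+m a₁ b) (≤-trans (≤-reflexive (sym (+-identityʳ d))) (*-monoˡ-≤ d 1≤))) (≤-reflexive (sym lt))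

  -- For the tuples that cannot continue a path: repeated entries, entries among the r+c vertices of
  -- the given edge and `L`, and a bad window at one of at most m+1 places.
  pathBound : ℕ → ℕ
  pathBound K = m * m + (m * (r + c) + suc m * K)

  module _ {n : ℕ} (H : List (Subset n)) (rg : IsRGraph (a + b) n H) (noOdd : ∀ bs → ¬ BlockPath H a b (2 * k ∸ 1) bs)
    (w₁ : Fin n) (L′ : List (Fin n)) (uL : Unique (w₁ ∷ L′)) (lL : length L′ ≡ c₁)
    (maximal : length (star (a + b) (w₁ ∷ L′)) ≤ length H)
    (K : ℕ) (mostGood : Tuples.cnt n d (¬? ∘ good? H (w₁ ∷ L′)) ≤ K * n ^ (d ∸ 1))
    (large₁ : 2 * pathBound K ≤ n) (large₂ : 2 * (r ^ d * M) * (2 * K) < n)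
    (chE : Charge (a + b) M (filter (¬? ∘ meetsˢ? (w₁ ∷ L′)) H)) where

    open Tuples n
    open Thin n

    L : List (Fin n)
    L = w₁ ∷ L′

    E Ψ Miss : List (Subset n)
    E = filter (¬? ∘ meetsˢ? L) H
    Ψ = star (a + b) L
    Miss = filter (λ e → ¬? (e ∈H? H)) Ψ

    0<n : 0 < n
    0<n = ≤-trans (s≤s z≤n) large₂

    instance
      n≢0 : NonZero n
      n≢0 = >-nonZero 0<n

    -- This is the only place where maximality enters: `H` must make up off the star for whatever it
    -- lacks of the star.
    Miss≤E : length Miss ≤ length E
    Miss≤E = +-cancelˡ-≤ (count (λ e → e ∈H? H) Ψ) _ _ (begin
      count (λ e → e ∈H? H) Ψ + length Miss ≡⟨ count-¬ (λ e → e ∈H? H) Ψ ⟩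
      length Ψ                              ≤⟨ maximal ⟩
      length H                              ≡⟨ sym (count-¬ (meetsˢ? L) H) ⟩
      count (meetsˢ? L) H + length E        ≤⟨ +-monoˡ-≤ (length E) (unique-⊆-length (Uniqueₚ.filter⁺ (meetsˢ? L) (proj₁ rg)) sub) ⟩
      count (λ e → e ∈H? H) Ψ + length E    ∎)
      where
      open ≤-Reasoning
      sub : ∀ {e} → e ∈ filter (meetsˢ? L) H → e ∈ filter (λ e → e ∈H? H) Ψ
      sub {e} e∈ = let (e∈H , mt) = ∈-filter⁻ (meetsˢ? L) {xs = H} e∈ in
        ∈-filter⁺ (λ e → e ∈H? H) (∈-filter⁺ (meetsˢ? L) (subst (λ z → e ∈ allSub n z) (All.lookup (proj₂ rg) e∈H) (∈-allSub e)) mt) e∈H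

    inB : Tup → Set
    inB t = Unique t × Any (λ e → All (_∈ˢ e) t) E

    inB? : Decidable inB
    inB? t = unique? t ×-dec any? (λ e → all? (_∈ˢ? e) t) E

    missing : Tup → Set
    missing y = Unique (w₁ ∷ y) × edge (w₁ ∷ y) ∉ H

    missing? : Decidable missing
    missing? y = unique? (w₁ ∷ y) ×-dec ¬? (edge (w₁ ∷ y) ∈H? H)

    -- The final comparison is carried out in this quantity: both the missing star edges and the
    -- edges off the star are estimated through it.
    β : ℕ
    β = cnt b inB?

    module Deficient (B : Tup) (lB : length B ≡ b) (uB : Unique B) (e : Subset n) (e∈E : e ∈ E) (B⊆e : All (_∈ˢ e) B) where

      e∈H = proj₁ (∈-filter⁻ (¬? ∘ meetsˢ? L) {xs = H} e∈E)
      ¬meets = proj₂ (∈-filter⁻ (¬? ∘ meetsˢ? L) {xs = H} e∈E)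

      A₀ : Tup
      A₀ = filter (λ x → ¬? (x ∈F? B)) (elements e)

      to : ∀ {x} → x ∈ A₀ ++ B → x ∈ elements e
      to p with ∈-++⁻ A₀ p
      ... | inj₁ q = proj₁ (∈-filter⁻ (λ x → ¬? (x ∈F? B)) q)
      ... | inj₂ q = ∈-elements⁺ (All.lookup B⊆e q)

      from : ∀ {x} → x ∈ elements e → x ∈ A₀ ++ B
      from {x} p with x ∈F? B
      ... | yes q = ∈-++⁺ʳ A₀ q
      ... | no q = ∈-++⁺ˡ (∈-filter⁺ (λ x → ¬? (x ∈F? B)) p q)

      uAB : Unique (A₀ ++ B)
      uAB = unique-++⁺ (Uniqueₚ.filter⁺ (λ x → ¬? (x ∈F? B)) (unique-elements e)) uB
        (λ p → proj₂ (∈-filter⁻ (λ x → ¬? (x ∈F? B)) {xs = elements e} p))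

      AB≡e : edge (A₀ ++ B) ≡ e
      AB≡e = trans (edge-cong (A₀ ++ B) (elements e) to from) (edge-elements e)

      lA₀ : length A₀ ≡ a
      lA₀ = +-cancelʳ-≡ b (length A₀) a (begin
        length A₀ + b        ≡⟨ cong (length A₀ +_) (sym lB) ⟩
        length A₀ + length B ≡⟨ sym (length-++ A₀) ⟩
        length (A₀ ++ B)     ≡⟨ sym (∣edge∣ uAB) ⟩
        ∣ edge (A₀ ++ B) ∣   ≡⟨ cong ∣_∣ AB≡e ⟩
        ∣ e ∣                ≡⟨ All.lookup (proj₂ rg) e∈H ⟩
        a + b                ∎)
        where open ≡-Reasoning

      V : Tup
      V = elements e ++ L

      lV : length V ≡ r + c
      lV = trans (length-++ (elements e)) (cong₂ _+_ (trans (length-elements e) (trans (All.lookup (proj₂ rg) e∈H) a+b≡r)) (cong suc lL))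

      ¬good? : Decidable (¬_ ∘ Good H L)
      ¬good? = ¬? ∘ good? H L

      badWindow? : Decidable (λ t → Any (λ i → i + d ≤ m × ¬ Good H L (take d (drop i t))) (upTo (suc m)))
      badWindow? t = any? (λ i → (i + d ≤? m) ×-dec ¬good? (take d (drop i t))) (upTo (suc m))

      rough? = λ t → ¬? (unique? t) ⊎-dec (meets? V t ⊎-dec badWindow? t)

      bad? = λ t → rough? t ⊎-dec missing? (B ++ take a₁ t)

      windows-bound : cnt m badWindow? ≤ suc m * K * n ^ (m ∸ 1)
      windows-bound = begin
        cnt m badWindow?
          ≤⟨ count-Any (λ i t → (i + d ≤? m) ×-dec ¬good? (take d (drop i t))) (upTo (suc m)) (tuples m) ⟩
        ∑ (upTo (suc m)) (λ i → cnt m (λ t → (i + d ≤? m) ×-dec ¬good? (take d (drop i t))))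
          ≤⟨ ∑-mono (upTo (suc m)) (λ {i} _ → each i) ⟩
        ∑ (upTo (suc m)) (λ _ → K * n ^ (m ∸ 1))
          ≡⟨ trans (∑-const (upTo (suc m)) (K * n ^ (m ∸ 1))) (cong (_* (K * n ^ (m ∸ 1))) (length-upTo (suc m))) ⟩
        suc m * (K * n ^ (m ∸ 1))
          ≡⟨ sym (*-assoc (suc m) K _) ⟩
        suc m * K * n ^ (m ∸ 1) ∎
        where
        open ≤-Reasoning
        each : ∀ i → cnt m (λ t → (i + d ≤? m) ×-dec ¬good? (take d (drop i t))) ≤ K * n ^ (m ∸ 1)
        each i = byCase (i + d ≤? m)
          where
          byCase : Dec (i + d ≤ m) → cnt m (λ t → (i + d ≤? m) ×-dec ¬good? (take d (drop i t))) ≤ K * n ^ (m ∸ 1)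
          byCase (yes le) = ≤-trans (count-mono _ (λ t → ¬good? (take d (drop i t))) (tuples m) (λ _ → proj₂)) (thin-window ¬good? d m i K (s≤s z≤n) le mostGood)
          byCase (no gt) = ≤-trans (≤-reflexive (count-none _ (tuples m) (λ _ p → gt (proj₁ p)))) z≤n

      rough-bound : cnt m rough? ≤ pathBound K * n ^ (m ∸ 1)
      rough-bound = ≤-trans (count-⊎ rough? (¬? ∘ unique?) rest? (tuples m) (λ _ p → p)) (+-thin (m * m) _ (n ^ (m ∸ 1)) (cnt-¬unique (m ∸ 1))
        (≤-trans (count-⊎ rest? (meets? V) badWindow? (tuples m) (λ _ p → p)) (+-thin (m * (r + c)) _ (n ^ (m ∸ 1))
          (subst (λ z → cnt m (meets? V) ≤ m * z * n ^ (m ∸ 1)) lV (cnt-meets V (m ∸ 1))) windows-bound)))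
        where
        rest? = λ t → meets? V t ⊎-dec badWindow? t

      -- The path consists of `A₀`, `B` and the blocks of `L` and `t`, 2 + 2c = 2k blocks. Its first
      -- edge is `e`; the second, B with `w₁` and the start of `t`, is present because it is not
      -- missing; good windows give the others.
      path : ∀ t → length t ≡ m → ¬ (((¬ Unique t) ⊎ (Any (_∈ V) t ⊎ Any (λ i → i + d ≤ m × ¬ Good H L (take d (drop i t))) (upTo (suc m)))) ⊎ missing (B ++ take a₁ t)) → ⊥
      path t lt nb = noOdd (A₀ ∷ B ∷ blocks L t) (blockPath (lA₀ ∷ lB ∷ blocks-alt L t lt′)
          (trans (cong (suc ∘ suc) (blocks-length L t)) (trans (cong (λ z → suc (suc (2 * z))) (cong suc lL)) (cong suc (sym (+-suc c (c + 0))))))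
          (subst (_∈ H) (sym AB≡e) e∈H ∷ links H L L t B id lt′ win (λ { refl → first }))
          (subst Unique (++-assoc A₀ B _) (unique-++⁺ uAB (blocks-unique L t uL ut (λ p q → t∌V q (∈-++⁺ʳ (elements e) p))) apart)))
        where
        lt′ : length t ≡ length L * d
        lt′ = trans lt (cong (λ z → suc z * d) (sym lL))
        ut : Unique t
        ut = decidable-stable (unique? t) (λ ¬u → nb (inj₁ (inj₁ ¬u)))
        t∌V : ∀ {x} → x ∈ t → x ∉ V
        t∌V p q = nb (inj₁ (inj₂ (inj₁ (lose p q))))
        win : Windows H L t
        win i le = decidable-stable (good? H L (take d (drop i t))) (λ ng → nb (inj₁ (inj₂ (inj₂ (lose (∈-upTo⁺ (s≤s (≤-trans (m≤m+n i d) le′))) (le′ , ng))))))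
          where
          le′ : i + d ≤ m
          le′ = ≤-trans le (≤-reflexive lt)
        L∌e : ∀ {x} → x ∈ L → x ∉ elements e
        L∌e p q = ¬meets (lose p (∈-elements⁻ q))
        -- only w₁ is known to complete B
        uw₁ : Unique (w₁ ∷ B ++ take a₁ t)
        uw₁ = unique-∷⁺ (λ p → [ (λ q → L∌e (here refl) (to (∈-++⁺ʳ A₀ q))) , (λ q → t∌V (∈-take a₁ q) (∈-++⁺ʳ (elements e) (here refl))) ]′ (∈-++⁻ B p))
          (unique-++⁺ uB (Uniqueₚ.take⁺ a₁ ut) (λ p q → t∌V (∈-take a₁ q) (∈-++⁺ˡ (to (∈-++⁺ʳ A₀ p)))))
        first′ : edge (w₁ ∷ B ++ take a₁ t) ∈ H
        first′ = decidable-stable (_ ∈H? H) (λ e∉ → nb (inj₂ (uw₁ , e∉)))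
        first : edge (B ++ w₁ ∷ take a₁ t) ∈ H
        first = subst (_∈ H) (edge-shift w₁ B (take a₁ t)) first′
        apart : ∀ {x} → x ∈ A₀ ++ B → x ∉ concat (blocks L t)
        apart p q with ∈-blocks L t q
        ... | inj₁ s = L∌e s (to p)
        ... | inj₂ s = t∌V s (∈-++⁺ˡ (to p))

      -- Rough tuples fill at most half of all m-tuples, by `large₁`. If fewer than half of the
      -- continuations of `B` were missing, a tuple would remain that `path` excludes.
      deficient : n ^ a₁ ≤ 2 * cnt a₁ (λ A′ → missing? (B ++ A′))
      deficient = ≮⇒≥ (λ lt → let (t , lt′ , nb) = cnt-∃¬ bad? m (few lt) in path t lt′ nb)
        where
        few : 2 * cnt a₁ (λ A′ → missing? (B ++ A′)) < n ^ a₁ → cnt m bad? < n ^ m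
        few lt = *-cancelˡ-< 2 _ _ (begin-strict
          2 * cnt m bad?
            ≤⟨ *-monoʳ-≤ 2 (count-⊎ bad? rough? (λ t → missing? (B ++ take a₁ t)) (tuples m) (λ _ p → p)) ⟩
          2 * (cnt m rough? + cnt m (λ t → missing? (B ++ take a₁ t)))
            ≡⟨ *-distribˡ-+ 2 (cnt m rough?) _ ⟩
          2 * cnt m rough? + 2 * cnt m (λ t → missing? (B ++ take a₁ t))
            <⟨ +-mono-≤-< rough≤ miss< ⟩
          n ^ m + n ^ m
            ≡⟨ cong (n ^ m +_) (sym (+-identityʳ (n ^ m))) ⟩
          2 * n ^ m ∎)
          where
          open ≤-Reasoning
          rough≤ : 2 * cnt m rough? ≤ n ^ m
          rough≤ = begin
            2 * cnt m rough?                     ≤⟨ *-monoʳ-≤ 2 rough-bound ⟩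
            2 * (pathBound K * n ^ (m ∸ 1))      ≡⟨ sym (*-assoc 2 (pathBound K) _) ⟩
            2 * pathBound K * n ^ (m ∸ 1)        ≤⟨ *-monoˡ-≤ (n ^ (m ∸ 1)) large₁ ⟩
            n * n ^ (m ∸ 1)                      ≡⟨ ^-pred n {m} (s≤s z≤n) ⟩
            n ^ m                                ∎
          miss≡ : cnt m (λ t → missing? (B ++ take a₁ t)) ≡ cnt a₁ (λ A′ → missing? (B ++ A′)) * n ^ (m ∸ a₁)
          miss≡ = trans (cong (λ z → cnt z (λ t → missing? (B ++ take a₁ t))) (sym (m+[n∸m]≡n a₁≤m))) (cnt-take (λ A′ → missing? (B ++ A′)) a₁ (m ∸ a₁))
          miss< : 2 * cnt m (λ t → missing? (B ++ take a₁ t)) < n ^ m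
          miss< = begin-strict
            2 * cnt m (λ t → missing? (B ++ take a₁ t))                  ≡⟨ cong (2 *_) miss≡ ⟩
            2 * (cnt a₁ (λ A′ → missing? (B ++ A′)) * n ^ (m ∸ a₁))      ≡⟨ sym (*-assoc 2 (cnt a₁ (λ A′ → missing? (B ++ A′))) _) ⟩
            2 * cnt a₁ (λ A′ → missing? (B ++ A′)) * n ^ (m ∸ a₁)        <⟨ *-monoˡ-< (n ^ (m ∸ a₁)) {{m^n≢0 n (m ∸ a₁)}} lt ⟩
            n ^ a₁ * n ^ (m ∸ a₁)                                        ≡⟨ sym (^-distribˡ-+-* n a₁ (m ∸ a₁)) ⟩
            n ^ (a₁ + (m ∸ a₁))                                          ≡⟨ cong (n ^_) (m+[n∸m]≡n a₁≤m) ⟩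
            n ^ m                                                        ∎

    Y? : Decidable (λ y → inB (take b y) × missing y)
    Y? y = inB? (take b y) ×-dec missing? y

    -- Missing star edges through `w₁`, counted with an order that starts with a b-tuple from an
    -- edge off the star. Three estimates are compared: `deficient` from below, and from above both
    -- stability and the number of missing edges.
    Y : ℕ
    Y = cnt d Y?

    Y-lower : β * n ^ a₁ ≤ 2 * Y
    Y-lower = begin
      β * n ^ a₁                                        ≡⟨ cong (_* n ^ a₁) (count≡∑ inB? (tuples b)) ⟩
      ∑ (tuples b) (𝟙 ∘ inB?) * n ^ a₁                  ≡⟨ sym (∑-*ʳ (tuples b) (𝟙 ∘ inB?) (n ^ a₁)) ⟩
      ∑ (tuples b) (λ B → 𝟙 (inB? B) * n ^ a₁)          ≤⟨ ∑-mono (tuples b) (λ {B} B∈ → fibre B (tuples-length b B∈)) ⟩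
      ∑ (tuples b) (λ B → cnt a₁ (λ A′ → Y? (B ++ A′)) * 2) ≡⟨ ∑-*ʳ (tuples b) _ 2 ⟩
      ∑ (tuples b) (λ B → cnt a₁ (λ A′ → Y? (B ++ A′))) * 2 ≡⟨ cong (_* 2) (sym (cnt-++ Y? b a₁)) ⟩
      Y * 2                                             ≡⟨ *-comm Y 2 ⟩
      2 * Y                                             ∎
      where
      open ≤-Reasoning
      fibre : ∀ B → length B ≡ b → 𝟙 (inB? B) * n ^ a₁ ≤ cnt a₁ (λ A′ → Y? (B ++ A′)) * 2
      fibre B lB = byCase (inB? B)
        where
        byCase : (h : Dec (inB B)) → 𝟙 h * n ^ a₁ ≤ cnt a₁ (λ A′ → Y? (B ++ A′)) * 2
        byCase (no _) = z≤n
        byCase (yes h@(uB , any)) = let (e , e∈ , B⊆) = find any in begin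
          n ^ a₁ + 0                               ≡⟨ +-identityʳ _ ⟩
          n ^ a₁                                   ≤⟨ Deficient.deficient B lB uB e e∈ B⊆ ⟩
          2 * cnt a₁ (λ A′ → missing? (B ++ A′))   ≤⟨ *-monoʳ-≤ 2 (count-mono (λ A′ → missing? (B ++ A′)) (λ A′ → Y? (B ++ A′)) (tuples a₁)
                                                       (λ _ p → subst inB (sym (take-++-≡ b B lB)) h , p)) ⟩
          2 * cnt a₁ (λ A′ → Y? (B ++ A′))         ≡⟨ *-comm 2 (cnt a₁ (λ A′ → Y? (B ++ A′))) ⟩
          cnt a₁ (λ A′ → Y? (B ++ A′)) * 2         ∎

    Y-upper₁ : Y ≤ K * n ^ (d ∸ 1)
    Y-upper₁ = ≤-trans (count-mono Y? (¬? ∘ good? H L) (tuples d) (λ { _ (_ , _ , e∉) (_ , h ∷ _) → e∉ (proj₂ h) })) mostGood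

    Y-upper₂ : Y ≤ length Miss * r ^ d
    Y-upper₂ = cnt-edge Miss (λ S∈ → trans (allSub-size n (a + b) (proj₁ (∈-filter⁻ (meetsˢ? L) {xs = allSub n (a + b)} (proj₁ (∈-filter⁻ (λ e → ¬? (e ∈H? H)) {xs = Ψ} S∈))))) a+b≡r) d Y?
      (λ {t} t∈ (_ , u , e∉) → edge (w₁ ∷ t) ,
        ∈-filter⁺ (λ e → ¬? (e ∈H? H)) (∈-filter⁺ (meetsˢ? L) (subst (λ z → edge (w₁ ∷ t) ∈ allSub n z) (trans (∣edge∣ u) (trans (cong suc (tuples-length d t∈)) (sym a+b≡r))) (∈-allSub (edge (w₁ ∷ t)))) (here (∈-edge⁺ {xs = w₁ ∷ t} (here refl)))) e∉ ,
        λ x∈ → ∈-edge⁺ (there x∈))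

    two? : Decidable (λ y → inB (take b y) × inB (take b (drop b y)))
    two? y = inB? (take b y) ×-dec inB? (take b (drop b y))

    two-count : cnt d two? ≡ β * (β * n ^ j)
    two-count = trans (cong (λ z → cnt (b + z) two?) (sym a₁≡)) (trans (cnt-× inB? (inB? ∘ take b) b (b + j)) (cong (β *_) (cnt-take inB? b j)))

    open Charge chE

    -- A facet with a colour lies in an edge of `E`. Its first `b` and its next `b` vertices are
    -- both counted by `β`, and the other `j` are free; each facet carries at most `M` edges. The
    -- square of `β` is what makes the bound strong.
    E≤ : length E ≤ β * (β * n ^ j) * M
    E≤ = begin
      length E                                                 ≤⟨ subst (λ z → length E ≤ ∑ (allSub n z) (length ∘ W)) (cong (_∸ 1) a+b≡r) total ⟩
      ∑ (allSub n d) (length ∘ W)                              ≤⟨ ∑-mono (allSub n d) (λ {S} _ → pointwise S) ⟩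
      ∑ (allSub n d) (λ S → 𝟙 (used? S) * M)                   ≡⟨ ∑-*ʳ (allSub n d) (𝟙 ∘ used?) M ⟩
      ∑ (allSub n d) (𝟙 ∘ used?) * M                           ≡⟨ cong (_* M) (sym (count≡∑ used? (allSub n d))) ⟩
      count used? (allSub n d) * M                             ≤⟨ *-monoˡ-≤ M (subst (_≤ cnt d two?) (length-map elements (filter used? (allSub n d))) (unique-⊆-length uq sub)) ⟩
      cnt d two? * M                                           ≡⟨ cong (_* M) two-count ⟩
      β * (β * n ^ j) * M                                      ∎
      where
      open ≤-Reasoning
      used? : Decidable (λ S → 1 ≤ length (W S))
      used? S = 1 ≤? length (W S)
      pointwise : ∀ S → length (W S) ≤ 𝟙 (used? S) * M
      pointwise S with used? S
      ... | yes _ = ≤-trans (W≤ S) (≤-reflexive (sym (+-identityʳ M)))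
      ... | no p = ≤-pred (≰⇒> p)
      uq : Unique (map elements (filter used? (allSub n d)))
      uq = Uniqueₚ.map⁺ elements-injective (Uniqueₚ.filter⁺ used? (unique-allSub n d))
      nonempty : ∀ (xs : Tup) → 1 ≤ length xs → ∃[ x ] (x ∈ xs)
      nonempty (x ∷ _) _ = x , here refl
      sub : ∀ {t} → t ∈ map elements (filter used? (allSub n d)) → t ∈ filter two? (tuples d)
      sub t∈ with ∈-map⁻ elements t∈
      ... | S , S∈ , refl = ∈-filter⁺ two? (∈-tuples (trans (length-elements S) (allSub-size n d (proj₁ (∈-filter⁻ used? S∈)))))
            (part (Uniqueₚ.take⁺ b (unique-elements S)) (∈-take b) , part (Uniqueₚ.take⁺ b (Uniqueₚ.drop⁺ b (unique-elements S))) (∈-drop b ∘ ∈-take b))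
        where
        x = nonempty (W S) (proj₂ (∈-filter⁻ used? {xs = allSub n d} S∈))
        part : ∀ {t} → Unique t → (∀ {y} → y ∈ t → y ∈ elements S) → inB t
        part u f = u , lose (proj₂ (W⇒edge (proj₂ x))) (All.tabulate (λ y∈ → x∈p∪q⁺ (inj₂ (∈-elements⁻ (f y∈)))))

    b₁+ : n ^ (d ∸ 1) ≡ n ^ b₁ * n ^ a₁
    b₁+ = ^-distribˡ-+-* n b₁ a₁

    β≤ : β ≤ 2 * K * n ^ b₁
    β≤ = *-cancelʳ-≤ β (2 * K * n ^ b₁) (n ^ a₁) {{m^n≢0 n a₁}} (begin
      β * n ^ a₁                   ≤⟨ Y-lower ⟩
      2 * Y                        ≤⟨ *-monoʳ-≤ 2 Y-upper₁ ⟩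
      2 * (K * n ^ (d ∸ 1))        ≡⟨ cong (λ z → 2 * (K * z)) b₁+ ⟩
      2 * (K * (n ^ b₁ * n ^ a₁))  ≡⟨ sym (*-assoc 2 K _) ⟩
      2 * K * (n ^ b₁ * n ^ a₁)    ≡⟨ sym (*-assoc (2 * K) (n ^ b₁) (n ^ a₁)) ⟩
      2 * K * n ^ b₁ * n ^ a₁      ∎)
      where open ≤-Reasoning

    -- Otherwise β n^(a-1) ≤ 2Y ≤ 2 r^d M β² n^j, and cancelling gives n^b ≤ 2Qβ. With β ≤ 2K
    -- n^(b-1) this bounds n, against `large₂`.
    β≡0 : β ≡ 0
    β≡0 = go β refl
      where
      go : ∀ x → β ≡ x → x ≡ 0
      go zero _ = refl
      go (suc x) eq = contradiction n≤ (<⇒≱ large₂)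
        where
        open ≤-Reasoning
        instance
          β≢0 : NonZero β
          β≢0 = subst NonZero (sym eq) nonZero
        Q = r ^ d * M
        n^b≤ : n ^ b ≤ 2 * Q * β
        n^b≤ = *-cancelʳ-≤ (n ^ b) (2 * Q * β) (n ^ j) {{m^n≢0 n j}} (*-cancelˡ-≤ β (begin
          β * (n ^ b * n ^ j)                  ≡⟨ cong (β *_) (trans (sym (^-distribˡ-+-* n b j)) (cong (n ^_) a₁≡)) ⟩
          β * n ^ a₁                           ≤⟨ Y-lower ⟩
          2 * Y                                ≤⟨ *-monoʳ-≤ 2 (≤-trans Y-upper₂ (*-monoˡ-≤ (r ^ d) (≤-trans Miss≤E E≤))) ⟩
          2 * (β * (β * n ^ j) * M * r ^ d)    ≡⟨ cong (2 *_) (trans (*-assoc (β * (β * n ^ j)) M (r ^ d)) (cong (β * (β * n ^ j) *_) (*-comm M (r ^ d)))) ⟩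
          2 * (β * (β * n ^ j) * Q)            ≡⟨ cong (2 *_) (trans (*-assoc β (β * n ^ j) Q) (cong (β *_) (trans (*-comm (β * n ^ j) Q) (sym (*-assoc Q β (n ^ j)))))) ⟩
          2 * (β * (Q * β * n ^ j))            ≡⟨ trans (sym (*-assoc 2 β _)) (trans (cong (_* (Q * β * n ^ j)) (*-comm 2 β)) (*-assoc β 2 _)) ⟩
          β * (2 * (Q * β * n ^ j))            ≡⟨ cong (β *_) (trans (sym (*-assoc 2 (Q * β) (n ^ j))) (cong (_* n ^ j) (sym (*-assoc 2 Q β)))) ⟩
          β * (2 * Q * β * n ^ j)              ∎))
        n≤ : n ≤ 2 * Q * (2 * K)
        n≤ = *-cancelʳ-≤ n (2 * Q * (2 * K)) (n ^ b₁) {{m^n≢0 n b₁}} (begin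
          n ^ b                           ≤⟨ n^b≤ ⟩
          2 * Q * β                       ≤⟨ *-monoʳ-≤ (2 * Q) β≤ ⟩
          2 * Q * (2 * K * n ^ b₁)        ≡⟨ sym (*-assoc (2 * Q) (2 * K) (n ^ b₁)) ⟩
          2 * Q * (2 * K) * n ^ b₁        ∎)

    E-empty : ∀ {e} → e ∉ E
    E-empty {e} e∈ = <⇒≱ (unique-⊆-length {xs = take b (elements e) ∷ []} ([] ∷ []) sub) (≤-reflexive β≡0)
      where
      lb : length (take b (elements e)) ≡ b
      lb = trans (length-take b (elements e)) (m≤n⇒m⊓n≡m (≤-trans (m≤n+m b a)
        (≤-reflexive (sym (trans (length-elements e) (All.lookup (proj₂ rg) (proj₁ (∈-filter⁻ (¬? ∘ meetsˢ? L) {xs = H} e∈))))))))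
      sub : ∀ {t} → t ∈ take b (elements e) ∷ [] → t ∈ filter inB? (tuples b)
      sub (here refl) = ∈-filter⁺ inB? (∈-tuples lb) (Uniqueₚ.take⁺ b (unique-elements e) , lose e∈ (All.tabulate (λ x∈ → ∈-elements⁻ (∈-take b x∈))))

    exact : ∀ e → (e ∈ H → ∣ e ∣ ≡ a + b × Any (_∈ˢ e) L) × (∣ e ∣ ≡ a + b × Any (_∈ˢ e) L → e ∈ H)
    exact e = to , from
      where
      to : e ∈ H → ∣ e ∣ ≡ a + b × Any (_∈ˢ e) L
      to e∈ = All.lookup (proj₂ rg) e∈ , decidable-stable (meetsˢ? L e) (λ nm → E-empty (∈-filter⁺ (¬? ∘ meetsˢ? L) e∈ nm))
      from : ∣ e ∣ ≡ a + b × Any (_∈ˢ e) L → e ∈ H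
      from (size , mt) = decidable-stable (e ∈H? H) (λ e∉ → noMiss (∈-filter⁺ (λ e → ¬? (e ∈H? H)) (∈-filter⁺ (meetsˢ? L) (subst (λ z → e ∈ allSub n z) size (∈-allSub e)) mt) e∉))
        where
        noE : length E ≡ 0
        noE = none E E-empty
          where
          none : ∀ {X : Set} (xs : List X) → (∀ {x} → x ∉ xs) → length xs ≡ 0
          none [] _ = refl
          none (x ∷ xs) h = contradiction (here refl) h
        noMiss : e ∉ Miss
        noMiss p = <⇒≱ (unique-⊆-length {xs = e ∷ []} {ys = Miss} ([] ∷ []) (λ { (here refl) → p })) (≤-trans Miss≤E (≤-reflexive noE))

-- The lower bound

star-isRGraph : ∀ {n} r (V : List (Fin n)) → IsRGraph r n (star r V)
star-isRGraph {n} r V = Uniqueₚ.filter⁺ (meetsˢ? V) (unique-allSub n r) ,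
  All.tabulate (λ e∈ → allSub-size n r (proj₁ (∈-filter⁻ (meetsˢ? V) {xs = allSub n r} e∈)))

star-free : ∀ {n} r a b k v Λ (V : List (Fin n)) → length V < k → (∀ {i} → i < k → 2 * i < Λ) → ¬ Contains (star r V) (v , pathEdges a b v Λ)
star-free {n} r a b k v Λ V lt bound = ¬contains-covered (star r V) V lt bound
  (λ e∈ → find (proj₂ (∈-filter⁻ (meetsˢ? V) {xs = allSub n r} e∈)))

-- Joining each vertex of `V` to each (d+1)-set disjoint from `V` gives distinct edges, since an
-- edge so obtained has only one vertex in `V`. The sets meeting `V` account for the error term.
length-star : ∀ {n} d (V : List (Fin n)) → Unique V →
  length V * (n C suc d) ≤ length (star (suc (suc d)) V) + length V * (suc d * length V) * n ^ d
length-star {n} d V uV = begin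
  c * (n C suc d)                              ≡⟨ cong (c *_) (trans (sym (length-allSub n (suc d))) (sym (count-¬ (meetsˢ? V) (allSub n (suc d))))) ⟩
  c * (count (meetsˢ? V) (allSub n (suc d)) + length D) ≡⟨ *-distribˡ-+ c _ (length D) ⟩
  c * count (meetsˢ? V) (allSub n (suc d)) + c * length D ≤⟨ +-mono-≤ (*-monoʳ-≤ c meeting) disjoint ⟩
  c * (suc d * c * n ^ d) + length (star (suc (suc d)) V) ≡⟨ trans (+-comm _ (length (star (suc (suc d)) V))) (cong (length (star (suc (suc d)) V) +_) (sym (*-assoc c (suc d * c) (n ^ d)))) ⟩
  length (star (suc (suc d)) V) + c * (suc d * c) * n ^ d ∎
  where
  open ≤-Reasoning
  open Tuples n
  c = length V
  D = filter (¬? ∘ meetsˢ? V) (allSub n (suc d))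
  D⁻ : ∀ {S} → S ∈ D → ∣ S ∣ ≡ suc d × ¬ Any (_∈ˢ S) V
  D⁻ S∈ = allSub-size n (suc d) (proj₁ (∈-filter⁻ (¬? ∘ meetsˢ? V) {xs = allSub n (suc d)} S∈)) , proj₂ (∈-filter⁻ (¬? ∘ meetsˢ? V) {xs = allSub n (suc d)} S∈)
  meeting : count (meetsˢ? V) (allSub n (suc d)) ≤ suc d * c * n ^ d
  meeting = ≤-trans (subst (_≤ cnt (suc d) (meets? V)) (length-map elements (filter (meetsˢ? V) (allSub n (suc d)))) (unique-⊆-length uq sub)) (cnt-meets V d)
    where
    uq : Unique (map elements (filter (meetsˢ? V) (allSub n (suc d))))
    uq = Uniqueₚ.map⁺ elements-injective (Uniqueₚ.filter⁺ (meetsˢ? V) (unique-allSub n (suc d)))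
    sub : ∀ {t} → t ∈ map elements (filter (meetsˢ? V) (allSub n (suc d))) → t ∈ filter (meets? V) (tuples (suc d))
    sub t∈ with ∈-map⁻ elements t∈
    ... | S , S∈ , refl = let (S∈′ , mt) = ∈-filter⁻ (meetsˢ? V) {xs = allSub n (suc d)} S∈ ; (x , x∈V , x∈S) = find mt in
      ∈-filter⁺ (meets? V) (∈-tuples (trans (length-elements S) (allSub-size n (suc d) S∈′))) (lose (∈-elements⁺ x∈S) x∈V)
  cones : List (Subset n)
  cones = concatMap (λ x → map (λ S → ⁅ x ⁆ ∪ S) D) V
  disjoint : c * length D ≤ length (star (suc (suc d)) V)
  disjoint = subst (_≤ length (star (suc (suc d)) V))
    (trans (length-concatMap (λ x → map (λ S → ⁅ x ⁆ ∪ S) D) V) (trans (∑-cong V (λ {x} _ → length-map (λ S → ⁅ x ⁆ ∪ S) D)) (∑-const V (length D))))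
    (unique-⊆-length uq sub)
    where
    ⊆-of : ∀ {x y S S′} → x ∈ V → S ∈ D → S′ ∈ D → y ∈ V → ⁅ x ⁆ ∪ S ≡ ⁅ y ⁆ ∪ S′ → ∀ {z} → z ∈ˢ S → z ∈ˢ S′
    ⊆-of {x} {y} {S} {S′} x∈ S∈ S′∈ y∈ eq {z} z∈ with x∈p∪q⁻ ⁅ y ⁆ S′ (subst (z ∈ˢ_) eq (x∈p∪q⁺ (inj₂ z∈)))
    ... | inj₂ q = q
    ... | inj₁ q = contradiction (lose y∈ (subst (_∈ˢ S) (x∈⁅y⁆⇒x≡y y q) z∈)) (proj₂ (D⁻ S∈))
    heads : ∀ {x y z} → x ∈ V → y ∈ V → z ∈ map (λ S → ⁅ x ⁆ ∪ S) D → z ∈ map (λ S → ⁅ y ⁆ ∪ S) D → x ≡ y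
    heads {x} {y} x∈ y∈ p q with ∈-map⁻ (λ S → ⁅ x ⁆ ∪ S) p | ∈-map⁻ (λ S → ⁅ y ⁆ ∪ S) q
    ... | S , S∈ , refl | S′ , S′∈ , eq with x∈p∪q⁻ ⁅ y ⁆ S′ (subst (x ∈ˢ_) eq (x∈p∪q⁺ (inj₁ (x∈⁅x⁆ x))))
    ... | inj₁ r = x∈⁅y⁆⇒x≡y y r
    ... | inj₂ r = contradiction (lose x∈ r) (proj₂ (D⁻ S′∈))
    uq : Unique cones
    uq = unique-concatMap (λ x → map (λ S → ⁅ x ⁆ ∪ S) D) V uV
      (λ {x} x∈ → uniqueMap x x∈)
      heads
      where
      uniqueMap : ∀ x → x ∈ V → Unique (map (λ S → ⁅ x ⁆ ∪ S) D)
      uniqueMap x x∈ = unique-on D id (Uniqueₚ.filter⁺ (¬? ∘ meetsˢ? V) (unique-allSub n (suc d)))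
        where
        unique-on : ∀ xs → (∀ {S} → S ∈ xs → S ∈ D) → Unique xs → Unique (map (λ S → ⁅ x ⁆ ∪ S) xs)
        unique-on [] _ _ = []
        unique-on (S ∷ xs) f (S∉ ∷ u) = unique-∷⁺ fresh (unique-on xs (f ∘ there) u)
          where
          fresh : ⁅ x ⁆ ∪ S ∉ map (λ S → ⁅ x ⁆ ∪ S) xs
          fresh p with ∈-map⁻ (λ S → ⁅ x ⁆ ∪ S) p
          ... | S′ , S′∈ , eq = All.lookup S∉ S′∈ (⊆ˢ-antisym (⊆-of x∈ (f (here refl)) (f (there S′∈)) x∈ eq) (⊆-of x∈ (f (there S′∈)) (f (here refl)) x∈ (sym eq)))
    sub : ∀ {e} → e ∈ cones → e ∈ star (suc (suc d)) V
    sub e∈ with ∈-concat⁻′ (map (λ x → map (λ S → ⁅ x ⁆ ∪ S) D) V) e∈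
    ... | es , e∈es , es∈ with ∈-map⁻ (λ x → map (λ S → ⁅ x ⁆ ∪ S) D) es∈
    ... | x , x∈ , refl with ∈-map⁻ (λ S → ⁅ x ⁆ ∪ S) e∈es
    ... | S , S∈ , refl = ∈-filter⁺ (meetsˢ? V)
      (subst (λ z → (⁅ x ⁆ ∪ S) ∈ allSub n z) (trans (∣⁅x⁆∪p∣ x S (λ x∈S → proj₂ (D⁻ S∈) (lose x∈ x∈S))) (cong suc (proj₁ (D⁻ S∈)))) (∈-allSub (⁅ x ⁆ ∪ S)))
      (lose x∈ (x∈p∪q⁺ (inj₁ (x∈⁅x⁆ x))))

-- Renaming vertices

module Relabel {n : ℕ} (L : List (Fin n)) (uL : Unique L) where

  others : List (Fin n)
  others = filter (λ x → ¬? (x ∈F? L)) (allFin n)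

  L+others : length L + length others ≤ n
  L+others = begin
    length L + length others                          ≤⟨ +-monoˡ-≤ (length others) (unique-⊆-length uL (λ {x} x∈ → ∈-filter⁺ (_∈F? L) (∈-allFin x) x∈)) ⟩
    count (_∈F? L) (allFin n) + length others         ≡⟨ count-¬ (_∈F? L) (allFin n) ⟩
    length (allFin n)                                 ≡⟨ length-tabulate id ⟩
    n                                                 ∎
    where open ≤-Reasoning

  -- `L` takes the first places and the other vertices follow, so `L` becomes the initial segment
  -- that defines Ψ.
  rank : ∀ {x} → Dec (x ∈ L) → ℕ
  rank (yes p) = proj₁ (∈⇒at p)
  rank {x} (no p) = length L + proj₁ (∈⇒at (∈-filter⁺ (λ x → ¬? (x ∈F? L)) (∈-allFin x) p))

  rank< : ∀ {x} (h : Dec (x ∈ L)) → rank h < n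
  rank< (yes p) = <-≤-trans (proj₁ (proj₂ (∈⇒at p))) (≤-trans (m≤m+n _ _) L+others)
  rank< {x} (no p) = <-≤-trans (+-monoʳ-< (length L) (proj₁ (proj₂ (∈⇒at (∈-filter⁺ (λ x → ¬? (x ∈F? L)) (∈-allFin x) p))))) L+others

  σ : Fin n → Fin n
  σ x = fromℕ< (rank< (x ∈F? L))

  toℕ-σ : ∀ x → toℕ (σ x) ≡ rank (x ∈F? L)
  toℕ-σ x = toℕ-fromℕ< (rank< (x ∈F? L))

  rank-yes : ∀ {x} (h : Dec (x ∈ L)) → x ∈ L → rank h < length L
  rank-yes (yes p) _ = proj₁ (proj₂ (∈⇒at p))
  rank-yes (no p) q = contradiction q p

  rank-no : ∀ {x} (h : Dec (x ∈ L)) → rank h < length L → x ∈ L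
  rank-no (yes p) _ = p
  rank-no (no p) lt = contradiction (m≤m+n (length L) _) (<⇒≱ lt)

  at-functional : ∀ {A : Set} {xs : List A} {i j x y} → at xs i ≡ just x → at xs j ≡ just y → i ≡ j → x ≡ y
  at-functional p q refl with trans (sym p) q
  ... | refl = refl

  rank-injective : ∀ {x y} (h : Dec (x ∈ L)) (h′ : Dec (y ∈ L)) → rank h ≡ rank h′ → x ≡ y
  rank-injective (yes p) (yes q) e = at-functional {xs = L} (proj₂ (proj₂ (∈⇒at p))) (proj₂ (proj₂ (∈⇒at q))) e
  rank-injective (yes p) (no q) e = contradiction (≤-trans (m≤m+n (length L) _) (≤-reflexive (sym e))) (<⇒≱ (proj₁ (proj₂ (∈⇒at p))))
  rank-injective (no p) (yes q) e = contradiction (≤-trans (m≤m+n (length L) _) (≤-reflexive e)) (<⇒≱ (proj₁ (proj₂ (∈⇒at q))))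
  rank-injective {x} {y} (no p) (no q) e = at-functional {xs = others}
    (proj₂ (proj₂ (∈⇒at (∈-filter⁺ (λ x → ¬? (x ∈F? L)) (∈-allFin x) p)))) (proj₂ (proj₂ (∈⇒at (∈-filter⁺ (λ x → ¬? (x ∈F? L)) (∈-allFin y) q)))) (+-cancelˡ-≡ (length L) _ _ e)

  σ-injective : ∀ {x y} → σ x ≡ σ y → x ≡ y
  σ-injective {x} {y} e = rank-injective (x ∈F? L) (y ∈F? L) (trans (sym (toℕ-σ x)) (trans (cong toℕ e) (toℕ-σ y)))

  ∣image∣ : ∀ (e : Subset n) → ∣ image σ e ∣ ≡ ∣ e ∣
  ∣image∣ e = begin
    ∣ image σ e ∣                 ≡⟨ cong ∣_∣ (⊆ˢ-antisym to from) ⟩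
    ∣ edge (map σ (elements e)) ∣ ≡⟨ ∣edge∣ (Uniqueₚ.map⁺ σ-injective (unique-elements e)) ⟩
    length (map σ (elements e))   ≡⟨ length-map σ (elements e) ⟩
    length (elements e)           ≡⟨ length-elements e ⟩
    ∣ e ∣                         ∎
    where
    open ≡-Reasoning
    to : image σ e ⊆ˢ edge (map σ (elements e))
    to p with ∈-image⁻ σ e p
    ... | i , q , refl = ∈-edge⁺ (∈-map⁺ σ (∈-elements⁺ (Vecₚ.lookup⇒[]= i e q)))
    from : edge (map σ (elements e)) ⊆ˢ image σ e
    from p with ∈-map⁻ σ (∈-edge⁻ (map σ (elements e)) p)
    ... | i , i∈ , refl = ∈-image⁺ σ e i (Vecₚ.[]=⇒lookup (∈-elements⁻ {S = e} i∈))

  isoPsi : ∀ {r} {H : List (Subset n)} → (∀ e → (e ∈ H → ∣ e ∣ ≡ r × Any (_∈ˢ e) L) × (∣ e ∣ ≡ r × Any (_∈ˢ e) L → e ∈ H)) → IsoPsi (length L) r n H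
  isoPsi {r} {H} h = σ , (λ {x} {y} → σ-injective) , λ e → mk⇔ (to e) (from e)
    where
    to : ∀ e → e ∈ H → InPsi (length L) r n (image σ e)
    to e e∈ = let (size , mt) = proj₁ (h e) e∈ ; (x , x∈L , x∈e) = find mt in
      trans (∣image∣ e) size , σ x , ∈-image⁺ σ e x (Vecₚ.[]=⇒lookup x∈e) , subst (_< length L) (sym (toℕ-σ x)) (rank-yes (x ∈F? L) x∈L)
    from : ∀ e → InPsi (length L) r n (image σ e) → e ∈ H
    from e (size , y , y∈ , lt) with ∈-image⁻ σ e y∈
    ... | x , q , refl = proj₂ (h e) (trans (sym (∣image∣ e)) size ,
      lose (rank-no (x ∈F? L) (subst (_< length L) (toℕ-σ x) lt)) (Vecₚ.lookup⇒[]= x e q))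

-- From the estimates to the three claims

2i<2k∸1 : ∀ {k i} → i < k → 2 * i < 2 * k ∸ 1
2i<2k∸1 {suc k} {i} (s≤s le) = ≤-trans (s≤s (*-monoʳ-≤ 2 le)) (≤-reflexive (sym (+-suc k (k + 0))))

2i<2k : ∀ {k i} → i < k → 2 * i < 2 * k
2i<2k lt = *-monoʳ-< 2 lt

initialSegment : ∀ {n} c → c ≤ n → ∃[ V ] (Unique {A = Fin n} V × length V ≡ c)
initialSegment {n} c le = take c (allFin n) , Uniqueₚ.take⁺ c (Uniqueₚ.allFin⁺ n) ,
  trans (length-take c (allFin n)) (trans (cong (c ⊓_) (length-tabulate id)) (m≤n⇒m⊓n≡m le))

∣-∣-bound : ∀ x y z → x ≤ y + z → y ≤ x + z → ∣ x - y ∣ ≤ z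
∣-∣-bound x y z p q with ≤-total x y
... | inj₁ le = ≤-trans (≤-reflexive (m≤n⇒∣m-n∣≡n∸m le)) (m≤n+o⇒m∸n≤o y x q)
... | inj₂ le = ≤-trans (≤-reflexive (trans (∣-∣-comm x y) (m≤n⇒∣m-n∣≡n∸m le))) (m≤n+o⇒m∸n≤o x y p)

-- Odd and even paths are treated alike: it suffices that graphs without `F` have no P_{2k}(α,β) and
-- that stars of c = k-1 vertices do not contain `F`. The error obtained is O(n^(r-2)).
asymptotics : ∀ α β c F → 1 ≤ β → β < α →
  (∀ {n} (H : List (Subset n)) → ¬ Contains H F → ∀ bs → ¬ BlockPath H α β (2 * suc c) bs) →
  (∀ {n} (V : List (Fin n)) → length V ≡ c → ¬ Contains (star (α + β) V) F) → ExAsymp (α + β) F (suc c)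
asymptotics α β c F 1≤β β<α noPath starFree m = N , bound
  where
  r₂ = α + β ∸ 2
  2≤r : 2 ≤ α + β
  2≤r = ≤-trans (≤-trans (s≤s 1≤β) β<α) (m≤m+n α β)
  r≡ : suc (suc r₂) ≡ α + β
  r≡ = m+[n∸m]≡n 2≤r
  ub = upper-bound α β (suc c) 1≤β β<α (s≤s z≤n)
  C₁ = proj₁ ub
  C₂ = c * (suc r₂ * c)
  -- This makes room for a star centre of `c` vertices, and n ≥ (m+1)(C₁+C₂) turns the error (C₁+C₂)
  -- n^(r-2) into at most n^(r-1)/(m+1).
  N = suc (c + suc m * (C₁ + C₂))
  bound : ∀ n → N ≤ n → ∀ (H : List (Subset n)) → Extremal (α + β) n F H → suc m * ∣ edges H - c * (n C (α + β ∸ 1)) ∣ ≤ n ^ (α + β ∸ 1)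
  bound n N≤n H (rg , free , max) = begin
    suc m * ∣ edges H - c * (n C (α + β ∸ 1)) ∣ ≤⟨ *-monoʳ-≤ (suc m) (∣-∣-bound (edges H) (c * (n C (α + β ∸ 1))) ((C₁ + C₂) * n ^ r₂)
        (≤-trans (proj₂ ub n H 1≤n rg (noPath H free)) (+-monoʳ-≤ (c * (n C (α + β ∸ 1))) (*-monoˡ-≤ (n ^ r₂) (m≤m+n C₁ C₂))))
        (≤-trans low (+-monoʳ-≤ (edges H) (*-monoˡ-≤ (n ^ r₂) (m≤n+m C₂ C₁))))) ⟩
    suc m * ((C₁ + C₂) * n ^ r₂)                ≡⟨ sym (*-assoc (suc m) (C₁ + C₂) (n ^ r₂)) ⟩
    suc m * (C₁ + C₂) * n ^ r₂                  ≤⟨ *-monoˡ-≤ (n ^ r₂) (≤-trans (m≤n+m (suc m * (C₁ + C₂)) (suc c)) N≤n) ⟩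
    n * n ^ r₂                                  ≡⟨ cong (λ z → n ^ (z ∸ 1)) r≡ ⟩
    n ^ (α + β ∸ 1)                             ∎
    where
    open ≤-Reasoning
    1≤n : 1 ≤ n
    1≤n = ≤-trans (s≤s z≤n) N≤n
    seg = initialSegment {n} c (≤-trans (≤-trans (m≤m+n c _) (n≤1+n _)) N≤n)
    V = proj₁ seg
    lV = proj₂ (proj₂ seg)
    low : c * (n C (α + β ∸ 1)) ≤ edges H + C₂ * n ^ r₂
    low = begin
      c * (n C (α + β ∸ 1)) ≡⟨ cong (λ z → c * (n C (z ∸ 1))) (sym r≡) ⟩
      c * (n C suc r₂)      ≤⟨ subst (λ z → z * (n C suc r₂) ≤ length (star (suc (suc r₂)) V) + z * (suc r₂ * z) * n ^ r₂) lV (length-star r₂ V (proj₁ (proj₂ seg))) ⟩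
      length (star (suc (suc r₂)) V) + C₂ * n ^ r₂ ≡⟨ cong (λ z → length (star z V) + C₂ * n ^ r₂) r≡ ⟩
      length (star (α + β) V) + C₂ * n ^ r₂ ≤⟨ +-monoˡ-≤ _ (max (star (α + β) V) (star-isRGraph (α + β) V) (starFree V lV)) ⟩
      edges H + C₂ * n ^ r₂ ∎

-- Extremality enters only through comparison with stars, once with an arbitrary one for the size of
-- `H` and once with the star of the set `L` found by stability.
uniqueness : ∀ α β c → 2 ≤ β → β < α → 1 ≤ c → ∃[ N ] (∀ n → N ≤ n → ∀ (H : List (Subset n)) → IsRGraph (α + β) n H →
  (∀ bs → ¬ BlockPath H α β (2 * suc c ∸ 1) bs) →
  (∀ (V : List (Fin n)) → length V ≡ c → length (star (α + β) V) ≤ length H) → IsoPsi c (α + β) n H)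
uniqueness (suc a₁) (suc (suc b″)) (suc c₁) (s≤s (s≤s _)) β<α _ = N , proof
  where
  α = suc a₁
  β = suc (suc b″)
  c = suc c₁
  k = suc c
  M = chargeBound α β k
  open Stability α b″ c β<α
  module X = Exact a₁ (suc b″) c₁ (≤-pred β<α)
  d = α + suc b″
  d≡ : d ≡ β + a₁
  d≡ = cong suc (trans (+-suc a₁ b″) (cong suc (+-comm a₁ b″)))
  -- The error constant of `length-star`, since `H` is at least as large as a star.
  C₂ = c * (d * c)
  K = goodBound C₂
  r = suc (β + a₁)
  large = 2 * (r ^ (β + a₁) * M) * (2 * K)
  -- The summands are the thresholds for a star to exist, for stability, for `deficient` and for
  -- `β≡0`.
  N = suc (c + (K + (2 * X.pathBound K + large)))
  proof : ∀ n → N ≤ n → ∀ (H : List (Subset n)) → IsRGraph (α + β) n H → (∀ bs → ¬ BlockPath H α β (2 * k ∸ 1) bs) →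
    (∀ (V : List (Fin n)) → length V ≡ c → length (star (α + β) V) ≤ length H) → IsoPsi c (α + β) n H
  proof n N≤n H rg noOdd max = finish (proj₁ stab) (proj₂ stab)
    where
    noPath : ∀ bs → ¬ BlockPath H α β (2 * k) bs
    noPath = noOdd⇒noEven c noOdd
    c≤n : c ≤ n
    c≤n = ≤-trans (≤-trans (m≤m+n c _) (n≤1+n _)) N≤n
    K<n : K < n
    K<n = ≤-trans (s≤s (≤-trans (m≤m+n K _) (m≤n+m _ c))) N≤n
    path≤n : 2 * X.pathBound K ≤ n
    path≤n = ≤-trans (≤-trans (≤-trans (m≤m+n _ large) (m≤n+m _ K)) (≤-trans (m≤n+m _ c) (n≤1+n _))) N≤n
    large<n : large < n
    large<n = ≤-trans (s≤s (≤-trans (≤-trans (m≤n+m large (2 * X.pathBound K)) (m≤n+m _ K)) (m≤n+m _ c))) N≤n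
    seg = initialSegment {n} c c≤n
    V = proj₁ seg
    lV = proj₂ (proj₂ seg)
    d′ = a₁ + suc b″
    low : c * (n C d) ≤ length H + C₂ * n ^ (d ∸ 1)
    low = ≤-trans (subst (λ z → z * (n C d) ≤ length (star (suc d) V) + z * (d * z) * n ^ d′) lV (length-star d′ V (proj₁ (proj₂ seg))))
      (+-monoˡ-≤ (C₂ * n ^ d′) (subst (λ z → length (star z V) ≤ length H) (+-suc α (suc b″)) (max V lV)))
    stab : ∃[ L ] (Unique L × length L ≡ c × Tuples.cnt n d (¬? ∘ good? H L) ≤ K * n ^ (d ∸ 1))
    stab = stability H rg noPath (charge α β k H (s≤s z≤n) noPath rg) C₂ low (fromℕ< (≤-trans (s≤s z≤n) N≤n)) K<n
    finish : ∀ L → Unique L × length L ≡ c × Tuples.cnt n d (¬? ∘ good? H L) ≤ K * n ^ (d ∸ 1) → IsoPsi c (α + β) n H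
    finish (w₁ ∷ L′) (uL , lL , good) = subst (λ z → IsoPsi z (α + β) n H) lL (Relabel.isoPsi (w₁ ∷ L′) uL
      (X.exact H rg noOdd w₁ L′ uL (suc-injective lL) (max (w₁ ∷ L′) lL) K
        (subst (λ z → Tuples.cnt n z (¬? ∘ good? H (w₁ ∷ L′)) ≤ K * n ^ (z ∸ 1)) d≡ good) path≤n large<n
        (charge α β k _ (s≤s z≤n) (λ bs p → noPath bs (blockPath-mono E⊆ p))
          (Uniqueₚ.filter⁺ (¬? ∘ meetsˢ? (w₁ ∷ L′)) (proj₁ rg) , All.tabulate (λ e∈ → All.lookup (proj₂ rg) (E⊆ e∈))))))
      where
      E⊆ : ∀ {e} → e ∈ filter (¬? ∘ meetsˢ? (w₁ ∷ L′)) H → e ∈ H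
      E⊆ e∈ = proj₁ (∈-filter⁻ (¬? ∘ meetsˢ? (w₁ ∷ L′)) e∈)

theorem1 : ∀ (a b k : ℕ) → 1 ≤ a → 1 ≤ b → 2 ≤ k →
    (((a + b) % 2 ≡ 1 → ExAsymp (a + b) (Podd a b k) k)
    × (b < a → ExAsymp (a + b) (Peven a b k) k)
    × (a ≢ b → 2 ≤ a → 2 ≤ b →
    ∃[ N ] (∀ n → N ≤ n → ∀ (H : List (Subset n)) →
    Extremal (a + b) n (Podd a b k) H → IsoPsi (k ∸ 1) (a + b) n H)))
theorem1 a b (suc (suc c₁)) 1≤a 1≤b (s≤s (s≤s _)) = part₁ , part₂ , part₃
  where
  c = suc c₁
  k = suc c
  oddFree : ∀ r {n} (V : List (Fin n)) → length V ≡ c → ¬ Contains (star r V) (Podd a b k)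
  oddFree r V lV = star-free r a b k (k * (a + b)) (2 * k ∸ 1) V (s≤s (≤-reflexive lV)) 2i<2k∸1
  straight : ∀ {n} (H : List (Subset n)) → ¬ Contains H (Podd a b k) → ∀ bs → ¬ BlockPath H a b (2 * k ∸ 1) bs
  straight H free bs p = free (odd-path⇒Podd k (s≤s z≤n) p)
  reversed : ∀ {n} (H : List (Subset n)) → ¬ Contains H (Podd a b k) → ∀ bs → ¬ BlockPath H b a (2 * k ∸ 1) bs
  reversed H free bs p = free (odd-path⇒Podd k (s≤s z≤n) (reverse-path k (s≤s z≤n) p))
  part₁ : (a + b) % 2 ≡ 1 → ExAsymp (a + b) (Podd a b k) k
  part₁ odd with <-cmp a b
  ... | tri< a<b _ _ = subst (λ r → ExAsymp r (Podd a b k) k) (+-comm b a)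
        (asymptotics b a c (Podd a b k) 1≤a a<b (λ H free → noOdd⇒noEven c (reversed H free)) (oddFree (b + a)))
  ... | tri> _ _ b<a = asymptotics a b c (Podd a b k) 1≤b b<a (λ H free → noOdd⇒noEven c (straight H free)) (oddFree (a + b))
  -- Odd r serves to exclude a = b; the other two cases differ by reversing the path.
  ... | tri≈ _ refl _ = contradiction (trans (sym odd) (trans (cong (_% 2) (trans (cong (a +_) (sym (+-identityʳ a))) (*-comm 2 a))) (m*n%n≡0 a 2))) (λ ())
  part₂ : b < a → ExAsymp (a + b) (Peven a b k) k
  part₂ b<a = asymptotics a b c (Peven a b k) 1≤b b<a (λ H free bs p → free (even-path⇒Peven k p))
    (λ V lV → star-free (a + b) a b k (k * (a + b) + a) (2 * k) V (s≤s (≤-reflexive lV)) 2i<2k)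
  part₃ : a ≢ b → 2 ≤ a → 2 ≤ b → ∃[ N ] (∀ n → N ≤ n → ∀ (H : List (Subset n)) → Extremal (a + b) n (Podd a b k) H → IsoPsi c (a + b) n H)
  part₃ a≢b 2≤a 2≤b with <-cmp a b
  ... | tri≈ _ a≡b _ = contradiction a≡b a≢b
  ... | tri> _ _ b<a = let (N , unq) = uniqueness a b c 2≤b b<a (s≤s z≤n) in N , λ n N≤n H (rg , free , max) →
        unq n N≤n H rg (straight H free) (λ V lV → max (star (a + b) V) (star-isRGraph (a + b) V) (oddFree (a + b) V lV))
  ... | tri< a<b _ _ = let (N , unq) = uniqueness b a c 2≤a a<b (s≤s z≤n) in N , λ n N≤n H (rg , free , max) →
        subst (λ r → IsoPsi c r n H) (+-comm b a) (unq n N≤n H (subst (λ r → IsRGraph r n H) (+-comm a b) rg) (reversed H free)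
          (λ V lV → subst (λ r → length (star r V) ≤ length H) (+-comm a b) (max (star (a + b) V) (star-isRGraph (a + b) V) (oddFree (a + b) V lV))))
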